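{- Let $k$ be an algebraically closed field containing $\kappa$, and let $(A_m\subset\dots\subset A_1\subset B_1\subset\dots\subset B_m)\in\mathcal N^{\mathbf h}_{E/F}(k)$ be any point. Then its Bruhat–Tits type $I\subset\{0,\dots,m\}$ is not empty.
   Context: Fields. $p$ is an odd prime, $F/\mathbb Q_p$ a finite extension with ring of integers $\mathcal O_F$, uniformizer $\pi$, residue field $\mathbb F_q$; $E/F$ is the unramified quadratic extension with nontrivial automorphism $x\mapsto x^*$; $\breve E$ is the completion of the maximal unramified extension of $E$, with residue field $\kappa=\overline{\mathbb F}_{q}$. For a perfect field $R\supset\mathbb F_q$, $W_{\mathcal O_F}(R)$ is the ring of relative Witt vectors, $F_R$ its fraction field, and $\sigma$ the lift of $x\mapsto x^q$. Fix $n,m\ge 1$ and integers $\mathbf h=(h_1<\dots<h_m)$, $0\le h_i\le n$, all of the same parity. Hermitian space. A strict formal $\mathcal O_F$-module is a formal $p$-divisible group with $\mathcal O_F$-action inducing the natural action on its Lie algebra. Fix $\mathbb X^{[h_1]}=(\mathbb X,i_{\mathbb X},\lambda)$: $\mathbb X$ is a supersingular strict formal $\mathcal O_F$-module over $\mathbb F_{q^2}$ of relative $F$-height $2n$; $i_{\mathbb X}$ is an $\mathcal O_E$-action extending the $\mathcal O_F$-action with $\mathrm{charpol}(i_{\mathbb X}(x)\mid \mathrm{Lie}\,\mathbb X)=(T-x)(T-x^*)^{n-1}$; $\lambda:\mathbb X\to\mathbb X^\vee$ is an $\mathcal O_E$-linear polarization ($\mathbb X^\vee$ having the action $i_{\mathbb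 X}(x^*)^\vee$) whose kernel lies in $\mathbb X[\pi]$ and has order $q^{2h_1}$. Let $\mathbb N$ be its rational relative Dieudonné module, with Frobenius $\mathcal F$ and Verschiebung $\mathcal V$ ($\mathcal F\mathcal V=\pi$), and pairing $\langle\cdot,\cdot\rangle$ induced by $\lambda$, with $\langle\mathcal Fv,w\rangle=\langle v,\mathcal Vw\rangle^\sigma$ and $\langle i_{\mathbb X}(x)v,w\rangle=\langle v,i_{\mathbb X}(x^*)w\rangle$. For $k\supset\kappa$ algebraically closed, $\mathbb N_k=\mathbb N\otimes F_k=\mathbb N_{k,0}\oplus\mathbb N_{k,1}$, where $E$ acts on $\mathbb N_{k,0}$ via a fixed $F$-isomorphism $\varphi_0:E\simeq F_{\mathbb F_{q^2}}$ and on $\mathbb N_{k,1}$ via its conjugate. Put $\tau=\pi\mathcal V^{ -2}$ and $C=\mathbb N_{k,0}^{\tau}$, an $n$-dimensional $F_{\mathbb F_{q^2}}$-space independent of $k$ with $C_k:=C\otimes F_k=\mathbb N_{k,0}$ and $\tau=\mathrm{id}\otimes\sigma^2$. The form $\{v,w\}=\delta\langle v,\mathcal Fw\rangle$ (with fixed $\delta\in W_{\mathcal O_F}(\mathbb F_{q^2})^\times$, $\delta^\sigma=-\delta$) is left linear, right $\sigma$-linear, nondegenerate on $C_k$, and hermitian on $C$. For a lattice $A$ in $C_k$ (over $W_{\mathcal O_F}(k)$) or in $C$ (over $W_{\mathcal O_F}(\mathbb F_{q^2})$), $A^\vee$ is the set of $v$ such that $\{v,A\}$ is integral; one has $(A^\vee)^\vee=\tau(A)$.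 $A\overset{x}{\subset}B$ means $A\subset B$ with $B/A$ of length $x$. Points. $\mathcal N^{\mathbf h}_{E/F}(k)$ (the $k$-points of the basic unramified unitary Rapoport–Zink space of signature $(1,n-1)$ and level $\mathbf h$) is identified with the set of chains of $W_{\mathcal O_F}(k)$-lattices $A_m\subset\dots\subset A_1\subset B_1\subset\dots\subset B_m$ in $C_k$ such that for all $1\le i\le m$: $\pi A_i^\vee\overset{1}{\subset}B_i\subset A_i^\vee$, $\pi B_i^\vee\overset{1}{\subset}A_i\subset B_i^\vee$, and $\pi B_i\subset A_i\overset{h_i}{\subset}B_i$. Vertex lattices. For $i\in\mathbb Z$, $\mathcal L_i$ is the set of $W_{\mathcal O_F}(\mathbb F_{q^2})$-lattices $\Lambda\subset C$ with $\pi^{i+1}\Lambda^\vee\subset\Lambda\subset\pi^i\Lambda^\vee$. Bruhat–Tits type. For a lattice $M\subset C_k$ put $T_s(M)=M+\tau(M)+\dots+\tau^{s-1}(M)$; for the $A_i,B_i$ above this is $\tau$-stable for $s$ large. Let $\Lambda_{A_i},\Lambda_{B_i}\subset C$ be the $W_{\mathcal O_F}(\mathbb F_{q^2})$-lattices with $\Lambda_{A_i}\otimes W_{\mathcal O_F}(k)=T_s(A_i)$ and $\Lambda_{B_i}\otimes W_{\mathcal O_F}(k)=T_s(B_i)$ for $s$ large. The Bruhat–Tits type of the point is the subset $I\subset\{0,\dots,m\}$ such that: $0\in I$ iff $\Lambda_{A_1}\in\mathcal L_1$; $m\in I$ iff $\Lambda_{B_m}\in\mathcal L_0$; and for $1\le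 i\le m-1$, $i\in I$ iff $\Lambda_{B_i}\subset\pi\Lambda_{A_{i+1}}^\vee$. -}

module Defs where

open import Algebra.Bundles using (AbelianGroup; CommutativeRing; RawRing)
open import Algebra.Core using (Op₁; Op₂)
import Algebra.Definitions.RawMonoid as RawMonoidDefs
import Algebra.Definitions.RawSemiring as RawSemiringDefs
open import Algebra.Module.Bundles using (Module)
import Algebra.Morphism.Construct.Composition as Composition
open import Algebra.Morphism.Structures using (module RingMorphisms)
open import Algebra.Structures using (IsCommutativeRing)
open import Data.Bool.Base using (if_then_else_)
open import Data.Fin.Base using (Fin; zero; suc; toℕ; inject₁; fromℕ; punchIn)
  renaming (_<_ to _<ᶠ_)
open import Data.Fin.Properties using () renaming (_≟_ to _≟ᶠ_)
open import Data.Fin.Relation.Unary.Top using (view; ‵fromℕ; ‵inject₁)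
open import Data.Integer.Base using (ℤ; +_; -[1+_]; 0ℤ; 1ℤ)
  renaming (_+_ to _+ℤ_; _*_ to _*ℤ_; _-_ to _-ℤ_; -_ to -ℤ_)
import Data.Integer.Divisibility.Signed as ℤ∣
import Data.Integer.Properties as ℤₚᵣ
open import Data.Integer.Tactic.RingSolver using (solve-∀)
open import Data.Nat.Base using (ℕ; zero; suc; pred; _∸_; _%_; _≤_; _<_)
  renaming (_*_ to _*ℕ_; _^_ to _^ℕ_)
open import Data.Product.Base using (∃; _×_; _,_)
open import Data.Sum.Base using (_⊎_)
open import Function.Base using (_∘_)
open import Function.Bundles using (Bijection; _⇔_)
open import Function.Definitions using (Injective; Surjective; Inverseᵇ)
open import Level using (Level; 0ℓ; _⊔_) renaming (suc to lsuc)
open import Relation.Binary.PropositionalEquality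
  using (_≡_; refl; sym; subst; setoid)
open import Relation.Nullary.Decidable.Core using (does)
open import Relation.Nullary.Negation.Core using (¬_)
open import Relation.Unary using (Pred; U; _∈_; _⊆_; _≐_)

private
  variable
    a b c ℓ ℓ′ : Level

IsHom : (R : CommutativeRing a b) (S : CommutativeRing c ℓ) →
        (CommutativeRing.Carrier R → CommutativeRing.Carrier S) → Set _
IsHom R S = RingMorphisms.IsRingHomomorphism
              (CommutativeRing.rawRing R) (CommutativeRing.rawRing S)

-- as the library's RingHomomorphism, but indexed by lawful rings
record Hom (R : CommutativeRing a b) (S : CommutativeRing c ℓ) : Set (a ⊔ b ⊔ c ⊔ ℓ) where
  field
    ⟦_⟧   : CommutativeRing.Carrier R → CommutativeRing.Carrier S
    isHom : IsHom R S ⟦_⟧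

open Hom using (⟦_⟧)

infixr 9 _∘ʰ_
_∘ʰ_ : {R : CommutativeRing a b} {S : CommutativeRing c ℓ} {T : CommutativeRing ℓ ℓ} →
       Hom S T → Hom R S → Hom R T
_∘ʰ_ {T = T} g f = record
  { ⟦_⟧ = ⟦ g ⟧ ∘ ⟦ f ⟧
  ; isHom = Composition.isRingHomomorphism (CommutativeRing.trans T) (Hom.isHom f) (Hom.isHom g) }

IsInjective : {R : CommutativeRing a b} {S : CommutativeRing c ℓ} → Hom R S → Set _
IsInjective {R = R} {S} f = Injective (CommutativeRing._≈_ R) (CommutativeRing._≈_ S) ⟦ f ⟧

IsSurjective : {R : CommutativeRing a b} {S : CommutativeRing c ℓ} → Hom R S → Set _
IsSurjective {R = R} {S} f = Surjective (CommutativeRing._≈_ R) (CommutativeRing._≈_ S) ⟦ f ⟧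

record Field ℓ : Set (lsuc ℓ) where
  field
    commutativeRing : CommutativeRing ℓ ℓ
  open CommutativeRing commutativeRing public
  open RawSemiringDefs (RawRing.rawSemiring rawRing) public using (_^_; sum)
  field
    1≉0     : ¬ (1# ≈ 0#)
    inverse : ∀ x → ¬ (x ≈ 0#) → ∃ λ y → x * y ≈ 1#

  ring′ : CommutativeRing ℓ ℓ
  ring′ = commutativeRing

open Field using (ring′)

record IsFractionField (R : CommutativeRing a b) (K : Field ℓ) (ι : Hom R (ring′ K)) :
       Set (a ⊔ b ⊔ ℓ) where
  open Field K
  field
    injective : IsInjective ι
    fraction  : ∀ x → ∃ λ r → ∃ λ s → ¬ (⟦ ι ⟧ s ≈ 0#) × ⟦ ι ⟧ s * x ≈ ⟦ ι ⟧ r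

IsIntegralOver : (R : CommutativeRing a b) (S : CommutativeRing ℓ ℓ) → Hom R S →
                 CommutativeRing.Carrier S → Set _
IsIntegralOver R S f x =
  ∃ λ d → ∃ λ (r : Fin d → CommutativeRing.Carrier R) →
    x ^ d + sum (λ i → ⟦ f ⟧ (r i) * x ^ toℕ i) ≈ 0#
  where
  open CommutativeRing S
  open RawSemiringDefs (RawRing.rawSemiring rawRing) using (_^_; sum)

record IsIntegralClosure (R : CommutativeRing a b) (S O : CommutativeRing ℓ ℓ)
                         (f : Hom R S) (g : Hom O S) : Set (a ⊔ ℓ) where
  open CommutativeRing S using (_≈_)
  field
    injective : IsInjective g
    image     : ∀ x → IsIntegralOver R S f x ⇔ ∃ λ o → ⟦ g ⟧ o ≈ x

IsAlgebraicallyClosed : Field ℓ → Set ℓ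
IsAlgebraicallyClosed K =
  ∀ d (r : Fin (suc d) → Carrier) → ∃ λ x → x ^ suc d + sum (λ i → r i * x ^ toℕ i) ≈ 0#
  where open Field K

-- For a field k this says that K/k is algebraic and K is algebraically closed.
IsAlgebraicClosure : (k K : Field ℓ) → Hom (ring′ k) (ring′ K) → Set ℓ
IsAlgebraicClosure k K f =
  (∀ x → IsIntegralOver (ring′ k) (ring′ K) f x) × IsAlgebraicallyClosed K

-- ℤ_p as lim ℤ/pⁿ: the n-th term is an integer that matters only modulo pⁿ
module PAdic (p : ℕ) where

  open ℤ∣ using (_∣_)

  record Carrierₚ : Set where
    field
      term     : ℕ → ℤ
      coherent : ∀ n → + (p ^ℕ n) ∣ term (suc n) -ℤ term n
  open Carrierₚ

  _≈ₚ_ : Carrierₚ → Carrierₚ → Set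
  x ≈ₚ y = ∀ n → + (p ^ℕ n) ∣ term x n -ℤ term y n

  private
    ∣-add : ∀ {d s t u} → d ∣ s → d ∣ t → u ≡ s +ℤ t → d ∣ u
    ∣-add d∣s d∣t refl = ℤ∣.∣m∣n⇒∣m+n d∣s d∣t

    ≡⇒∣ : ∀ {d s t} → s ≡ t → d ∣ s -ℤ t
    ≡⇒∣ {d} {s} refl = subst (d ∣_) (sym (ℤₚᵣ.+-inverseʳ s)) (ℤ∣.divides 0ℤ refl)

    sum-diff : ∀ s s′ t t′ → (s +ℤ t) -ℤ (s′ +ℤ t′) ≡ (s -ℤ s′) +ℤ (t -ℤ t′)
    sum-diff = solve-∀

    prod-diff : ∀ s s′ t t′ → (s *ℤ t) -ℤ (s′ *ℤ t′) ≡ (s *ℤ (t -ℤ t′)) +ℤ (t′ *ℤ (s -ℤ s′))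
    prod-diff = solve-∀

    neg-diff : ∀ s s′ → (-ℤ s) -ℤ (-ℤ s′) ≡ -ℤ (s -ℤ s′)
    neg-diff = solve-∀

    swap-diff : ∀ s s′ → s′ -ℤ s ≡ -ℤ (s -ℤ s′)
    swap-diff = solve-∀

    trans-diff : ∀ s t u → s -ℤ u ≡ (s -ℤ t) +ℤ (t -ℤ u)
    trans-diff = solve-∀

    ∣-sum : ∀ {d} s s′ t t′ → d ∣ s -ℤ s′ → d ∣ t -ℤ t′ → d ∣ (s +ℤ t) -ℤ (s′ +ℤ t′)
    ∣-sum s s′ t t′ p₁ p₂ = ∣-add p₁ p₂ (sum-diff s s′ t t′)

    ∣-prod : ∀ {d} s s′ t t′ → d ∣ s -ℤ s′ → d ∣ t -ℤ t′ → d ∣ (s *ℤ t) -ℤ (s′ *ℤ t′)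
    ∣-prod s s′ t t′ p₁ p₂ =
      ∣-add (ℤ∣.∣n⇒∣m*n s p₂) (ℤ∣.∣n⇒∣m*n t′ p₁) (prod-diff s s′ t t′)

    ∣-neg : ∀ {d} s s′ → d ∣ s -ℤ s′ → d ∣ (-ℤ s) -ℤ (-ℤ s′)
    ∣-neg {d} s s′ p₁ = subst (d ∣_) (sym (neg-diff s s′)) (ℤ∣.∣m⇒∣-m p₁)

    const : ℤ → Carrierₚ
    const z = record { term = λ _ → z ; coherent = λ _ → ≡⇒∣ {s = z} refl }

    _+ₚ_ _*ₚ_ : Op₂ Carrierₚ
    x +ₚ y = record
      { term     = λ n → term x n +ℤ term y n
      ; coherent = λ n → ∣-sum (term x (suc n)) (term x n) (term y (suc n)) (term y n)
                           (coherent x n) (coherent y n) }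
    x *ₚ y = record
      { term     = λ n → term x n *ℤ term y n
      ; coherent = λ n → ∣-prod (term x (suc n)) (term x n) (term y (suc n)) (term y n)
                           (coherent x n) (coherent y n) }

    -ₚ_ : Op₁ Carrierₚ
    -ₚ x = record
      { term     = λ n → -ℤ term x n
      ; coherent = λ n → ∣-neg (term x (suc n)) (term x n) (coherent x n) }

  ℤₚ : CommutativeRing 0ℓ 0ℓ
  ℤₚ = record
    { Carrier = Carrierₚ ; _≈_ = _≈ₚ_ ; _+_ = _+ₚ_ ; _*_ = _*ₚ_ ; -_ = -ₚ_
    ; 0# = const 0ℤ ; 1# = const 1ℤ
    ; isCommutativeRing = record
      { isRing = record
        { +-isAbelianGroup = record
          { isGroup = record
            { isMonoid = record
              { isSemigroup = record
                { isMagma = record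
                  { isEquivalence = record
                    { refl  = λ {x} n → ≡⇒∣ {s = term x n} refl
                    ; sym   = λ {x} {y} e n → subst (+ (p ^ℕ n) ∣_)
                                (sym (swap-diff (term x n) (term y n))) (ℤ∣.∣m⇒∣-m (e n))
                    ; trans = λ {x} {y} {z} e f n →
                                ∣-add (e n) (f n) (trans-diff (term x n) (term y n) (term z n)) }
                  ; ∙-cong = λ {x} {x′} {y} {y′} e f n →
                      ∣-sum (term x n) (term x′ n) (term y n) (term y′ n) (e n) (f n) }
                ; assoc = λ x y z n → ≡⇒∣ (ℤₚᵣ.+-assoc (term x n) (term y n) (term z n)) }
              ; identity = (λ x n → ≡⇒∣ (ℤₚᵣ.+-identityˡ (term x n)))
                         , (λ x n → ≡⇒∣ (ℤₚᵣ.+-identityʳ (term x n))) }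
            ; inverse = (λ x n → ≡⇒∣ (ℤₚᵣ.+-inverseˡ (term x n)))
                      , (λ x n → ≡⇒∣ (ℤₚᵣ.+-inverseʳ (term x n)))
            ; ⁻¹-cong = λ {x} {x′} e n → ∣-neg (term x n) (term x′ n) (e n) }
          ; comm = λ x y n → ≡⇒∣ (ℤₚᵣ.+-comm (term x n) (term y n)) }
        ; *-cong = λ {x} {x′} {y} {y′} e f n →
            ∣-prod (term x n) (term x′ n) (term y n) (term y′ n) (e n) (f n)
        ; *-assoc = λ x y z n → ≡⇒∣ (ℤₚᵣ.*-assoc (term x n) (term y n) (term z n))
        ; *-identity = (λ x n → ≡⇒∣ (ℤₚᵣ.*-identityˡ (term x n)))
                     , (λ x n → ≡⇒∣ (ℤₚᵣ.*-identityʳ (term x n)))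
        ; distrib = (λ x y z n → ≡⇒∣ (ℤₚᵣ.*-distribˡ-+ (term x n) (term y n) (term z n)))
                  , (λ x y z n → ≡⇒∣ (ℤₚᵣ.*-distribʳ-+ (term x n) (term y n) (term z n))) }
      ; *-comm = λ x y n → ≡⇒∣ (ℤₚᵣ.*-comm (term x n) (term y n)) } }

open PAdic using (ℤₚ)

module LinearAlgebra {ℓ} (K : CommutativeRing ℓ ℓ) (G : AbelianGroup ℓ ℓ)
  (_·_ : CommutativeRing.Carrier K → AbelianGroup.Carrier G → AbelianGroup.Carrier G) where

  private
    module K = CommutativeRing K
    module G = AbelianGroup G

  lincomb : ∀ {d} → (Fin d → K.Carrier) → (Fin d → G.Carrier) → G.Carrier
  lincomb x b = RawMonoidDefs.sum G.rawMonoid (λ i → x i · b i)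

  record IsBasis {d} (S : Pred G.Carrier ℓ′) (b : Fin d → G.Carrier) : Set (ℓ ⊔ ℓ′) where
    field
      member      : ∀ i → b i ∈ S
      spanning    : ∀ v → v ∈ S → ∃ λ x → v G.≈ lincomb x b
      independent : ∀ x → lincomb x b G.≈ G.ε → ∀ i → x i K.≈ K.0#

  HasDimension : ℕ → Pred G.Carrier ℓ′ → Set _
  HasDimension d S = ∃ λ (b : Fin d → G.Carrier) → IsBasis S b

module Lattices {ℓ} {W K : CommutativeRing ℓ ℓ} (ι : Hom W K) (G : AbelianGroup ℓ ℓ)
  (_·_ : CommutativeRing.Carrier K → AbelianGroup.Carrier G → AbelianGroup.Carrier G) where

  private
    module W = CommutativeRing W
    module G = AbelianGroup G

    _·ʷ_ : W.Carrier → G.Carrier → G.Carrier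
    w ·ʷ v = ⟦ ι ⟧ w · v

  open LinearAlgebra K G _·_ using (IsBasis)
  open LinearAlgebra W G _·ʷ_ using (lincomb)

  record IsSubmodule (P : Pred G.Carrier ℓ) : Set ℓ where
    field
      resp   : ∀ {u v} → u G.≈ v → u ∈ P → v ∈ P
      zero∈  : G.ε ∈ P
      +-closed : ∀ {u v} → u ∈ P → v ∈ P → (u G.∙ v) ∈ P
      ·-closed : ∀ w {v} → v ∈ P → (w ·ʷ v) ∈ P

  spanOf : ∀ {d} → (Fin d → G.Carrier) → Pred G.Carrier ℓ
  spanOf b v = ∃ λ w → v G.≈ lincomb w b

  -- P is a W-lattice in the K-subspace S, where dim S = d
  IsLattice : ℕ → Pred G.Carrier ℓ′ → Pred G.Carrier ℓ → Set _
  IsLattice d S P = ∃ λ (b : Fin d → G.Carrier) → IsBasis S b × P ≐ spanOf b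

  -- the W-submodule generated by a subset
  Generated : Pred G.Carrier ℓ → Pred G.Carrier ℓ
  Generated P v = ∃ λ d → ∃ λ (b : Fin d → G.Carrier) → (∀ i → b i ∈ P) × v ∈ spanOf b

  -- Q/P is a simple W-module
  record _⋖_ (P Q : Pred G.Carrier ℓ) : Set (lsuc ℓ) where
    field
      included : P ⊆ Q
      proper   : ¬ (Q ⊆ P)
      simple   : ∀ X → IsSubmodule X → P ⊆ X → X ⊆ Q → X ⊆ P ⊎ Q ⊆ X

  -- P ⊂[ x ] Q : P ⊂ Q with Q/P of length x, witnessed by a composition series
  data _⊂[_]_ (P : Pred G.Carrier ℓ) : ℕ → Pred G.Carrier ℓ → Set (lsuc ℓ) where
    done : ∀ {Q} → P ≐ Q → P ⊂[ 0 ] Q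
    step : ∀ {x X Q} → P ⊂[ x ] X → IsSubmodule Q → X ⋖ Q → P ⊂[ suc x ] Q

module _ {a b} (R : RawRing a b) where

  private
    module R = RawRing R
    sumR : ∀ {d} → (Fin d → R.Carrier) → R.Carrier
    sumR = RawMonoidDefs.sum R.+-rawMonoid

  -- R[T], a polynomial being given by its sequence of coefficients
  polynomials : RawRing a b
  polynomials = record
    { Carrier = ℕ → R.Carrier
    ; _≈_ = λ f g → ∀ i → f i R.≈ g i
    ; _+_ = λ f g i → f i R.+ g i
    ; _*_ = λ f g i → sumR {suc i} (λ j → f (toℕ j) R.* g (i ∸ toℕ j))
    ; -_  = λ f i → R.- f i
    ; 0#  = λ _ → R.0#
    ; 1#  = λ { zero → R.1# ; (suc _) → R.0# }
    }

  constant : R.Carrier → ℕ → R.Carrier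
  constant r zero    = r
  constant r (suc _) = R.0#

  indeterminate : ℕ → R.Carrier
  indeterminate (suc zero) = R.1#
  indeterminate _          = R.0#

  det : ∀ {d} → (Fin d → Fin d → R.Carrier) → R.Carrier
  det {zero}  X = R.1#
  det {suc d} X = sumR λ j →
    ((R.- R.1#) ^ toℕ j R.* X zero j) R.* det (λ i l → X (suc i) (punchIn j l))
    where open RawSemiringDefs R.rawSemiring using (_^_)

charpol : ∀ (R : RawRing a b) {d} → (Fin d → Fin d → RawRing.Carrier R) → ℕ → RawRing.Carrier R
charpol R X = det R[T] λ i j →
  (if does (i ≟ᶠ j) then indeterminate R else R[T].0#) R[T].+ R[T].- constant R (X i j)
  where
  R[T] = polynomials R
  module R[T] = RawRing R[T]

record UnramifiedQuadraticExtension (p : ℕ) ℓ : Set (lsuc ℓ) where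
  field
    ℚₚ F E  : Field ℓ
    𝔽q 𝔽q²  : Field ℓ
    𝒪F 𝒪E   : CommutativeRing ℓ ℓ

  module ℚₚ = Field ℚₚ
  module F  = Field F
  module E  = Field E
  module 𝔽q  = Field 𝔽q
  module 𝔽q² = Field 𝔽q²
  module 𝒪F = CommutativeRing 𝒪F
  module 𝒪E = CommutativeRing 𝒪E

  field
    ℤₚ→ℚₚ  : Hom (ℤₚ p) ℚₚ.ring′
    isℚₚ   : IsFractionField (ℤₚ p) ℚₚ ℤₚ→ℚₚ

    ℚₚ→F   : Hom ℚₚ.ring′ F.ring′
    F/ℚₚ-finite : ∃ λ d → LinearAlgebra.HasDimension ℚₚ.ring′ F.+-abelianGroup
                    (λ x y → ⟦ ℚₚ→F ⟧ x F.* y) d U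
    F→E    : Hom F.ring′ E.ring′
    E/F-quadratic : LinearAlgebra.HasDimension F.ring′ E.+-abelianGroup
                      (λ x y → ⟦ F→E ⟧ x E.* y) 2 U

    𝒪F→F   : Hom 𝒪F F.ring′
    is𝒪F   : IsIntegralClosure (ℤₚ p) F.ring′ 𝒪F
               (ℚₚ→F ∘ʰ ℤₚ→ℚₚ) 𝒪F→F
    𝒪E→E   : Hom 𝒪E E.ring′
    is𝒪E   : IsIntegralClosure (ℤₚ p) E.ring′ 𝒪E
               (F→E ∘ʰ ℚₚ→F ∘ʰ ℤₚ→ℚₚ) 𝒪E→E
    𝒪F→𝒪E  : Hom 𝒪F 𝒪E
    𝒪F→𝒪E-compatible : ∀ x → ⟦ 𝒪E→E ⟧ (⟦ 𝒪F→𝒪E ⟧ x) E.≈ ⟦ F→E ⟧ (⟦ 𝒪F→F ⟧ x)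

    π      : 𝒪F.Carrier
    π≉0    : ¬ (π 𝒪F.≈ 𝒪F.0#)
    𝒪F→𝔽q  : Hom 𝒪F 𝔽q.ring′
    𝒪F→𝔽q-surjective : IsSurjective 𝒪F→𝔽q
    𝒪F→𝔽q-kernel     : ∀ x → (⟦ 𝒪F→𝔽q ⟧ x 𝔽q.≈ 𝔽q.0#) ⇔ (∃ λ y → x 𝒪F.≈ π 𝒪F.* y)
    q      : ℕ
    𝔽q-order : Bijection (setoid (Fin q)) 𝔽q.setoid

    -- E/F is unramified: π is also a uniformizer of 𝒪E
    𝒪E→𝔽q² : Hom 𝒪E 𝔽q².ring′
    𝒪E→𝔽q²-surjective : IsSurjective 𝒪E→𝔽q²
    𝒪E→𝔽q²-kernel     : ∀ x → (⟦ 𝒪E→𝔽q² ⟧ x 𝔽q².≈ 𝔽q².0#) ⇔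
                              (∃ λ y → x 𝒪E.≈ ⟦ 𝒪F→𝒪E ⟧ π 𝒪E.* y)
    𝔽q²-order : Bijection (setoid (Fin (q ^ℕ 2))) 𝔽q².setoid
    𝔽q→𝔽q² : Hom 𝔽q.ring′ 𝔽q².ring′
    𝔽q→𝔽q²-compatible : ∀ x → ⟦ 𝔽q→𝔽q² ⟧ (⟦ 𝒪F→𝔽q ⟧ x) 𝔽q².≈ ⟦ 𝒪E→𝔽q² ⟧ (⟦ 𝒪F→𝒪E ⟧ x)

    star   : Hom E.ring′ E.ring′
    star-F : ∀ x → ⟦ star ⟧ (⟦ F→E ⟧ x) E.≈ ⟦ F→E ⟧ x
    star-nontrivial : ∃ λ x → ¬ (⟦ star ⟧ x E.≈ x)

module _ {p ℓ} (D : UnramifiedQuadraticExtension p ℓ) where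

  open UnramifiedQuadraticExtension D

  record 𝒪F-Algebra : Set (lsuc ℓ) where
    field
      ring      : CommutativeRing ℓ ℓ
      structure : Hom 𝒪F ring
    open CommutativeRing ring public hiding (ring)
    open RawSemiringDefs (RawRing.rawSemiring rawRing) public using (_^_; sum)

    ghost : ℕ → (ℕ → Carrier) → Carrier
    ghost n x = sum {suc n} λ i →
      ⟦ structure ⟧ π ^ toℕ i * x (toℕ i) ^ (q ^ℕ (n ∸ toℕ i))

  -- The functor A ↦ W_{𝒪F}(A) on 𝒪F-algebras, by its defining property: as a
  -- functor to sets it is A ↦ A^ℕ, and the ghost components are natural
  -- homomorphisms of 𝒪F-algebras.  This determines the 𝒪F-algebra structures.
  record RelativeWittVectors : Set (lsuc ℓ) where
    field
      addʷ mulʷ   : ∀ A → Op₂ (ℕ → 𝒪F-Algebra.Carrier A)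
      negʷ        : ∀ A → Op₁ (ℕ → 𝒪F-Algebra.Carrier A)
      zeroʷ oneʷ  : ∀ A → ℕ → 𝒪F-Algebra.Carrier A
      isRingʷ     : ∀ A → IsCommutativeRing (λ x y → ∀ n → 𝒪F-Algebra._≈_ A (x n) (y n))
                            (addʷ A) (mulʷ A) (negʷ A) (zeroʷ A) (oneʷ A)

    W : 𝒪F-Algebra → CommutativeRing ℓ ℓ
    W A = record { isCommutativeRing = isRingʷ A }

    field
      structureʷ      : ∀ A → Hom 𝒪F (W A)
      map-isHom       : ∀ A B (f : Hom (𝒪F-Algebra.ring A) (𝒪F-Algebra.ring B)) →
                        (∀ x → 𝒪F-Algebra._≈_ B (⟦ f ⟧ (⟦ 𝒪F-Algebra.structure A ⟧ x))
                                               (⟦ 𝒪F-Algebra.structure B ⟧ x)) →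
                        IsHom (W A) (W B) (⟦ f ⟧ ∘_) ×
                        (∀ x n → 𝒪F-Algebra._≈_ B (⟦ f ⟧ (⟦ structureʷ A ⟧ x n))
                                                 (⟦ structureʷ B ⟧ x n))
      ghost-isHom     : ∀ A n → IsHom (W A) (𝒪F-Algebra.ring A) (𝒪F-Algebra.ghost A n)
      ghost-structure : ∀ A n x → 𝒪F-Algebra._≈_ A (𝒪F-Algebra.ghost A n (⟦ structureʷ A ⟧ x))
                                                  (⟦ 𝒪F-Algebra.structure A ⟧ x)

  asAlgebra : (R : Field ℓ) → Hom 𝔽q.ring′ (ring′ R) → 𝒪F-Algebra
  asAlgebra R j = record
    { ring = ring′ R
    ; structure = j ∘ʰ 𝒪F→𝔽q }

  -- 𝐅 = F_R with σ; on W_{𝒪F}(R) the lift σ = W_{𝒪F}(x ↦ x^q) acts componentwise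
  record WittFractionField (𝕎 : RelativeWittVectors) (R : Field ℓ)
                           (j : Hom 𝔽q.ring′ (ring′ R)) : Set (lsuc ℓ) where
    module R = Field R
    W : CommutativeRing ℓ ℓ
    W = RelativeWittVectors.W 𝕎 (asAlgebra R j)
    module W = CommutativeRing W

    frobʷ : W.Carrier → W.Carrier
    frobʷ x n = x n R.^ q

    field
      𝐅 : Field ℓ
    module 𝐅 = Field 𝐅
    field
      ι      : Hom W 𝐅.ring′
      isFrac : IsFractionField W 𝐅 ι
      σ      : Hom 𝐅.ring′ 𝐅.ring′
      σ-lift : ∀ x → ⟦ σ ⟧ (⟦ ι ⟧ x) 𝐅.≈ ⟦ ι ⟧ (frobʷ x)
      F→𝐅  : Hom F.ring′ 𝐅.ring′
      F→𝐅-compatible : ∀ x → ⟦ F→𝐅 ⟧ (⟦ 𝒪F→F ⟧ x) 𝐅.≈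
                               ⟦ ι ⟧ (⟦ RelativeWittVectors.structureʷ 𝕎 (asAlgebra R j) ⟧ x)

    π′ : 𝐅.Carrier
    π′ = ⟦ F→𝐅 ⟧ (⟦ 𝒪F→F ⟧ π)

    Integral : Pred 𝐅.Carrier ℓ
    Integral x = ∃ λ w → x 𝐅.≈ ⟦ ι ⟧ w

  -- The structure carried by the rational relative Dieudonné module of a polarized
  -- 𝕏 with 𝒪E-action; 𝒱-σ is σ⁻¹-linearity.
  record Isocrystal {𝕎 : RelativeWittVectors} {R : Field ℓ} {j : Hom 𝔽q.ring′ (ring′ R)}
                    (K : WittFractionField 𝕎 R j) (n : ℕ) : Set (lsuc ℓ) where
    open WittFractionField K using (module 𝐅; W; ι; σ; F→𝐅; π′; Integral)
    infix 8 ⟨_,_⟩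
    field
      module′ : Module 𝐅.ring′ ℓ ℓ
    open Module module′ public
      using (Carrierᴹ; _≈ᴹ_; _+ᴹ_; -ᴹ_; 0ᴹ; _*ₗ_; +ᴹ-abelianGroup)
    open LinearAlgebra 𝐅.ring′ +ᴹ-abelianGroup _*ₗ_ public
    open Lattices ι +ᴹ-abelianGroup _*ₗ_ public
    field
      height : HasDimension (2 *ℕ n) U

      ℱ 𝒱 𝒱⁻¹ : Carrierᴹ → Carrierᴹ
      ℱ-cong : ∀ {v w} → v ≈ᴹ w → ℱ v ≈ᴹ ℱ w
      𝒱-cong : ∀ {v w} → v ≈ᴹ w → 𝒱 v ≈ᴹ 𝒱 w
      ℱ-+    : ∀ v w → ℱ (v +ᴹ w) ≈ᴹ (ℱ v +ᴹ ℱ w)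
      𝒱-+    : ∀ v w → 𝒱 (v +ᴹ w) ≈ᴹ (𝒱 v +ᴹ 𝒱 w)
      ℱ-σ    : ∀ x v → ℱ (x *ₗ v) ≈ᴹ (⟦ σ ⟧ x *ₗ ℱ v)
      𝒱-σ    : ∀ x v → 𝒱 (⟦ σ ⟧ x *ₗ v) ≈ᴹ (x *ₗ 𝒱 v)
      ℱ𝒱     : ∀ v → ℱ (𝒱 v) ≈ᴹ (π′ *ₗ v)
      𝒱ℱ     : ∀ v → 𝒱 (ℱ v) ≈ᴹ (π′ *ₗ v)
      𝒱-inverse : Inverseᵇ _≈ᴹ_ _≈ᴹ_ 𝒱 𝒱⁻¹

      ⟨_,_⟩  : Carrierᴹ → Carrierᴹ → 𝐅.Carrier
      ⟨⟩-cong : ∀ {u v w x} → u ≈ᴹ v → w ≈ᴹ x → ⟨ u , w ⟩ 𝐅.≈ ⟨ v , x ⟩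
      ⟨⟩-+ˡ  : ∀ u v w → ⟨ u +ᴹ v , w ⟩ 𝐅.≈ ⟨ u , w ⟩ 𝐅.+ ⟨ v , w ⟩
      ⟨⟩-+ʳ  : ∀ u v w → ⟨ u , v +ᴹ w ⟩ 𝐅.≈ ⟨ u , v ⟩ 𝐅.+ ⟨ u , w ⟩
      ⟨⟩-*ˡ  : ∀ x v w → ⟨ x *ₗ v , w ⟩ 𝐅.≈ x 𝐅.* ⟨ v , w ⟩
      ⟨⟩-*ʳ  : ∀ x v w → ⟨ v , x *ₗ w ⟩ 𝐅.≈ x 𝐅.* ⟨ v , w ⟩
      ⟨⟩-alternating   : ∀ v → ⟨ v , v ⟩ 𝐅.≈ 𝐅.0#
      ⟨⟩-nondegenerate : ∀ v → (∀ w → ⟨ v , w ⟩ 𝐅.≈ 𝐅.0#) → v ≈ᴹ 0ᴹ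
      ⟨⟩-ℱ𝒱 : ∀ v w → ⟨ ℱ v , w ⟩ 𝐅.≈ ⟦ σ ⟧ ⟨ v , 𝒱 w ⟩

      act    : E.Carrier → Carrierᴹ → Carrierᴹ
      act-cong : ∀ {x y v w} → x E.≈ y → v ≈ᴹ w → act x v ≈ᴹ act y w
      act-+ᴹ : ∀ x v w → act x (v +ᴹ w) ≈ᴹ (act x v +ᴹ act x w)
      act-*ₗ : ∀ x y v → act x (y *ₗ v) ≈ᴹ (y *ₗ act x v)
      act-+  : ∀ x y v → act (x E.+ y) v ≈ᴹ (act x v +ᴹ act y v)
      act-*  : ∀ x y v → act (x E.* y) v ≈ᴹ act x (act y v)
      act-F  : ∀ x v → act (⟦ F→E ⟧ x) v ≈ᴹ (⟦ F→𝐅 ⟧ x *ₗ v)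
      act-ℱ  : ∀ x v → act x (ℱ v) ≈ᴹ ℱ (act x v)
      act-𝒱  : ∀ x v → act x (𝒱 v) ≈ᴹ 𝒱 (act x v)
      ⟨⟩-act : ∀ x v w → ⟨ act x v , w ⟩ 𝐅.≈ ⟨ v , act (⟦ star ⟧ x) w ⟩

    image : (Carrierᴹ → Carrierᴹ) → Pred Carrierᴹ ℓ → Pred Carrierᴹ ℓ
    image f P v = ∃ λ u → u ∈ P × v ≈ᴹ f u

  -- The polarized strict formal 𝒪F-module 𝕏^[h] over 𝔽q², given through relative
  -- Dieudonné theory by its Dieudonné module M inside N = M[1/π].  (Being formal,
  -- i.e. 𝒱 topologically nilpotent on M, follows from supersingularity.)
  record FramingObject {𝕎 : RelativeWittVectors}
                       (K : WittFractionField 𝕎 𝔽q² 𝔽q→𝔽q²) (n h : ℕ) : Set (lsuc ℓ) where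
    open WittFractionField K using (module 𝐅; module W; W; ι; π′; Integral)
    field
      N : Isocrystal K n
    open Isocrystal N
    field
      M          : Pred Carrierᴹ ℓ
      M-lattice  : IsLattice (2 *ℕ n) U M
      M-ℱ        : ∀ {v} → v ∈ M → ℱ v ∈ M
      M-𝒱        : ∀ {v} → v ∈ M → 𝒱 v ∈ M
      M-act      : ∀ x {v} → v ∈ M → act (⟦ 𝒪E→E ⟧ x) v ∈ M

      -- all slopes are 1/2
      supersingular : ∃ λ L → IsLattice (2 *ℕ n) U L ×
                        image (𝒱 ∘ 𝒱) L ≐ image (π′ *ₗ_) L

    M^⊥ : Pred Carrierᴹ ℓ
    M^⊥ v = ∀ w → w ∈ M → ⟨ v , w ⟩ ∈ Integral

    field
      -- M^⊥/M is the Dieudonné module of ker λ, and length d corresponds to order q^d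
      kernel-order : M ⊂[ 2 *ℕ h ] M^⊥
      kernel-π     : image (π′ *ₗ_) M^⊥ ⊆ M

    reduction : W.Carrier → 𝔽q².Carrier
    reduction w = w 0

    𝒱M : Pred Carrierᴹ ℓ
    𝒱M = image 𝒱 M

    open LinearAlgebra W +ᴹ-abelianGroup (λ w v → ⟦ ι ⟧ w *ₗ v) public
      using () renaming (lincomb to lincombʷ)

    field
      -- representatives in M of an 𝔽q²-basis of Lie 𝕏 = M/𝒱M
      lie          : Fin n → Carrierᴹ
      lie-member   : ∀ i → lie i ∈ M
      lie-spanning : ∀ v → v ∈ M → ∃ λ w → (v +ᴹ -ᴹ lincombʷ w lie) ∈ 𝒱M
      lie-independent : ∀ w → lincombʷ w lie ∈ 𝒱M → ∀ i → reduction (w i) 𝔽q².≈ 𝔽q².0#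

    private
      𝔽q²[T] = polynomials 𝔽q².rawRing
      module 𝔽q²[T] = RawRing 𝔽q²[T]
      open RawSemiringDefs 𝔽q²[T].rawSemiring using (_^_)

      T-_ : 𝔽q².Carrier → 𝔽q²[T].Carrier
      T- r = indeterminate 𝔽q².rawRing 𝔽q²[T].+ 𝔽q²[T].- constant 𝔽q².rawRing r

    field
      -- signature (1,n-1); X is (a lift to W of) the matrix of x ∈ 𝒪E on Lie 𝕏
      signature : ∀ (x x* : 𝒪E.Carrier) → ⟦ 𝒪E→E ⟧ x* E.≈ ⟦ star ⟧ (⟦ 𝒪E→E ⟧ x) →
        ∀ (X : Fin n → Fin n → W.Carrier) →
        (∀ l → (act (⟦ 𝒪E→E ⟧ x) (lie l) +ᴹ -ᴹ lincombʷ (λ i → X i l) lie) ∈ 𝒱M) →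
        charpol 𝔽q².rawRing (λ i l → reduction (X i l)) 𝔽q²[T].≈
          ((T- ⟦ 𝒪E→𝔽q² ⟧ x) 𝔽q²[T].* (T- ⟦ 𝒪E→𝔽q² ⟧ x*) ^ pred n)

  record AlgebraicallyClosedExtension : Set (lsuc ℓ) where
    field
      κ k       : Field ℓ
      𝔽q²→κ     : Hom 𝔽q².ring′ (ring′ κ)
      isκ       : IsAlgebraicClosure 𝔽q² κ 𝔽q²→κ
      κ→k       : Hom (ring′ κ) (ring′ k)
      k-closed  : IsAlgebraicallyClosed k

    𝔽q²→k : Hom 𝔽q².ring′ (ring′ k)
    𝔽q²→k = κ→k ∘ʰ 𝔽q²→κ

    𝔽q→k : Hom 𝔽q.ring′ (ring′ k)
    𝔽q→k = 𝔽q²→k ∘ʰ 𝔽q→𝔽q²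

  -- Base change of 𝕏's isocrystal to k, with the choices of φ₀ and δ that define
  -- Nₖ₀ and the hermitian form
  record BaseChange {𝕎 : RelativeWittVectors} {n h : ℕ}
                    (K₂ : WittFractionField 𝕎 𝔽q² 𝔽q→𝔽q²) (𝕏 : FramingObject K₂ n h)
                    (X : AlgebraicallyClosedExtension) : Set (lsuc ℓ) where
    open AlgebraicallyClosedExtension X
    module K₂ = WittFractionField K₂
    module N = Isocrystal (FramingObject.N 𝕏)
    field
      Kₖ : WittFractionField 𝕎 k 𝔽q→k
    module Kₖ = WittFractionField Kₖ
    module F₂ = Field K₂.𝐅
    module Fₖ = Field Kₖ.𝐅
    field
      F₂→Fₖ : Hom F₂.ring′ Fₖ.ring′
      F₂→Fₖ-functorial : ∀ x → ⟦ F₂→Fₖ ⟧ (⟦ K₂.ι ⟧ x) Fₖ.≈ ⟦ Kₖ.ι ⟧ (⟦ 𝔽q²→k ⟧ ∘ x)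

      -- Nₖ = N ⊗ Fₖ with the Fₖ-(semi)linear extensions of all structures
      Nₖ : Isocrystal Kₖ n
    module Nₖ = Isocrystal Nₖ
    field
      base       : N.Carrierᴹ → Nₖ.Carrierᴹ
      base-cong  : ∀ {v w} → v N.≈ᴹ w → base v Nₖ.≈ᴹ base w
      base-+     : ∀ v w → base (v N.+ᴹ w) Nₖ.≈ᴹ (base v Nₖ.+ᴹ base w)
      base-*ₗ    : ∀ x v → base (x N.*ₗ v) Nₖ.≈ᴹ (⟦ F₂→Fₖ ⟧ x Nₖ.*ₗ base v)
      base-basis : ∀ (b : Fin (2 *ℕ n) → N.Carrierᴹ) →
                   N.IsBasis U b → Nₖ.IsBasis U (base ∘ b)
      base-ℱ     : ∀ v → base (N.ℱ v) Nₖ.≈ᴹ Nₖ.ℱ (base v)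
      base-𝒱     : ∀ v → base (N.𝒱 v) Nₖ.≈ᴹ Nₖ.𝒱 (base v)
      base-⟨⟩    : ∀ v w → ⟦ F₂→Fₖ ⟧ N.⟨ v , w ⟩ Fₖ.≈ Nₖ.⟨ base v , base w ⟩
      base-act   : ∀ x v → base (N.act x v) Nₖ.≈ᴹ Nₖ.act x (base v)

      φ₀             : Hom E.ring′ F₂.ring′
      φ₀-isomorphism : IsInjective φ₀ × IsSurjective φ₀
      φ₀-F           : ∀ x → ⟦ φ₀ ⟧ (⟦ F→E ⟧ x) F₂.≈ ⟦ K₂.F→𝐅 ⟧ x

      δ       : K₂.W.Carrier
      δ-unit  : ∃ λ ε → (δ K₂.W.* ε) K₂.W.≈ K₂.W.1#
      δ-σ     : K₂.frobʷ δ K₂.W.≈ K₂.W.- δ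

    open Nₖ

    Nₖ₀ : Pred Carrierᴹ ℓ
    Nₖ₀ v = ∀ x → act x v ≈ᴹ (⟦ F₂→Fₖ ⟧ (⟦ φ₀ ⟧ x) *ₗ v)

    τ : Carrierᴹ → Carrierᴹ
    τ v = Kₖ.π′ *ₗ 𝒱⁻¹ (𝒱⁻¹ v)

    C : Pred Carrierᴹ ℓ
    C v = v ∈ Nₖ₀ × τ v ≈ᴹ v

    infix 8 ⟪_,_⟫
    ⟪_,_⟫ : Carrierᴹ → Carrierᴹ → Fₖ.Carrier
    ⟪ v , w ⟫ = ⟦ F₂→Fₖ ⟧ (⟦ K₂.ι ⟧ δ) Fₖ.* ⟨ v , ℱ w ⟩

    -- duals of subsets of Nₖ₀ = C ⊗ Fₖ, resp. of C
    infix 9 _ᵛ _ᵛᶜ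
    _ᵛ _ᵛᶜ : Pred Carrierᴹ ℓ → Pred Carrierᴹ ℓ
    (A ᵛ)  v = v ∈ Nₖ₀ × (∀ w → w ∈ A → ⟪ v , w ⟫ ∈ Kₖ.Integral)
    (A ᵛᶜ) v = v ∈ C × (∀ w → w ∈ A → ∃ λ (x : K₂.W.Carrier) → ⟪ v , w ⟫ Fₖ.≈ ⟦ F₂→Fₖ ⟧ (⟦ K₂.ι ⟧ x))

    -- for negative exponents, v ∈ π^(-j)·P is expressed as π^j·v ∈ P
    infixr 8 π^_·_ π·_
    π^_·_ : ℤ → Pred Carrierᴹ ℓ → Pred Carrierᴹ ℓ
    π^ (+ i)    · P = image ((Kₖ.π′ Fₖ.^ i) *ₗ_) P
    π^ -[1+ i ] · P = λ v → ((Kₖ.π′ Fₖ.^ suc i) *ₗ v) ∈ P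

    π·_ : Pred Carrierᴹ ℓ → Pred Carrierᴹ ℓ
    π· P = image (Kₖ.π′ *ₗ_) P

    IsLatticeCₖ IsLatticeC : Pred Carrierᴹ ℓ → Set ℓ
    IsLatticeCₖ = IsLattice n Nₖ₀
    IsLatticeC   = Lattices.IsLattice {W = K₂.W} {K = F₂.ring′} K₂.ι +ᴹ-abelianGroup
                     (λ x v → ⟦ F₂→Fₖ ⟧ x *ₗ v) n C

    𝓛 : ℤ → Pred (Pred Carrierᴹ ℓ) ℓ
    𝓛 i Λ = IsLatticeC Λ × (π^ (1ℤ +ℤ i) · (Λ ᵛᶜ)) ⊆ Λ × Λ ⊆ (π^ i · (Λ ᵛᶜ))

    _⊞_ : Pred Carrierᴹ ℓ → Pred Carrierᴹ ℓ → Pred Carrierᴹ ℓ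
    (P ⊞ Q) v = ∃ λ u → ∃ λ w → u ∈ P × w ∈ Q × v ≈ᴹ (u +ᴹ w)

    τ^_ : ℕ → Carrierᴹ → Carrierᴹ
    (τ^ zero)  v = v
    (τ^ suc s) v = τ ((τ^ s) v)

    T : ℕ → Pred Carrierᴹ ℓ → Pred Carrierᴹ ℓ
    T zero    A = λ v → v ≈ᴹ 0ᴹ
    T (suc s) A = T s A ⊞ image (τ^ s) A

    -- Λ ⊗ W_{𝒪F}(k) = T_s(A) for all large s
    IsτClosure : Pred Carrierᴹ ℓ → Pred Carrierᴹ ℓ → Set ℓ
    IsτClosure Λ A = IsLatticeC Λ × (∃ λ s₀ → ∀ s → s₀ ≤ s → Generated Λ ≐ T s A)

-- The number of levels is m = suc m′; the index i : Fin m stands for toℕ i + 1 in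
-- the usual 1-based numbering.
record LevelStructure (n m′ : ℕ) : Set where
  field
    h          : Fin (suc m′) → ℕ
    increasing : ∀ {i j} → i <ᶠ j → h i < h j
    bounded    : ∀ i → h i ≤ n
    parity     : ∀ i j → h i % 2 ≡ h j % 2

module _ {p ℓ} {D : UnramifiedQuadraticExtension p ℓ} {𝕎 : RelativeWittVectors D}
  {n m′ : ℕ} (𝐡 : LevelStructure n m′)
  {K₂ : WittFractionField D 𝕎 (UnramifiedQuadraticExtension.𝔽q² D)
          (UnramifiedQuadraticExtension.𝔽q→𝔽q² D)}
  {𝕏 : FramingObject D K₂ n (LevelStructure.h 𝐡 zero)}
  {X : AlgebraicallyClosedExtension D} (𝒩 : BaseChange D K₂ 𝕏 X) where

  open LevelStructure 𝐡
  open BaseChange 𝒩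
  open Nₖ

  record Point : Set (lsuc ℓ) where
    field
      A B        : Fin (suc m′) → Pred Carrierᴹ ℓ
      A-lattice  : ∀ i → IsLatticeCₖ (A i)
      B-lattice  : ∀ i → IsLatticeCₖ (B i)
      A-chain    : ∀ (i : Fin m′) → A (suc i) ⊆ A (inject₁ i)
      A⊆B        : A zero ⊆ B zero
      B-chain    : ∀ (i : Fin m′) → B (inject₁ i) ⊆ B (suc i)
      πAᵛ⊂B      : ∀ i → (π· (A i ᵛ)) ⊂[ 1 ] B i
      B⊆Aᵛ       : ∀ i → B i ⊆ A i ᵛ
      πBᵛ⊂A      : ∀ i → (π· (B i ᵛ)) ⊂[ 1 ] A i
      A⊆Bᵛ       : ∀ i → A i ⊆ B i ᵛ
      πB⊆A       : ∀ i → (π· B i) ⊆ A i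
      A⊂B        : ∀ i → A i ⊂[ h i ] B i

  -- Λᴬ i and Λᴮ i are the lattices in C determined by A i and B i
  record τClosures (P : Point) : Set (lsuc ℓ) where
    open Point P
    field
      Λᴬ Λᴮ      : Fin (suc m′) → Pred Carrierᴹ ℓ
      Λᴬ-closure : ∀ i → IsτClosure (Λᴬ i) (A i)
      Λᴮ-closure : ∀ i → IsτClosure (Λᴮ i) (B i)

  -- The cases are 0, m, and (for 1 ≤ i ≤ m - 1) i.
  BruhatTitsType : {P : Point} → τClosures P → Pred (Fin (suc (suc m′))) ℓ
  BruhatTitsType Λ zero    = 𝓛 1ℤ (τClosures.Λᴬ Λ zero)
  BruhatTitsType Λ (suc j) with view j
  ... | ‵fromℕ       = 𝓛 0ℤ (τClosures.Λᴮ Λ (fromℕ m′))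
  ... | ‵inject₁ i = τClosures.Λᴮ Λ (inject₁ i) ⊆ (π· (τClosures.Λᴬ Λ (suc i) ᵛᶜ))

{-# OPTIONS --safe #-}

-- Write L for the lattices A_i, B_i and Y for the sublattices πB_iᵛ ⊂ A_i and πA_iᵛ ⊂ B_i of
-- colength 1.  Double duality gives Y ⊆ L ∩ τ(L).  The lattices form a chain
-- … ⊇ A_1 ⊇ … ⊇ A_m ⊇ πB_m ⊇ … ⊇ πB_1 ⊇ πA_1 ⊇ …, and each link L ⊇ L′ of it is attached to an
-- element of {0,…,m}, which lies in I as soon as all τ^{-j}(L′), j ≥ 0, are contained in Y.
-- Suppose I is empty.  For the least j with τ^{-j}(L′) ⊄ Y one has τ^{-j}(L′) ⊆ τ^{-1}(Y) ⊆ L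
-- (or j = 0), so L = Y + τ^{-j}(L′) since L/Y is simple.  Substituting these equations along the chain
-- gives L = Y + π^E τ^{-N}(L″) with E arbitrarily large: if L is not τ-stable, then Y = L ∩ τ(L)
-- absorbs the intermediate terms; if all lattices are τ-stable, every j may be taken to be 0 and the
-- sublattices Y decrease along the chain.  Since T_s(A_m) is τ-stable, π^E τ^{-N}(L″) ⊆ Y for large E
-- uniformly in N, so L = Y, a contradiction.

module Submission where

open import Defs
open import Data.Nat.Base using (ℕ; _≤_)
open import Data.Fin.Base using (Fin)
open import Data.Nat.Primality using (Prime)
open import Relation.Binary.PropositionalEquality using (_≢_)
open import Relation.Unary using (Satisfiable)
open import Axiom.ExcludedMiddle using (ExcludedMiddle)

open import Algebra.Bundles using (CommutativeMonoid; CommutativeRing)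
open import Algebra.Module.Bundles using (Module)
import Algebra.Module.Construct.TensorUnit as TensorUnit
import Algebra.Morphism.Structures as Morphisms
import Algebra.Properties.CommutativeMonoid.Sum as CommutativeMonoidSum
import Algebra.Properties.CommutativeSemigroup as CommutativeSemigroupProperties
import Algebra.Properties.Group as GroupProperties
import Algebra.Properties.Ring as RingProperties
import Algebra.Properties.Semiring.Exp as SemiringExp
import Algebra.Properties.Semiring.Sum as SemiringSum
open import Data.Empty using (⊥-elim)
open import Data.Fin.Base using (zero; suc; inject₁; fromℕ; punchIn; punchOut; toℕ)
open import Data.Fin.Induction using (<-weakInduction; >-weakInduction)
open import Data.Fin.Permutation using (Permutation; permutation)
open import Data.Fin.Properties using (_≟_; punchInᵢ≢i; punchIn-punchOut; suc-injective)
open import Data.Fin.Relation.Unary.Top using (view-fromℕ; view-inject₁)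
open import Data.Integer.Base using (0ℤ; 1ℤ)
import Data.Integer.Divisibility.Signed as ℤ∣
open import Data.Nat.Base using (zero; suc; z≤n; s≤s; nonTrivial⇒n>1)
  renaming (_+_ to _+ℕ_; _*_ to _*ℕ_; _^_ to _^ℕ_)
import Data.Nat.Divisibility as ℕ∣
open import Data.Nat.Primality using (prime)
import Data.Nat.Properties as ℕₚ
open import Data.Product.Base using (∃; _×_; _,_; proj₁; proj₂)
open import Data.Sum.Base using (_⊎_; inj₁; inj₂)
open import Data.Unit.Base using (tt)
open import Data.Vec.Base using (Vec; []; _∷_; replicate)
open import Data.Vec.Functional using (insertAt)
  renaming (_∷_ to infixr 5 _∷ᶠ_; replicate to replicateᶠ)
open import Data.Vec.Functional.Properties using (insertAt-lookup; insertAt-punchIn)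
open import Function.Base using (_∘_; id)
open import Function.Bundles using (Bijection)
open import Relation.Binary.PropositionalEquality as ≡ using (_≡_; refl)
import Relation.Binary.Reasoning.Setoid as SetoidReasoning
open import Relation.Nullary.Decidable using (Dec; yes; no; decidable-stable)
open import Relation.Nullary.Negation.Core using (¬_)
open import Relation.Unary using (Pred; U; _∈_; _⊆_)

open Hom using (⟦_⟧)

-- Fields and linear combinations.

module FieldProperties {ℓ} (K : Field ℓ) where
  open Field K hiding (refl; zero)
  open RingProperties ring public
    using (-‿distribˡ-*; -‿distribʳ-*; -‿involutive; +-inverseʳ-unique)
  open SetoidReasoning setoid

  *-cancelˡ-≉0 : ∀ {x y z} → ¬ (x ≈ 0#) → x * y ≈ x * z → y ≈ z
  *-cancelˡ-≉0 {x} {y} {z} x≉0 xy≈xz with inverse x x≉0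
  ... | x⁻¹ , xx⁻¹≈1 = begin
    y              ≈⟨ absorb y ⟨
    x⁻¹ * (x * y)  ≈⟨ *-congˡ xy≈xz ⟩
    x⁻¹ * (x * z)  ≈⟨ absorb z ⟩
    z              ∎
    where
    absorb : ∀ t → x⁻¹ * (x * t) ≈ t
    absorb t = trans (sym (*-assoc x⁻¹ x t))
      (trans (*-congʳ (trans (*-comm x⁻¹ x) xx⁻¹≈1)) (*-identityˡ t))

  x*y≈0⇒y≈0 : ∀ {x y} → ¬ (x ≈ 0#) → x * y ≈ 0# → y ≈ 0#
  x*y≈0⇒y≈0 x≉0 xy≈0 = *-cancelˡ-≉0 x≉0 (trans xy≈0 (sym (zeroʳ _)))

  x-y≈0⇒x≈y : ∀ {x y} → x + - y ≈ 0# → x ≈ y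
  x-y≈0⇒x≈y {x} {y} = GroupProperties.x∙y⁻¹≈ε⇒x≈y +-group x y

  x+y≈0⇒-x≈y : ∀ {x y} → x + y ≈ 0# → - x ≈ y
  x+y≈0⇒-x≈y {x} {y} eq = sym (+-inverseʳ-unique x y eq)

module LinearCombinations {ℓ} {K : CommutativeRing ℓ ℓ} (M : Module K ℓ ℓ) where
  open CommutativeRing K using (Carrier; _≈_; _+_; _*_; -_; 0#; -‿inverseʳ) renaming (refl to ≈-refl)
  open Module M
  open LinearAlgebra K +ᴹ-abelianGroup _*ₗ_ public using (lincomb)
  private
    module S = CommutativeMonoidSum +ᴹ-commutativeMonoid
    module R = SemiringSum (CommutativeRing.semiring K)
  open SetoidReasoning ≈ᴹ-setoid

  lincomb-cong : ∀ {d} {x y : Fin d → Carrier} {b c : Fin d → Carrierᴹ} →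
    (∀ i → x i ≈ y i) → (∀ i → b i ≈ᴹ c i) → lincomb x b ≈ᴹ lincomb y c
  lincomb-cong x≈y b≈c = S.sum-cong-≋ (λ i → *ₗ-cong (x≈y i) (b≈c i))

  lincomb-zero : ∀ {d} (x : Fin d → Carrier) (b : Fin d → Carrierᴹ) →
    (∀ i → x i ≈ 0#) → lincomb x b ≈ᴹ 0ᴹ
  lincomb-zero {d} x b x≈0 =
    ≈ᴹ-trans (S.sum-cong-≋ (λ i → ≈ᴹ-trans (*ₗ-congʳ (x≈0 i)) (*ₗ-zeroˡ (b i))))
             (S.sum-replicate-zero d)

  lincomb-+ : ∀ {d} (x y : Fin d → Carrier) (b : Fin d → Carrierᴹ) →
    lincomb (λ i → x i + y i) b ≈ᴹ lincomb x b +ᴹ lincomb y b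
  lincomb-+ x y b = ≈ᴹ-trans (S.sum-cong-≋ (λ i → *ₗ-distribʳ (b i) (x i) (y i)))
                             (S.∑-distrib-+ (λ i → x i *ₗ b i) (λ i → y i *ₗ b i))

  *ₗ-distrib-sum : ∀ {d} k (v : Fin d → Carrierᴹ) → k *ₗ S.sum v ≈ᴹ S.sum (λ i → k *ₗ v i)
  *ₗ-distrib-sum {zero}  k v = *ₗ-zeroʳ k
  *ₗ-distrib-sum {suc d} k v =
    ≈ᴹ-trans (*ₗ-distribˡ k _ _) (+ᴹ-congˡ (*ₗ-distrib-sum k (v ∘ suc)))

  sum-distrib-*ₗ : ∀ {d} (x : Fin d → Carrier) v → R.sum x *ₗ v ≈ᴹ S.sum (λ i → x i *ₗ v)
  sum-distrib-*ₗ {zero}  x v = *ₗ-zeroˡ v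
  sum-distrib-*ₗ {suc d} x v =
    ≈ᴹ-trans (*ₗ-distribʳ v _ _) (+ᴹ-congˡ (sum-distrib-*ₗ (x ∘ suc) v))

  *ₗ-lincomb : ∀ {d} k (x : Fin d → Carrier) (b : Fin d → Carrierᴹ) →
    k *ₗ lincomb x b ≈ᴹ lincomb (λ i → k * x i) b
  *ₗ-lincomb k x b = ≈ᴹ-trans (*ₗ-distrib-sum k (λ i → x i *ₗ b i))
                              (S.sum-cong-≋ (λ i → ≈ᴹ-sym (*ₗ-assoc k (x i) (b i))))

  lincomb-lincomb : ∀ {d e} (c : Fin d → Carrier) (N : Fin d → Fin e → Carrier)
    (b : Fin e → Carrierᴹ) →
    lincomb c (λ i → lincomb (N i) b) ≈ᴹ lincomb (λ j → R.sum (λ i → c i * N i j)) b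
  lincomb-lincomb c N b = begin
    S.sum (λ i → c i *ₗ lincomb (N i) b)
      ≈⟨ S.sum-cong-≋ (λ i → *ₗ-lincomb (c i) (N i) b) ⟩
    S.sum (λ i → S.sum (λ j → (c i * N i j) *ₗ b j))
      ≈⟨ S.∑-comm (λ i j → (c i * N i j) *ₗ b j) ⟩
    S.sum (λ j → S.sum (λ i → (c i * N i j) *ₗ b j))
      ≈⟨ S.sum-cong-≋ (λ j → ≈ᴹ-sym (sum-distrib-*ₗ (λ i → c i * N i j) (b j))) ⟩
    S.sum (λ j → R.sum (λ i → c i * N i j) *ₗ b j) ∎

  lincomb-substitute : ∀ {d e} (c : Fin d → Carrier) (N : Fin d → Fin e → Carrier)
    (b : Fin d → Carrierᴹ) (v : Fin e → Carrierᴹ) → (∀ i → b i ≈ᴹ lincomb (N i) v) →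
    lincomb c b ≈ᴹ lincomb (λ j → R.sum (λ i → c i * N i j)) v
  lincomb-substitute c N b v b≈Nv = begin
    lincomb c b                                    ≈⟨ lincomb-cong {x = c} {c} {b} (λ _ → ≈-refl) b≈Nv ⟩
    lincomb c (λ i → lincomb (N i) v)              ≈⟨ lincomb-lincomb c N v ⟩
    lincomb (λ j → R.sum (λ i → c i * N i j)) v    ∎

  lincomb-multiple : ∀ {d} t (x y : Fin d → Carrier) (v : Fin d → Carrierᴹ) →
    (∀ i → y i ≈ t * x i) → lincomb x v ≈ᴹ 0ᴹ → lincomb y v ≈ᴹ 0ᴹ
  lincomb-multiple t x y v y≈tx xv≈0 = begin
    lincomb y v                ≈⟨ lincomb-cong {x = y} {λ i → t * x i} {v} y≈tx (λ _ → ≈ᴹ-refl) ⟩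
    lincomb (λ i → t * x i) v  ≈⟨ *ₗ-lincomb t x v ⟨
    t *ₗ lincomb x v           ≈⟨ *ₗ-congˡ xv≈0 ⟩
    t *ₗ 0ᴹ                    ≈⟨ *ₗ-zeroʳ t ⟩
    0ᴹ                         ∎

  Independent : ∀ {d} → (Fin d → Carrierᴹ) → Set ℓ
  Independent b = ∀ x → lincomb x b ≈ᴹ 0ᴹ → ∀ i → x i ≈ 0#

  independent-unique : ∀ {d} (b : Fin d → Carrierᴹ) → Independent b → ∀ (x y : Fin d → Carrier) →
    lincomb x b ≈ᴹ lincomb y b → ∀ i → x i ≈ y i
  independent-unique b ind x y eq i = +-Properties.x∙y⁻¹≈ε⇒x≈y (x i) (y i) (ind (λ i → x i + - y i) (begin
    lincomb (λ i → x i + - y i) b        ≈⟨ lincomb-+ x (λ i → - y i) b ⟩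
    lincomb x b +ᴹ lincomb (λ i → - y i) b  ≈⟨ +ᴹ-congʳ eq ⟩
    lincomb y b +ᴹ lincomb (λ i → - y i) b  ≈⟨ lincomb-+ y (λ i → - y i) b ⟨
    lincomb (λ i → y i + - y i) b        ≈⟨ lincomb-zero (λ i → y i + - y i) b (λ i → -‿inverseʳ (y i)) ⟩
    0ᴹ                                   ∎) i)
    where module +-Properties = GroupProperties (CommutativeRing.+-group K)

  sum∈ : ∀ {p} (P : Carrierᴹ → Set p) → P 0ᴹ → (∀ u v → P u → P v → P (u +ᴹ v)) →
    ∀ {d} (v : Fin d → Carrierᴹ) → (∀ i → P (v i)) → P (S.sum v)
  sum∈ P P0 P+ {zero}  v Pv = P0
  sum∈ P P0 P+ {suc d} v Pv = P+ _ _ (Pv zero) (sum∈ P P0 P+ (v ∘ suc) (Pv ∘ suc))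

  semilinear-lincomb : (N : Module K ℓ ℓ) → let module N = Module N in
    (s : Carrier → Carrier) (f : Carrierᴹ → N.Carrierᴹ) → f 0ᴹ N.≈ᴹ N.0ᴹ →
    (∀ u v → f (u +ᴹ v) N.≈ᴹ (f u N.+ᴹ f v)) → (∀ x v → f (x *ₗ v) N.≈ᴹ (s x N.*ₗ f v)) →
    ∀ {d} (x : Fin d → Carrier) (b : Fin d → Carrierᴹ) →
    f (lincomb x b) N.≈ᴹ LinearAlgebra.lincomb K N.+ᴹ-abelianGroup N._*ₗ_ (s ∘ x) (f ∘ b)
  semilinear-lincomb N s f f0 f+ f* {zero}  x b = f0
  semilinear-lincomb N s f f0 f+ f* {suc d} x b = N.≈ᴹ-trans (f+ _ _)
    (N.+ᴹ-cong (f* _ _) (semilinear-lincomb N s f f0 f+ f* (x ∘ suc) (b ∘ suc)))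
    where module N = Module N

-- Gaussian elimination over a field.

module LinearEquations {ℓ} (em : ExcludedMiddle ℓ) (K : Field ℓ) where
  open Field K hiding (refl; zero; sum)
  open FieldProperties K
  open SemiringSum (CommutativeRing.semiring ring′)
  open SetoidReasoning setoid

  private
    Relation : ∀ {m n} → (Fin m → Fin n → Carrier) → Set ℓ
    Relation {m} M = ∃ λ (c : Fin m → Carrier) →
      (∃ λ i → ¬ (c i ≈ 0#)) × (∀ j → sum (λ i → c i * M i j) ≈ 0#)

    zero-sum : ∀ {m} (f : Fin m → Carrier) → (∀ i → f i ≈ 0#) → sum f ≈ 0#
    zero-sum {m} f f≈0 = trans (sum-cong-≋ f≈0) (sum-replicate-zero m)

    eliminate : ∀ {m} (c a b : Fin m → Carrier) r →
      sum (λ k → c k * (a k + - (b k * r))) ≈ 0# →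
      sum (λ k → c k * a k) + - (sum (λ k → c k * b k) * r) ≈ 0#
    eliminate c a b r eq = begin
      sum (λ k → c k * a k) + - (sum (λ k → c k * b k) * r)
        ≈⟨ +-congˡ (-‿distribʳ-* (sum (λ k → c k * b k)) r) ⟩
      sum (λ k → c k * a k) + sum (λ k → c k * b k) * - r
        ≈⟨ +-congˡ (*-distribʳ-sum (- r) (λ k → c k * b k)) ⟩
      sum (λ k → c k * a k) + sum (λ k → c k * b k * - r)
        ≈⟨ ∑-distrib-+ (λ k → c k * a k) (λ k → c k * b k * - r) ⟨
      sum (λ k → c k * a k + c k * b k * - r)
        ≈⟨ sum-cong-≋ pointwise ⟩
      sum (λ k → c k * (a k + - (b k * r)))
        ≈⟨ eq ⟩
      0# ∎
      where
      pointwise : ∀ k → c k * a k + c k * b k * - r ≈ c k * (a k + - (b k * r))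
      pointwise k = begin
        c k * a k + c k * b k * - r    ≈⟨ +-congˡ (*-assoc (c k) (b k) (- r)) ⟩
        c k * a k + c k * (b k * - r)  ≈⟨ distribˡ (c k) (a k) (b k * - r) ⟨
        c k * (a k + b k * - r)        ≈⟨ *-congˡ (+-congˡ (-‿distribʳ-* (b k) r)) ⟨
        c k * (a k + - (b k * r))      ∎

    without-pivot : ∀ {m n} (M : Fin (suc m) → Fin (suc n) → Carrier) →
      (∀ i → M i zero ≈ 0#) → Relation (λ i j → M (suc i) (suc j)) → Relation M
    without-pivot M M₀≈0 (c , (i , cᵢ≉0) , eqs) = 0# ∷ᶠ c , (suc i , cᵢ≉0) , λ
      { zero → zero-sum (λ i → (0# ∷ᶠ c) i * M i zero)
                        (λ i → trans (*-congˡ (M₀≈0 i)) (zeroʳ ((0# ∷ᶠ c) i)))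
      ; (suc j) → trans (+-cong (zeroˡ (M zero (suc j))) (eqs j)) (+-identityˡ 0#) }

    -- Row p is used to clear column zero. The cleared column vanishes identically, so `reduced`
    -- holds there as well and `eliminate` recovers the original equations for all columns at once;
    -- `t` collects the multiples of row p subtracted on the way.
    with-pivot : ∀ {m n} (M : Fin (suc m) → Fin (suc n) → Carrier) p u → M p zero * u ≈ 1# →
      Relation (λ i j → M (punchIn p i) (suc j) + - (M (punchIn p i) zero * (u * M p (suc j)))) →
      Relation M
    with-pivot {m} {n} M p u pivot (c , (i , cᵢ≉0) , eqs) =
      c′ , (punchIn p i , λ eq → cᵢ≉0 (trans (sym (c′-punchIn i)) eq)) , eqs′
      where
      t = - (sum (λ i → c i * M (punchIn p i) zero) * u)
      c′ : Fin (suc m) → Carrier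
      c′ = insertAt c p t
      c′-p : c′ p ≈ t
      c′-p = reflexive (insertAt-lookup c p t)
      c′-punchIn : ∀ i → c′ (punchIn p i) ≈ c i
      c′-punchIn i = reflexive (insertAt-punchIn c p t i)

      reduced : ∀ j → sum (λ i → c i * (M (punchIn p i) j + - (M (punchIn p i) zero * (u * M p j)))) ≈ 0#
      reduced zero = zero-sum (λ i → c i * (M (punchIn p i) zero + - (M (punchIn p i) zero * (u * M p zero))))
        λ i → trans (*-congˡ (trans (+-congˡ (-‿cong (trans (*-congˡ (trans (*-comm u (M p zero)) pivot))
          (*-identityʳ (M (punchIn p i) zero))))) (-‿inverseʳ (M (punchIn p i) zero)))) (zeroʳ (c i))
      reduced (suc j) = eqs j

      eqs′ : ∀ j → sum (λ i → c′ i * M i j) ≈ 0#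
      eqs′ j = begin
        sum (λ i → c′ i * M i j)
          ≈⟨ sum-remove {i = p} (λ i → c′ i * M i j) ⟩
        c′ p * M p j + sum (λ i → c′ (punchIn p i) * M (punchIn p i) j)
          ≈⟨ +-cong (*-congʳ c′-p) (sum-cong-≋ (λ i → *-congʳ (c′-punchIn i))) ⟩
        t * M p j + sum (λ i → c i * M (punchIn p i) j)
          ≈⟨ +-comm (t * M p j) (sum (λ i → c i * M (punchIn p i) j)) ⟩
        sum (λ i → c i * M (punchIn p i) j) + t * M p j
          ≈⟨ +-congˡ (trans (sym (-‿distribˡ-* s (M p j))) (-‿cong (*-assoc s₀ u (M p j)))) ⟩
        sum (λ i → c i * M (punchIn p i) j) + - (s₀ * (u * M p j))
          ≈⟨ eliminate c (λ i → M (punchIn p i) j) (λ i → M (punchIn p i) zero) (u * M p j) (reduced j) ⟩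
        0# ∎
        where
        s₀ = sum (λ i → c i * M (punchIn p i) zero)
        s = s₀ * u

  abstract
    more-unknowns-than-equations : ∀ n (M : Fin (suc n) → Fin n → Carrier) → Relation M
    more-unknowns-than-equations zero M = (λ _ → 1#) , (zero , 1≉0) , λ ()
    more-unknowns-than-equations (suc n) M = go em
      where
      go : Dec (∃ λ p → ¬ (M p zero ≈ 0#)) → Relation M
      go (no noPivot) = without-pivot M (λ p → decidable-stable em (λ neq → noPivot (p , neq)))
        (more-unknowns-than-equations n (λ i j → M (suc i) (suc j)))
      go (yes (p , pivot≉0)) with inverse (M p zero) pivot≉0
      ... | u , pivot = with-pivot M p u pivot (more-unknowns-than-equations n
              (λ i j → M (punchIn p i) (suc j) + - (M (punchIn p i) zero * (u * M p (suc j)))))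

  -- The n + 1 vectors consisting of y and the rows of G satisfy a nontrivial relation in dimension
  -- n. Its coefficient at y is nonzero, since otherwise the rows of G would be dependent, so it can
  -- be solved for y.
  injective⇒surjective : ∀ {n} (G : Fin n → Fin n → Carrier) →
    (∀ x → (∀ j → sum (λ i → x i * G i j) ≈ 0#) → ∀ i → x i ≈ 0#) →
    ∀ y → ∃ λ x → ∀ j → sum (λ i → x i * G i j) ≈ y j
  injective⇒surjective {n} G inj y =
    let c , c≉0 , eqs = more-unknowns-than-equations n (y ∷ᶠ G)
    in solveFor c c≉0 (λ j → trans (+-comm _ _) (eqs j)) em
    where
    solveFor : ∀ (c : Fin (suc n) → Carrier) → (∃ λ i → ¬ (c i ≈ 0#)) →
      (∀ j → sum (λ i → c (suc i) * G i j) + c zero * y j ≈ 0#) → Dec (c zero ≈ 0#) →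
      ∃ λ x → ∀ j → sum (λ i → x i * G i j) ≈ y j
    solveFor c c≉0 eqs (yes c₀≈0) = ⊥-elim (contra c≉0)
      where
      rest : ∀ i → c (suc i) ≈ 0#
      rest = inj (c ∘ suc) λ j → trans (sym (trans (+-congˡ (trans (*-congʳ c₀≈0) (zeroˡ _)))
                                             (+-identityʳ _))) (eqs j)
      contra : ¬ (∃ λ i → ¬ (c i ≈ 0#))
      contra (zero , c₀≉0) = c₀≉0 c₀≈0
      contra (suc i , cᵢ≉0) = cᵢ≉0 (rest i)
    solveFor c _ eqs (no c₀≉0) with inverse (c zero) c₀≉0
    ... | u , c₀u≈1 = (λ i → - u * c (suc i)) , λ j → begin
      sum (λ i → - u * c (suc i) * G i j)   ≈⟨ sum-cong-≋ (λ i → *-assoc (- u) (c (suc i)) (G i j)) ⟩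
      sum (λ i → - u * (c (suc i) * G i j)) ≈⟨ *-distribˡ-sum (- u) (λ i → c (suc i) * G i j) ⟨
      - u * sum (λ i → c (suc i) * G i j)   ≈⟨ -‿distribˡ-* _ _ ⟨
      - (u * sum (λ i → c (suc i) * G i j)) ≈⟨ -‿distribʳ-* _ _ ⟩
      u * - sum (λ i → c (suc i) * G i j)   ≈⟨ *-congˡ (x+y≈0⇒-x≈y (eqs j)) ⟩
      u * (c zero * y j)                    ≈⟨ *-assoc _ _ _ ⟨
      u * c zero * y j                      ≈⟨ *-congʳ (trans (*-comm _ _) c₀u≈1) ⟩
      1# * y j                              ≈⟨ *-identityˡ _ ⟩
      y j                                   ∎

  private
    proportional : ∀ {n} (a x : Fin (suc n) → Carrier) i u → x i * u ≈ 1# →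
      (∀ j → a (punchIn i j) ≈ a i * (u * x (punchIn i j))) → ∀ j → a j ≈ (a i * u) * x j
    proportional a x i u xᵢu≈1 eq j = go (i ≟ j)
      where
      go : Dec (i ≡ j) → a j ≈ (a i * u) * x j
      go (yes refl) = sym (trans (*-assoc _ _ _)
              (trans (*-congˡ (trans (*-comm _ _) xᵢu≈1)) (*-identityʳ _)))
      go (no i≢j) = ≡.subst (λ j → a j ≈ (a i * u) * x j) (punchIn-punchOut i≢j)
              (trans (eq (punchOut i≢j)) (sym (*-assoc _ _ _)))

  module _ (V : Module ring′ ℓ ℓ) where
    open Module V
    open LinearCombinations V

    -- A relation among the n vectors vⱼ would leave n unknowns and only n - 1
    -- equations for a relation among the bᵢ.
    spanning⇒independent : ∀ {n} (b v : Fin n → Carrierᴹ) → Independent b →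
      (N : Fin n → Fin n → Carrier) → (∀ i → b i ≈ᴹ lincomb (N i) v) → Independent v
    spanning⇒independent {suc n} b v ind N b≈Nv x xv≈0 i = go em
      where
      relation : ∀ u → x i * u ≈ 1# → ∀ (c : Fin (suc n) → Carrier) →
        (∀ j → sum (λ k → c k * (N k (punchIn i j) + - (N k i * (u * x (punchIn i j))))) ≈ 0#) →
        ∀ k → c k ≈ 0#
      relation u xᵢu≈1 c eqs = ind c (≈ᴹ-trans (lincomb-substitute c N b v b≈Nv)
        (lincomb-multiple (cN i * u) x cN v (proportional cN x i u xᵢu≈1 cN≈) xv≈0))
        where
        cN : Fin (suc n) → Carrier
        cN j = sum (λ k → c k * N k j)
        cN≈ : ∀ j → cN (punchIn i j) ≈ cN i * (u * x (punchIn i j))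
        cN≈ j = x-y≈0⇒x≈y (eliminate c (λ k → N k (punchIn i j)) (λ k → N k i) (u * x (punchIn i j)) (eqs j))

      nontrivial : ∀ u → x i * u ≈ 1# → (∃ λ (c : Fin (suc n) → Carrier) → (∃ λ k → ¬ (c k ≈ 0#)) ×
        (∀ j → sum (λ k → c k * (N k (punchIn i j) + - (N k i * (u * x (punchIn i j))))) ≈ 0#)) →
        x i ≈ 0#
      nontrivial u xᵢu≈1 (c , (k , cₖ≉0) , eqs) = ⊥-elim (cₖ≉0 (relation u xᵢu≈1 c eqs k))

      go : Dec (x i ≈ 0#) → x i ≈ 0#
      go (yes xᵢ≈0) = xᵢ≈0
      go (no xᵢ≉0) with inverse (x i) xᵢ≉0
      ... | u , xᵢu≈1 = nontrivial u xᵢu≈1 (more-unknowns-than-equations n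
                          (λ k j → N k (punchIn i j) + - (N k i * (u * x (punchIn i j)))))

-- Ring homomorphisms, monic polynomials and finite fields.

module HomProperties {a ℓ} {R : CommutativeRing a ℓ} {b ℓ′} {S : CommutativeRing b ℓ′} (f : Hom R S) where
  open Morphisms.RingMorphisms.IsRingHomomorphism (Hom.isHom f) public

module FieldHomProperties {ℓ} {K L : Field ℓ} (f : Hom (Field.ring′ K) (Field.ring′ L)) where
  private
    module K = Field K
    module L = Field L
    φ = ⟦ f ⟧
  open HomProperties f public

  ≉0-homo : ∀ {x} → ¬ (x K.≈ K.0#) → ¬ (φ x L.≈ L.0#)
  ≉0-homo {x} x≉0 fx≈0 with K.inverse x x≉0
  ... | y , xy≈1 = L.1≉0 (L.trans (L.sym 1#-homo) (L.trans (⟦⟧-cong (K.sym xy≈1))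
          (L.trans (*-homo x y) (L.trans (L.*-congʳ fx≈0) (L.zeroˡ (φ y))))))

  injective : ExcludedMiddle ℓ → ∀ {x y} → φ x L.≈ φ y → x K.≈ y
  injective em {x} {y} fx≈fy = go em
    where
    go : Dec (x K.+ K.- y K.≈ K.0#) → x K.≈ y
    go (yes eq) = FieldProperties.x-y≈0⇒x≈y K eq
    go (no neq) = ⊥-elim (≉0-homo neq (L.trans (+-homo x (K.- y))
      (L.trans (L.+-cong fx≈fy (-‿homo y)) (L.-‿inverseʳ (φ y)))))

  ^-homo : ∀ x n → φ (x K.^ n) L.≈ φ x L.^ n
  ^-homo x zero = 1#-homo
  ^-homo x (suc n) = L.trans (*-homo x (x K.^ n)) (L.*-congˡ (^-homo x n))

module MonicPolynomials {ℓ} (em : ExcludedMiddle ℓ) (K : Field ℓ) where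
  open Field K hiding (refl; zero)
  open FieldProperties K
  open SetoidReasoning setoid

  -- c₀ ∷ … ∷ c_{d-1} ∷ [] stands for T^d + c_{d-1} T^{d-1} + … + c₀.
  eval : ∀ {d} → Vec Carrier d → Carrier → Carrier
  eval []       x = 1#
  eval (c ∷ cs) x = c + x * eval cs x

  -- Synthetic division by T - a: the intermediate values of Horner's scheme at a are the
  -- coefficients of the quotient.
  quotient : ∀ {d} → Vec Carrier (suc d) → Carrier → Vec Carrier d
  quotient (c ∷ [])      a = []
  quotient (c ∷ c′ ∷ cs) a = eval (c′ ∷ cs) a ∷ quotient (c′ ∷ cs) a

  factor : ∀ {d} (cs : Vec Carrier (suc d)) a x →
    eval cs x ≈ eval cs a + (x + - a) * eval (quotient cs a) x
  factor (c ∷ []) a x = begin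
    c + x * 1#                         ≈⟨ +-congˡ (*-congʳ (split x a)) ⟩
    c + (a + (x + - a)) * 1#           ≈⟨ +-congˡ (distribʳ 1# a (x + - a)) ⟩
    c + (a * 1# + (x + - a) * 1#)      ≈⟨ +-assoc c (a * 1#) ((x + - a) * 1#) ⟨
    c + a * 1# + (x + - a) * 1#        ∎
    where
    split : ∀ x a → x ≈ a + (x + - a)
    split x a = sym (trans (+-comm a (x + - a)) (trans (+-assoc x (- a) a)
      (trans (+-congˡ (-‿inverseˡ a)) (+-identityʳ x))))
  factor (c ∷ c′ ∷ cs) a x = begin
    c + x * E x                                 ≈⟨ +-congˡ (*-congˡ (factor (c′ ∷ cs) a x)) ⟩
    c + x * (E a + D * Q)                       ≈⟨ +-congˡ (distribˡ x (E a) (D * Q)) ⟩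
    c + (x * E a + x * (D * Q))                 ≈⟨ +-congˡ (+-cong (*-congʳ split) (swap x D Q)) ⟩
    c + ((a + D) * E a + D * (x * Q))           ≈⟨ +-congˡ (+-congʳ (distribʳ (E a) a D)) ⟩
    c + ((a * E a + D * E a) + D * (x * Q))     ≈⟨ +-congˡ (+-assoc (a * E a) (D * E a) (D * (x * Q))) ⟩
    c + (a * E a + (D * E a + D * (x * Q)))     ≈⟨ +-congˡ (+-congˡ (distribˡ D (E a) (x * Q))) ⟨
    c + (a * E a + D * (E a + x * Q))           ≈⟨ +-assoc c (a * E a) (D * (E a + x * Q)) ⟨
    (c + a * E a) + D * (E a + x * Q)           ∎
    where
    E = eval (c′ ∷ cs)
    Q = eval (quotient (c′ ∷ cs) a) x
    D = x + - a
    split : x ≈ a + D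
    split = sym (trans (+-comm a D) (trans (+-assoc x (- a) a)
      (trans (+-congˡ (-‿inverseˡ a)) (+-identityʳ x))))
    swap : ∀ x y z → x * (y * z) ≈ y * (x * z)
    swap x y z = trans (sym (*-assoc x y z)) (trans (*-congʳ (*-comm x y)) (*-assoc y x z))

  root-of-quotient : ∀ {d} (cs : Vec Carrier (suc d)) {a x} → eval cs a ≈ 0# → ¬ (x ≈ a) →
    eval cs x ≈ 0# → eval (quotient cs a) x ≈ 0#
  root-of-quotient cs {a} {x} pa≈0 x≉a px≈0 = x*y≈0⇒y≈0 (λ eq → x≉a (x-y≈0⇒x≈y eq))
    (trans (sym (+-identityˡ _)) (trans (+-congʳ (sym pa≈0)) (trans (sym (factor cs a x)) px≈0)))

  -- Divide by T - a₀: the remaining a's, and y if it differs from a₀, stay roots of the quotient.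
  -- In degree 0 the polynomial is 1 and has no root.
  roots-complete : ∀ {d} (cs : Vec Carrier d) (a : Fin d → Carrier) →
    (∀ {i j} → a i ≈ a j → i ≡ j) → (∀ i → eval cs (a i) ≈ 0#) →
    ∀ y → eval cs y ≈ 0# → ∃ λ i → a i ≈ y
  roots-complete [] a distinct roots y 1≈0 = ⊥-elim (1≉0 1≈0)
  roots-complete {suc d} cs@(_ ∷ _) a distinct roots y root = go em
    where
    shift : (∃ λ i → a (suc i) ≈ y) → ∃ λ i → a i ≈ y
    shift (i , eq) = suc i , eq
    a₀-distinct : ∀ i → ¬ (a (suc i) ≈ a zero)
    a₀-distinct i eq with () ← distinct eq
    go : Dec (y ≈ a zero) → ∃ λ i → a i ≈ y
    go (yes eq) = zero , sym eq
    go (no y≉a₀) = shift (roots-complete (quotient cs (a zero)) (a ∘ suc)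
      (λ eq → suc-injective (distinct eq))
      (λ i → root-of-quotient cs (roots zero) (a₀-distinct i) (roots (suc i)))
      y (root-of-quotient cs (roots zero) y≉a₀ root))

  eval-replicate : ∀ d x → eval (replicate d 0#) x ≈ x ^ d
  eval-replicate zero x = Field.refl K
  eval-replicate (suc d) x = trans (+-identityˡ _) (*-congˡ (eval-replicate d x))

  -- T^(N+2) - T
  frobeniusPolynomial : ∀ N → Vec Carrier (suc (suc N))
  frobeniusPolynomial N = 0# ∷ - 1# ∷ replicate N 0#

  eval-frobeniusPolynomial : ∀ N x → eval (frobeniusPolynomial N) x ≈ x ^ suc (suc N) + - x
  eval-frobeniusPolynomial N x = begin
    0# + x * (- 1# + x * eval (replicate N 0#) x)  ≈⟨ +-identityˡ _ ⟩
    x * (- 1# + x * eval (replicate N 0#) x)       ≈⟨ *-congˡ (+-comm _ _) ⟩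
    x * (x * eval (replicate N 0#) x + - 1#)       ≈⟨ distribˡ x _ (- 1#) ⟩
    x * (x * eval (replicate N 0#) x) + x * - 1#   ≈⟨ +-cong (*-congˡ (*-congˡ (eval-replicate N x))) (trans (sym (-‿distribʳ-* x 1#)) (-‿cong (*-identityʳ x))) ⟩
    x * (x * x ^ N) + - x                          ∎

module FiniteField {ℓ} (em : ExcludedMiddle ℓ) (K : Field ℓ) where
  open Field K hiding (refl; zero; sum)
  open FieldProperties K
  private module Π = CommutativeMonoidSum *-commutativeMonoid
  open SetoidReasoning setoid

  product≉0 : ∀ {d} (x : Fin d → Carrier) → (∀ i → ¬ (x i ≈ 0#)) → ¬ (Π.sum x ≈ 0#)
  product≉0 {zero}  x x≉0 = 1≉0
  product≉0 {suc d} x x≉0 eq = product≉0 (x ∘ suc) (x≉0 ∘ suc) (x*y≈0⇒y≈0 (x≉0 zero) eq)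

  private
    -- Replacing the factor 0 by 1 lets the product of the units run over the whole index set, on
    -- which multiplication by a unit is a permutation.
    orOne : ∀ x → Dec (x ≈ 0#) → Carrier
    orOne x (yes _) = 1#
    orOne x (no _)  = x

    orOne-0 : ∀ {x} (d : Dec (x ≈ 0#)) → x ≈ 0# → orOne x d ≈ 1#
    orOne-0 (yes _) _ = Field.refl K
    orOne-0 (no x≉0) x≈0 = ⊥-elim (x≉0 x≈0)

    orOne-≉0 : ∀ {x} (d : Dec (x ≈ 0#)) → ¬ (x ≈ 0#) → orOne x d ≈ x
    orOne-≉0 (yes x≈0) x≉0 = ⊥-elim (x≉0 x≈0)
    orOne-≉0 (no _) _ = Field.refl K

    orOne-cong : ∀ {x y} (d : Dec (x ≈ 0#)) (e : Dec (y ≈ 0#)) → x ≈ y → orOne x d ≈ orOne y e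
    orOne-cong (yes x≈0) e x≈y = sym (orOne-0 e (trans (sym x≈y) x≈0))
    orOne-cong (no x≉0) e x≈y = trans x≈y (sym (orOne-≉0 e (λ y≈0 → x≉0 (trans x≈y y≈0))))

  module _ {N} (enum : Bijection (≡.setoid (Fin (suc N))) setoid) where
    open Bijection enum using (to; injective; to⁻; strictlySurjective)

    private
      to∘to⁻ : ∀ y → to (to⁻ y) ≈ y
      to∘to⁻ y = proj₂ (strictlySurjective y)

      nz : Carrier → Carrier
      nz x = orOne x em

      z : Fin (suc N)
      z = to⁻ 0#

      to-punchIn≉0 : ∀ j → ¬ (to (punchIn z j) ≈ 0#)
      to-punchIn≉0 j eq = punchInᵢ≢i z j (injective (trans eq (sym (to∘to⁻ 0#))))

      units : Carrier
      units = Π.sum (λ j → to (punchIn z j))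

      product-nz : ∀ x → ¬ (x ≈ 0#) → Π.sum (λ i → nz (x * to i)) ≈ x ^ N * units
      product-nz x x≉0 = begin
        Π.sum (λ i → nz (x * to i))
          ≈⟨ Π.sum-remove {i = z} (λ i → nz (x * to i)) ⟩
        nz (x * to z) * Π.sum (λ j → nz (x * to (punchIn z j)))
          ≈⟨ *-cong (orOne-0 em (trans (*-congˡ (to∘to⁻ 0#)) (zeroʳ x)))
               (Π.sum-cong-≋ (λ j → orOne-≉0 em (λ eq → to-punchIn≉0 j (x*y≈0⇒y≈0 x≉0 eq)))) ⟩
        1# * Π.sum (λ j → x * to (punchIn z j))
          ≈⟨ *-identityˡ _ ⟩
        Π.sum (λ j → x * to (punchIn z j))
          ≈⟨ Π.∑-distrib-+ (λ _ → x) (λ j → to (punchIn z j)) ⟩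
        Π.sum (replicateᶠ N x) * units
          ≈⟨ *-congʳ (Π.sum-replicate N) ⟩
        x ^ N * units ∎

      scaling : ∀ x y → x * y ≈ 1# → Permutation (suc N) (suc N)
      scaling x y xy≈1 = permutation (λ i → to⁻ (x * to i)) (λ i → to⁻ (y * to i))
        (λ i → cancel x y xy≈1 i) (λ i → cancel y x (trans (*-comm y x) xy≈1) i)
        where
        cancel : ∀ x y → x * y ≈ 1# → ∀ i → to⁻ (x * to (to⁻ (y * to i))) ≡ i
        cancel x y xy≈1 i = injective (trans (to∘to⁻ _) (trans (*-congˡ (to∘to⁻ _))
          (trans (sym (*-assoc x y (to i))) (trans (*-congʳ xy≈1) (*-identityˡ (to i))))))

      -- Multiplication by x permutes the N units, so their product is x^N times itself; the product
      -- is nonzero and cancels.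
      x^N≈1 : ∀ x → ¬ (x ≈ 0#) → x ^ N ≈ 1#
      x^N≈1 x x≉0 = *-cancelˡ-≉0 (product≉0 (λ j → to (punchIn z j)) to-punchIn≉0) (begin
        units * x ^ N
          ≈⟨ *-comm units (x ^ N) ⟩
        x ^ N * units
          ≈⟨ product-nz x x≉0 ⟨
        Π.sum (λ i → nz (x * to i))
          ≈⟨ Π.sum-cong-≋ (λ i → orOne-cong em em (trans (sym (to∘to⁻ (x * to i)))
               (sym (*-identityˡ (to (to⁻ (x * to i))))))) ⟩
        -- The factor `1#` is inserted so that `product-nz` evaluates this side too, with `1#` in
        -- the place of x.
        Π.sum (λ i → nz (1# * to (to⁻ (x * to i))))
          ≈⟨ Π.sum-permute (λ i → nz (1# * to i)) (scaling x (proj₁ (inverse x x≉0)) (proj₂ (inverse x x≉0))) ⟨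
        Π.sum (λ i → nz (1# * to i))
          ≈⟨ product-nz 1# 1≉0 ⟩
        1# ^ N * units
          ≈⟨ *-congʳ (1^n N) ⟩
        1# * units
          ≈⟨ *-comm 1# units ⟩
        units * 1# ∎)
        where
        1^n : ∀ n → 1# ^ n ≈ 1#
        1^n zero = Field.refl K
        1^n (suc n) = trans (*-identityˡ _) (1^n n)

    frobenius-fixed : ∀ x → x ^ suc N ≈ x
    frobenius-fixed x = go em
      where
      go : Dec (x ≈ 0#) → x ^ suc N ≈ x
      go (yes x≈0) = trans (*-congʳ x≈0) (trans (zeroˡ _) (sym x≈0))
      go (no x≉0) = trans (*-congˡ (x^N≈1 x x≉0)) (*-identityʳ x)

  nonempty : ∀ {N} → Bijection (≡.setoid (Fin N)) setoid → ∃ λ M → N ≡ suc M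
  nonempty {zero}  enum with () ← Bijection.to⁻ enum 0#
  nonempty {suc N} enum = N , refl

  x^∣K∣≈x : ∀ {N} → Bijection (≡.setoid (Fin N)) setoid → ∀ x → x ^ N ≈ x
  x^∣K∣≈x {zero}  enum x with () ← Bijection.to⁻ enum 0#
  x^∣K∣≈x {suc N} enum x = frobenius-fixed enum x

-- The images of the N elements of k are N distinct roots of T^N - T in K, and a monic polynomial of
-- degree N has no further ones.
frobenius-fixed⇒∈image : ∀ {ℓ} (em : ExcludedMiddle ℓ) {k K : Field ℓ}
  (f : Hom (Field.ring′ k) (Field.ring′ K)) {N : ℕ} →
  Bijection (≡.setoid (Fin N)) (Field.setoid k) →
  ∀ y → Field._≈_ K (Field._^_ K y N) y → ∃ λ x → Field._≈_ K (⟦ f ⟧ x) y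
frobenius-fixed⇒∈image em {k} f {zero} enum y _ with () ← Bijection.to⁻ enum (Field.0# k)
-- T^N - T is monic of degree N only for N ≥ 2; with a single element, 1 would equal 0 in k.
frobenius-fixed⇒∈image em {k} f {suc zero} enum y _ = ⊥-elim (k.1≉0 (k.trans (k.sym (to-≈ k.1#))
    (k.trans (k.reflexive (≡.cong (Bijection.to enum) (unique (from k.1#) (from k.0#)))) (to-≈ k.0#))))
  where
  module k = Field k
  from = Bijection.to⁻ enum
  to-≈ : ∀ y → Bijection.to enum (from y) k.≈ y
  to-≈ y = proj₂ (Bijection.strictlySurjective enum y)
  unique : ∀ (i j : Fin 1) → i ≡ j
  unique zero zero = refl
frobenius-fixed⇒∈image em {k} {K} f {suc (suc N)} enum y y^N≈y = to (proj₁ sol) , proj₂ sol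
  where
  module k = Field k
  module K = Field K
  open Bijection enum using (to)
  module f = FieldHomProperties {K = k} {K} f
  open MonicPolynomials em K
  root : ∀ x → x K.^ suc (suc N) K.≈ x → eval (frobeniusPolynomial N) x K.≈ K.0#
  root x eq = K.trans (eval-frobeniusPolynomial N x) (K.trans (K.+-congʳ eq) (K.-‿inverseʳ x))
  sol : ∃ λ i → ⟦ f ⟧ (to i) K.≈ y
  sol = roots-complete (frobeniusPolynomial N) (λ i → ⟦ f ⟧ (to i))
    (λ eq → Bijection.injective enum (f.injective em eq))
    (λ i → root (⟦ f ⟧ (to i)) (K.trans (K.sym (f.^-homo (to i) (suc (suc N))))
      (f.⟦⟧-cong (FiniteField.x^∣K∣≈x em k enum (to i)))))
    y (root y y^N≈y)

-- In T^(d+1) + Σ rᵢ Tⁱ only r₀ = - a is nonzero.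
algebraicallyClosed⇒roots : ∀ {ℓ} {K : Field ℓ} → IsAlgebraicallyClosed K →
  ∀ d a → ∃ λ x → Field._≈_ K (Field._^_ K x (suc d)) a
algebraicallyClosed⇒roots {K = K} closed d a =
  proj₁ root , x-y≈0⇒x≈y (trans (+-congˡ (sym Σ≈-a)) (proj₂ root))
  where
  open Field K hiding (refl; zero; sum)
  open FieldProperties K
  open SemiringSum (CommutativeRing.semiring ring′)
  r : Fin (suc d) → Carrier
  r zero = - a
  r (suc i) = 0#
  root = closed d r
  r*x≈0 : ∀ i → r (suc i) * proj₁ root ^ toℕ (suc i) ≈ 0#
  r*x≈0 i = zeroˡ (proj₁ root ^ toℕ (suc i))
  Σ≈-a : sum (λ i → r i * proj₁ root ^ toℕ i) ≈ - a
  Σ≈-a = trans (+-cong (*-identityʳ (- a)) (trans (sum-cong-≋ r*x≈0) (sum-replicate-zero d)))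
               (+-identityʳ (- a))

-- Scalars: Frobenius, integrality and descent from k to 𝔽q².

module Scalars {p ℓ} (em : ExcludedMiddle ℓ) {D : UnramifiedQuadraticExtension p ℓ}
  {𝕎 : RelativeWittVectors D} {n h : ℕ}
  {K₂ : WittFractionField D 𝕎 (UnramifiedQuadraticExtension.𝔽q² D)
          (UnramifiedQuadraticExtension.𝔽q→𝔽q² D)}
  {𝕏 : FramingObject D K₂ n h} {X : AlgebraicallyClosedExtension D}
  (𝒩 : BaseChange D K₂ 𝕏 X) where

  open UnramifiedQuadraticExtension D
  open AlgebraicallyClosedExtension X
  open BaseChange 𝒩
  open Fₖ using (_≈_; _+_; _*_; -_; 0#; 1#; sym; trans; *-congˡ; *-congʳ; *-cong)
  private
    module k = Field k
    module Wₖ = CommutativeRing Kₖ.W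
    module W₂ = CommutativeRing K₂.W
    module f = FieldHomProperties {K = 𝔽q²} {k} 𝔽q²→k
    module ι = HomProperties {R = Kₖ.W} {S = Fₖ.ring′} Kₖ.ι
    module ι₂ = HomProperties {R = K₂.W} {S = F₂.ring′} K₂.ι
  module σ = FieldHomProperties {K = Kₖ.𝐅} {Kₖ.𝐅} Kₖ.σ
  module g = FieldHomProperties {K = K₂.𝐅} {Kₖ.𝐅} F₂→Fₖ

  σ : Fₖ.Carrier → Fₖ.Carrier
  σ = ⟦ Kₖ.σ ⟧

  σ² : Fₖ.Carrier → Fₖ.Carrier
  σ² x = σ (σ x)

  g : F₂.Carrier → Fₖ.Carrier
  g = ⟦ F₂→Fₖ ⟧

  ι : Kₖ.W.Carrier → Fₖ.Carrier
  ι = ⟦ Kₖ.ι ⟧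

  d : Fₖ.Carrier
  d = g (⟦ K₂.ι ⟧ δ)

  -- The conditions on I involve values of the form in W, for the index m, and in πW, for all the
  -- others. A general factor c lets one argument serve for all of them.
  Multiple : Fₖ.Carrier → Fₖ.Carrier → Set ℓ
  Multiple c x = ∃ λ w → x ≈ c * ι w

  σ²-cong : ∀ {x y} → x ≈ y → σ² x ≈ σ² y
  σ²-cong eq = σ.⟦⟧-cong (σ.⟦⟧-cong eq)

  abstract
    ι-frob : ∀ w → σ (ι w) ≈ ι (Kₖ.frobʷ w)
    ι-frob = Kₖ.σ-lift

    frobenius-root : ∀ a → ∃ λ x → x k.^ q k.≈ a
    frobenius-root a with FiniteField.nonempty em 𝔽q 𝔽q-order
    ... | q-1 , q≡ = ≡.subst (λ q → ∃ λ x → x k.^ q k.≈ a) (≡.sym q≡)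
                       (algebraicallyClosed⇒roots {K = k} k-closed q-1 a)

    -- Frobenius acts componentwise on Witt vectors, so it suffices that k has q-th roots. This is
    -- why integrality of x may be tested on σ x.
    frobʷ-surjective : ∀ w → ∃ λ v → Kₖ.frobʷ v Wₖ.≈ w
    frobʷ-surjective w = (λ n → proj₁ (frobenius-root (w n))) , (λ n → proj₂ (frobenius-root (w n)))

    σ-ι-surjective : ∀ w → ∃ λ v → σ (ι v) ≈ ι w
    σ-ι-surjective w with frobʷ-surjective w
    ... | v , eq = v , trans (ι-frob v) (ι.⟦⟧-cong eq)

    σ²-ι-surjective : ∀ w → ∃ λ v → σ² (ι v) ≈ ι w
    σ²-ι-surjective w with σ-ι-surjective w
    ... | v , eq with σ-ι-surjective v
    ...   | u , eq′ = u , trans (σ.⟦⟧-cong eq′) eq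

    σ²-ι : ∀ w → ∃ λ v → σ² (ι w) ≈ ι v
    σ²-ι w = Kₖ.frobʷ (Kₖ.frobʷ w) , trans (σ.⟦⟧-cong (ι-frob w)) (ι-frob _)

    Multiple-resp : ∀ c {x y} → x ≈ y → Multiple c x → Multiple c y
    Multiple-resp c eq (w , e) = w , trans (sym eq) e

    Multiple-0 : ∀ c → Multiple c 0#
    Multiple-0 c = Wₖ.0# , sym (trans (*-congˡ ι.0#-homo) (Fₖ.zeroʳ c))

    Multiple-+ : ∀ c {x y} → Multiple c x → Multiple c y → Multiple c (x + y)
    Multiple-+ c (v , e) (w , e′) = v Wₖ.+ w , trans (Fₖ.+-cong e e′)
      (trans (sym (Fₖ.distribˡ c (ι v) (ι w))) (*-congˡ (sym (ι.+-homo v w))))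

    Multiple-* : ∀ c w {x} → Multiple c x → Multiple c (ι w * x)
    Multiple-* c w {x} (v , e) = w Wₖ.* v , trans (*-congˡ e) (trans (sym (Fₖ.*-assoc (ι w) c (ι v)))
      (trans (*-congʳ (Fₖ.*-comm (ι w) c)) (trans (Fₖ.*-assoc c (ι w) (ι v))
        (*-congˡ (sym (ι.*-homo w v))))))

    Multiple-σ : ∀ c → σ c ≈ c → ∀ {x} → Multiple c x → Multiple c (σ x)
    Multiple-σ c σc (w , e) = Kₖ.frobʷ w ,
      trans (σ.⟦⟧-cong e) (trans (σ.*-homo c (ι w)) (*-cong σc (ι-frob w)))

    Multiple-σ⁻ : ∀ c → σ c ≈ c → ∀ {x} → Multiple c (σ x) → Multiple c x
    Multiple-σ⁻ c σc {x} (w , e) with σ-ι-surjective w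
    ... | v , eq = v , σ.injective em (trans e (trans (*-cong (sym σc) (sym eq)) (sym (σ.*-homo c (ι v)))))

    Integral⇒Multiple : ∀ {x} → Kₖ.Integral x → Multiple 1# x
    Integral⇒Multiple (w , e) = w , trans e (sym (Fₖ.*-identityˡ (ι w)))

    Multiple⇒Integral : ∀ {x} → Multiple 1# x → Kₖ.Integral x
    Multiple⇒Integral (w , e) = w , trans e (Fₖ.*-identityˡ (ι w))

    σ²-g-ι : ∀ r → σ² (g (⟦ K₂.ι ⟧ r)) ≈ g (⟦ K₂.ι ⟧ r)
    σ²-g-ι r = trans (σ²-cong (F₂→Fₖ-functorial r)) (trans (σ.⟦⟧-cong (ι-frob fr))
      (trans (ι-frob (Kₖ.frobʷ fr)) (trans (ι.⟦⟧-cong fixed) (sym (F₂→Fₖ-functorial r)))))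
      where
      fr : Kₖ.W.Carrier
      fr = ⟦ 𝔽q²→k ⟧ ∘ r
      q*q : q *ℕ q ≡ q ^ℕ 2
      q*q = ≡.cong (q *ℕ_) (≡.sym (ℕₚ.*-identityʳ q))
      fixed : Kₖ.frobʷ (Kₖ.frobʷ fr) Wₖ.≈ fr
      fixed n = k.trans (SemiringExp.^-assocʳ k.semiring (fr n) q q)
        (k.trans (SemiringExp.^-congʳ k.semiring (fr n) q*q)
        (k.trans (k.sym (f.^-homo (r n) (q ^ℕ 2)))
          (f.⟦⟧-cong (FiniteField.x^∣K∣≈x em 𝔽q² 𝔽q²-order (r n)))))

    σ²-g : ∀ y → σ² (g y) ≈ g y
    σ²-g y with IsFractionField.fraction K₂.isFrac y
    ... | r , s , s≉0 , sy≈r = FieldProperties.*-cancelˡ-≉0 Kₖ.𝐅 (g.≉0-homo s≉0) (begin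
      gs * σ² (g y)       ≈⟨ *-congʳ (σ²-g-ι s) ⟨
      σ² gs * σ² (g y)    ≈⟨ σ.*-homo (σ gs) (σ (g y)) ⟨
      σ (σ gs * σ (g y))  ≈⟨ σ.⟦⟧-cong (σ.*-homo gs (g y)) ⟨
      σ² (gs * g y)       ≈⟨ σ²-cong gs*gy ⟩
      σ² (g (⟦ K₂.ι ⟧ r)) ≈⟨ σ²-g-ι r ⟩
      g (⟦ K₂.ι ⟧ r)      ≈⟨ gs*gy ⟨
      gs * g y            ∎)
      where
      open SetoidReasoning Fₖ.setoid
      gs : Fₖ.Carrier
      gs = g (⟦ K₂.ι ⟧ s)
      gs*gy : gs * g y ≈ g (⟦ K₂.ι ⟧ r)
      gs*gy = trans (sym (g.*-homo (⟦ K₂.ι ⟧ s) y)) (g.⟦⟧-cong sy≈r)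

    -- Since W embeds into its fraction field, the Witt vector itself is fixed. Each component then
    -- satisfies x^(q²) = x, hence comes from 𝔽q².
    σ²-fixed-integral : ∀ {x} → σ² x ≈ x → Kₖ.Integral x →
      ∃ λ (r : K₂.W.Carrier) → x ≈ g (⟦ K₂.ι ⟧ r)
    σ²-fixed-integral {x} σ²x≈x (w , x≈w) = (λ n → proj₁ (preimage n)) ,
      trans x≈w (trans (ι.⟦⟧-cong (λ n → k.sym (proj₂ (preimage n)))) (sym (F₂→Fₖ-functorial _)))
      where
      fixed : Kₖ.frobʷ (Kₖ.frobʷ w) Wₖ.≈ w
      fixed = IsFractionField.injective Kₖ.isFrac (trans (sym (trans (σ.⟦⟧-cong (ι-frob w)) (ι-frob (Kₖ.frobʷ w))))
        (trans (sym (σ²-cong x≈w)) (trans σ²x≈x x≈w)))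
      w^q² : ∀ n → w n k.^ (q ^ℕ 2) k.≈ w n
      w^q² n = k.trans (SemiringExp.^-congʳ k.semiring (w n) (≡.cong (q *ℕ_) (ℕₚ.*-identityʳ q)))
        (k.trans (k.sym (SemiringExp.^-assocʳ k.semiring (w n) q q)) (fixed n))
      preimage : ∀ n → ∃ λ x → ⟦ 𝔽q²→k ⟧ x k.≈ w n
      preimage n = frobenius-fixed⇒∈image em {𝔽q²} {k} 𝔽q²→k 𝔽q²-order (w n) (w^q² n)

    σ-d : σ d ≈ - d
    σ-d = trans (σ.⟦⟧-cong (F₂→Fₖ-functorial δ)) (trans (ι-frob fδ)
      (trans (ι.⟦⟧-cong λ n → k.trans (k.sym (f.^-homo (δ n) q)) (f.⟦⟧-cong (δ-σ n)))
      (trans (sym (F₂→Fₖ-functorial (W₂.- δ)))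
      (trans (g.⟦⟧-cong (ι₂.-‿homo δ)) (g.-‿homo (⟦ K₂.ι ⟧ δ))))))
      where
      fδ : Kₖ.W.Carrier
      fδ = ⟦ 𝔽q²→k ⟧ ∘ δ

    d≉0 : ¬ (d ≈ 0#)
    d≉0 d≈0 with δ-unit
    ... | ε , δε≈1 = Fₖ.1≉0 (trans (sym (trans (g.⟦⟧-cong ι₂.1#-homo) g.1#-homo))
      (trans (g.⟦⟧-cong (ι₂.⟦⟧-cong (W₂.sym δε≈1)))
      (trans (g.⟦⟧-cong (ι₂.*-homo δ ε))
      (trans (g.*-homo (⟦ K₂.ι ⟧ δ) (⟦ K₂.ι ⟧ ε)) (trans (*-congʳ d≈0) (Fₖ.zeroˡ _))))))

-- The semilinear operators and the form on Nₖ.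

module VectorSpaces {ℓ} (em : ExcludedMiddle ℓ) (K : Field ℓ) (V : Module (Field.ring′ K) ℓ ℓ) where
  open Field K hiding (refl; zero)
  open Module V
  open LinearCombinations V

  *ₗ-inverse : ∀ {x y} → x * y ≈ 1# → ∀ v → x *ₗ (y *ₗ v) ≈ᴹ v
  *ₗ-inverse {x} {y} xy≈1 v = ≈ᴹ-trans (≈ᴹ-sym (*ₗ-assoc x y v)) (≈ᴹ-trans (*ₗ-congʳ xy≈1) (*ₗ-identityˡ v))

  *ₗ-cancelˡ : ∀ {x u v} → ¬ (x ≈ 0#) → x *ₗ u ≈ᴹ x *ₗ v → u ≈ᴹ v
  *ₗ-cancelˡ {x} {u} {v} x≉0 eq with inverse x x≉0
  ... | y , xy≈1 = ≈ᴹ-trans (≈ᴹ-sym (*ₗ-inverse yx≈1 u)) (≈ᴹ-trans (*ₗ-congˡ eq) (*ₗ-inverse yx≈1 v))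
    where
    yx≈1 : y * x ≈ 1#
    yx≈1 = trans (*-comm y x) xy≈1

  *ₗ-cancelʳ : ∀ {x y v} → ¬ (v ≈ᴹ 0ᴹ) → x *ₗ v ≈ᴹ y *ₗ v → x ≈ y
  *ₗ-cancelʳ {x} {y} {v} v≉0 eq = FieldProperties.x-y≈0⇒x≈y K (decidable-stable em λ x-y≉0 →
    v≉0 (*ₗ-cancelˡ x-y≉0 (≈ᴹ-trans vanish (≈ᴹ-sym (*ₗ-zeroʳ (x + - y))))))
    where
    vanish : (x + - y) *ₗ v ≈ᴹ 0ᴹ
    vanish = ≈ᴹ-trans (*ₗ-distribʳ v x (- y)) (≈ᴹ-trans (+ᴹ-congʳ eq)
      (≈ᴹ-trans (≈ᴹ-sym (*ₗ-distribʳ v y (- y))) (≈ᴹ-trans (*ₗ-congʳ (-‿inverseʳ y)) (*ₗ-zeroˡ v))))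

  independent⇒nonzero : ∀ {d} (b : Fin d → Carrierᴹ) → Fin d → Independent b → ∃ λ v → ¬ (v ≈ᴹ 0ᴹ)
  independent⇒nonzero b i ind = decidable-stable em λ none → 1≉0 (ind (λ _ → 1#)
    (sum∈ (_≈ᴹ 0ᴹ) ≈ᴹ-refl (λ u v u≈0 v≈0 → ≈ᴹ-trans (+ᴹ-cong u≈0 v≈0) (+ᴹ-identityˡ 0ᴹ))
      (λ j → 1# *ₗ b j)
      (λ j → ≈ᴹ-trans (*ₗ-identityˡ (b j)) (decidable-stable em λ neq → none (b j , neq)))) i)

module Operators {p ℓ} (em : ExcludedMiddle ℓ) {D : UnramifiedQuadraticExtension p ℓ}
  {𝕎 : RelativeWittVectors D} {n h : ℕ} (1≤n : 1 ≤ n)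
  {K₂ : WittFractionField D 𝕎 (UnramifiedQuadraticExtension.𝔽q² D)
          (UnramifiedQuadraticExtension.𝔽q→𝔽q² D)}
  {𝕏 : FramingObject D K₂ n h} {X : AlgebraicallyClosedExtension D}
  (𝒩 : BaseChange D K₂ 𝕏 X) where

  open UnramifiedQuadraticExtension D
  open BaseChange 𝒩
  open Scalars em 𝒩
  open Fₖ using (_≈_; _+_; _*_; -_; 0#; 1#; sym; trans; *-congˡ; *-congʳ; *-cong)
  open Nₖ
  open Module Nₖ.module′ using (≈ᴹ-refl; ≈ᴹ-sym; ≈ᴹ-trans; ≈ᴹ-setoid; +ᴹ-cong; *ₗ-cong; *ₗ-congˡ;
    *ₗ-congʳ; *ₗ-zeroˡ; *ₗ-zeroʳ; *ₗ-distribˡ; *ₗ-assoc)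
  open VectorSpaces em Kₖ.𝐅 Nₖ.module′
  private
    module M = SetoidReasoning ≈ᴹ-setoid
    module F→𝐅 = FieldHomProperties {K = F} {Kₖ.𝐅} Kₖ.F→𝐅
    module 𝒪F→F = HomProperties {R = 𝒪F} {S = F.ring′} 𝒪F→F

  π₀ : Fₖ.Carrier
  π₀ = Kₖ.π′

  *ₗ-swap : ∀ x y v → x *ₗ (y *ₗ v) ≈ᴹ y *ₗ (x *ₗ v)
  *ₗ-swap x y v = ≈ᴹ-trans (≈ᴹ-sym (*ₗ-assoc x y v)) (≈ᴹ-trans (*ₗ-congʳ (Fₖ.*-comm x y)) (*ₗ-assoc y x v))

  abstract
    π₀≉0 : ¬ (π₀ ≈ 0#)
    π₀≉0 = F→𝐅.≉0-homo (λ eq → π≉0 (IsIntegralClosure.injective is𝒪F (F.trans eq (F.sym 𝒪F→F.0#-homo))))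

    𝒱-0 : 𝒱 0ᴹ ≈ᴹ 0ᴹ
    𝒱-0 = ≈ᴹ-trans (𝒱-cong (≈ᴹ-sym (≈ᴹ-trans (*ₗ-congʳ σ.0#-homo) (*ₗ-zeroˡ 0ᴹ))))
            (≈ᴹ-trans (𝒱-σ 0# 0ᴹ) (*ₗ-zeroˡ (𝒱 0ᴹ)))

    nonzero : ∃ λ v → ¬ (v ≈ᴹ 0ᴹ)
    nonzero = independent⇒nonzero (proj₁ height) (index 1≤n) (IsBasis.independent (proj₂ height))
      where
      index : ∀ {m} → 1 ≤ m → Fin (2 *ℕ m)
      index (s≤s _) = zero

    ℱ-nonzero : ∀ {v} → ¬ (v ≈ᴹ 0ᴹ) → ¬ (ℱ v ≈ᴹ 0ᴹ)
    ℱ-nonzero {v} v≉0 ℱv≈0 = v≉0 (*ₗ-cancelˡ π₀≉0 (≈ᴹ-trans (≈ᴹ-sym (𝒱ℱ v))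
      (≈ᴹ-trans (𝒱-cong ℱv≈0) (≈ᴹ-trans 𝒱-0 (≈ᴹ-sym (*ₗ-zeroʳ π₀))))))

    -- The E-action commutes with ℱ, and F acts by scalars.
    σ-F : ∀ y → σ (⟦ Kₖ.F→𝐅 ⟧ y) ≈ ⟦ Kₖ.F→𝐅 ⟧ y
    σ-F y = *ₗ-cancelʳ (ℱ-nonzero (proj₂ nonzero)) (M.begin
      σ a *ₗ ℱ v             M.≈⟨ ℱ-σ a v ⟨
      ℱ (a *ₗ v)             M.≈⟨ ℱ-cong (act-F y v) ⟨
      ℱ (act (⟦ F→E ⟧ y) v)  M.≈⟨ act-ℱ (⟦ F→E ⟧ y) v ⟨
      act (⟦ F→E ⟧ y) (ℱ v)  M.≈⟨ act-F y (ℱ v) ⟩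
      a *ₗ ℱ v               M.∎)
      where
      v : Carrierᴹ
      v = proj₁ nonzero
      a : Fₖ.Carrier
      a = ⟦ Kₖ.F→𝐅 ⟧ y

  σ-π₀ : σ π₀ ≈ π₀
  σ-π₀ = σ-F (⟦ 𝒪F→F ⟧ π)

  ϖ : Fₖ.Carrier
  ϖ = proj₁ (Fₖ.inverse π₀ π₀≉0)

  abstract
    π₀ϖ : π₀ * ϖ ≈ 1#
    π₀ϖ = proj₂ (Fₖ.inverse π₀ π₀≉0)

    ϖπ₀ : ϖ * π₀ ≈ 1#
    ϖπ₀ = trans (Fₖ.*-comm ϖ π₀) π₀ϖ

    σ-inverse : ∀ {x y} → x * y ≈ 1# → σ x ≈ x → σ y ≈ y
    σ-inverse {x} {y} xy≈1 σx≈x = FieldProperties.*-cancelˡ-≉0 Kₖ.𝐅 {x}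
      (λ x≈0 → Fₖ.1≉0 (trans (sym xy≈1) (trans (*-congʳ x≈0) (Fₖ.zeroˡ y))))
      (trans (*-congʳ (sym σx≈x)) (trans (sym (σ.*-homo x y)) (trans (σ.⟦⟧-cong xy≈1)
        (trans σ.1#-homo (sym xy≈1)))))

    σ-ϖ : σ ϖ ≈ ϖ
    σ-ϖ = σ-inverse π₀ϖ σ-π₀

    𝒱𝒱⁻¹ : ∀ v → 𝒱 (𝒱⁻¹ v) ≈ᴹ v
    𝒱𝒱⁻¹ v = proj₁ 𝒱-inverse ≈ᴹ-refl

    𝒱⁻¹𝒱 : ∀ v → 𝒱⁻¹ (𝒱 v) ≈ᴹ v
    𝒱⁻¹𝒱 v = proj₂ 𝒱-inverse ≈ᴹ-refl

    𝒱⁻¹-unique : ∀ {u v} → u ≈ᴹ 𝒱 v → 𝒱⁻¹ u ≈ᴹ v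
    𝒱⁻¹-unique = proj₂ 𝒱-inverse

    𝒱⁻¹-cong : ∀ {u v} → u ≈ᴹ v → 𝒱⁻¹ u ≈ᴹ 𝒱⁻¹ v
    𝒱⁻¹-cong {u} {v} u≈v = 𝒱⁻¹-unique (≈ᴹ-trans u≈v (≈ᴹ-sym (𝒱𝒱⁻¹ v)))

    𝒱⁻¹-+ : ∀ u v → 𝒱⁻¹ (u +ᴹ v) ≈ᴹ 𝒱⁻¹ u +ᴹ 𝒱⁻¹ v
    𝒱⁻¹-+ u v = 𝒱⁻¹-unique (≈ᴹ-sym (≈ᴹ-trans (𝒱-+ (𝒱⁻¹ u) (𝒱⁻¹ v)) (+ᴹ-cong (𝒱𝒱⁻¹ u) (𝒱𝒱⁻¹ v))))

    𝒱⁻¹-σ : ∀ x v → 𝒱⁻¹ (x *ₗ v) ≈ᴹ σ x *ₗ 𝒱⁻¹ v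
    𝒱⁻¹-σ x v = 𝒱⁻¹-unique (≈ᴹ-sym (≈ᴹ-trans (𝒱-σ x (𝒱⁻¹ v)) (*ₗ-congˡ (𝒱𝒱⁻¹ v))))

    act-𝒱⁻¹ : ∀ x v → act x (𝒱⁻¹ v) ≈ᴹ 𝒱⁻¹ (act x v)
    act-𝒱⁻¹ x v = ≈ᴹ-sym (𝒱⁻¹-unique (≈ᴹ-trans (act-cong E.refl (≈ᴹ-sym (𝒱𝒱⁻¹ v))) (act-𝒱 x (𝒱⁻¹ v))))

  -- The inverse of τ = π𝒱⁻². The proof moves lattices by θ rather than by τ, because double duality
  -- yields θ(Y) ⊆ L.
  θ : Carrierᴹ → Carrierᴹ
  θ v = ϖ *ₗ 𝒱 (𝒱 v)

  abstract
    τ-cong : ∀ {u v} → u ≈ᴹ v → τ u ≈ᴹ τ v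
    τ-cong eq = *ₗ-congˡ (𝒱⁻¹-cong (𝒱⁻¹-cong eq))

    τ-+ : ∀ u v → τ (u +ᴹ v) ≈ᴹ τ u +ᴹ τ v
    τ-+ u v = ≈ᴹ-trans (*ₗ-congˡ (≈ᴹ-trans (𝒱⁻¹-cong (𝒱⁻¹-+ u v)) (𝒱⁻¹-+ (𝒱⁻¹ u) (𝒱⁻¹ v))))
                (*ₗ-distribˡ π₀ (𝒱⁻¹ (𝒱⁻¹ u)) (𝒱⁻¹ (𝒱⁻¹ v)))

    τ-* : ∀ x v → τ (x *ₗ v) ≈ᴹ σ² x *ₗ τ v
    τ-* x v = ≈ᴹ-trans (*ₗ-congˡ (≈ᴹ-trans (𝒱⁻¹-cong (𝒱⁻¹-σ x v)) (𝒱⁻¹-σ (σ x) (𝒱⁻¹ v))))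
                (*ₗ-swap π₀ (σ² x) (𝒱⁻¹ (𝒱⁻¹ v)))

    θ-cong : ∀ {u v} → u ≈ᴹ v → θ u ≈ᴹ θ v
    θ-cong eq = *ₗ-congˡ (𝒱-cong (𝒱-cong eq))

    θ-+ : ∀ u v → θ (u +ᴹ v) ≈ᴹ θ u +ᴹ θ v
    θ-+ u v = ≈ᴹ-trans (*ₗ-congˡ (≈ᴹ-trans (𝒱-cong (𝒱-+ u v)) (𝒱-+ (𝒱 u) (𝒱 v))))
                (*ₗ-distribˡ ϖ (𝒱 (𝒱 u)) (𝒱 (𝒱 v)))

    θ-* : ∀ x v → θ (σ² x *ₗ v) ≈ᴹ x *ₗ θ v
    θ-* x v = ≈ᴹ-trans (*ₗ-congˡ (≈ᴹ-trans (𝒱-cong (𝒱-σ (σ x) v)) (𝒱-σ x (𝒱 v))))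
                (*ₗ-swap ϖ x (𝒱 (𝒱 v)))

    τθ : ∀ v → τ (θ v) ≈ᴹ v
    τθ v = M.begin
      τ (ϖ *ₗ 𝒱 (𝒱 v))                         M.≈⟨ τ-* ϖ (𝒱 (𝒱 v)) ⟩
      σ² ϖ *ₗ (π₀ *ₗ 𝒱⁻¹ (𝒱⁻¹ (𝒱 (𝒱 v))))     M.≈⟨ *ₗ-cong (trans (σ.⟦⟧-cong σ-ϖ) σ-ϖ)
                                                   (*ₗ-congˡ (≈ᴹ-trans (𝒱⁻¹-cong (𝒱⁻¹𝒱 (𝒱 v))) (𝒱⁻¹𝒱 v))) ⟩
      ϖ *ₗ (π₀ *ₗ v)                           M.≈⟨ *ₗ-inverse ϖπ₀ v ⟩
      v                                        M.∎

    θτ : ∀ v → θ (τ v) ≈ᴹ v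
    θτ v = M.begin
      θ (π₀ *ₗ 𝒱⁻¹ (𝒱⁻¹ v))       M.≈⟨ θ-cong (*ₗ-congʳ (sym (trans (σ.⟦⟧-cong σ-π₀) σ-π₀))) ⟩
      θ (σ² π₀ *ₗ 𝒱⁻¹ (𝒱⁻¹ v))    M.≈⟨ θ-* π₀ (𝒱⁻¹ (𝒱⁻¹ v)) ⟩
      π₀ *ₗ (ϖ *ₗ 𝒱 (𝒱 (𝒱⁻¹ (𝒱⁻¹ v))))  M.≈⟨ *ₗ-inverse π₀ϖ _ ⟩
      𝒱 (𝒱 (𝒱⁻¹ (𝒱⁻¹ v)))         M.≈⟨ 𝒱-cong (𝒱𝒱⁻¹ (𝒱⁻¹ v)) ⟩
      𝒱 (𝒱⁻¹ v)                   M.≈⟨ 𝒱𝒱⁻¹ v ⟩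
      v                           M.∎

    θ-fixed : ∀ {x} → σ x ≈ x → ∀ v → θ (x *ₗ v) ≈ᴹ x *ₗ θ v
    θ-fixed {x} σx≈x v = ≈ᴹ-trans (θ-cong (*ₗ-congʳ (sym (trans (σ.⟦⟧-cong σx≈x) σx≈x)))) (θ-* x v)

    τ-fixed : ∀ {x} → σ x ≈ x → ∀ v → τ (x *ₗ v) ≈ᴹ x *ₗ τ v
    τ-fixed {x} σx≈x v = ≈ᴹ-trans (τ-* x v) (*ₗ-congʳ (trans (σ.⟦⟧-cong σx≈x) σx≈x))

    θ-0 : θ 0ᴹ ≈ᴹ 0ᴹ
    θ-0 = ≈ᴹ-trans (*ₗ-congˡ (≈ᴹ-trans (𝒱-cong 𝒱-0) 𝒱-0)) (*ₗ-zeroʳ ϖ)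

    τ-0 : τ 0ᴹ ≈ᴹ 0ᴹ
    τ-0 = ≈ᴹ-trans (τ-cong (≈ᴹ-sym θ-0)) (τθ 0ᴹ)

    Nₖ₀-resp : ∀ {u v} → u ≈ᴹ v → u ∈ Nₖ₀ → v ∈ Nₖ₀
    Nₖ₀-resp eq u∈ x = ≈ᴹ-trans (act-cong E.refl (≈ᴹ-sym eq)) (≈ᴹ-trans (u∈ x) (*ₗ-congˡ eq))

    Nₖ₀-+ : ∀ {u v} → u ∈ Nₖ₀ → v ∈ Nₖ₀ → (u +ᴹ v) ∈ Nₖ₀
    Nₖ₀-+ {u} {v} u∈ v∈ x = ≈ᴹ-trans (act-+ᴹ x u v) (≈ᴹ-trans (+ᴹ-cong (u∈ x) (v∈ x))
      (≈ᴹ-sym (*ₗ-distribˡ (g (⟦ φ₀ ⟧ x)) u v)))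

    Nₖ₀-* : ∀ y {v} → v ∈ Nₖ₀ → (y *ₗ v) ∈ Nₖ₀
    Nₖ₀-* y {v} v∈ x = ≈ᴹ-trans (act-*ₗ x y v) (≈ᴹ-trans (*ₗ-congˡ (v∈ x)) (*ₗ-swap y (g (⟦ φ₀ ⟧ x)) v))

    Nₖ₀-0 : 0ᴹ ∈ Nₖ₀
    Nₖ₀-0 x = ≈ᴹ-trans (act-cong E.refl (≈ᴹ-sym (*ₗ-zeroˡ 0ᴹ))) (≈ᴹ-trans (act-*ₗ x 0# 0ᴹ)
      (≈ᴹ-trans (*ₗ-zeroˡ (act x 0ᴹ)) (≈ᴹ-sym (*ₗ-zeroʳ (g (⟦ φ₀ ⟧ x))))))

    -- 𝒱 is E-linear but σ⁻¹-semilinear, so one 𝒱 changes the eigenvalues of E. Two of them do not,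
    -- as σ² fixes the scalars coming from `F₂`.
    Nₖ₀-θ : ∀ {v} → v ∈ Nₖ₀ → θ v ∈ Nₖ₀
    Nₖ₀-θ {v} v∈ x = M.begin
      act x (ϖ *ₗ 𝒱 (𝒱 v))       M.≈⟨ act-*ₗ x ϖ (𝒱 (𝒱 v)) ⟩
      ϖ *ₗ act x (𝒱 (𝒱 v))       M.≈⟨ *ₗ-congˡ (≈ᴹ-trans (act-𝒱 x (𝒱 v)) (𝒱-cong (act-𝒱 x v))) ⟩
      θ (act x v)                M.≈⟨ θ-cong (v∈ x) ⟩
      θ (a *ₗ v)                 M.≈⟨ θ-cong (*ₗ-congʳ (sym (σ²-g (⟦ φ₀ ⟧ x)))) ⟩
      θ (σ² a *ₗ v)              M.≈⟨ θ-* a v ⟩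
      a *ₗ θ v                   M.∎
      where
      a : Fₖ.Carrier
      a = g (⟦ φ₀ ⟧ x)

    Nₖ₀-τ : ∀ {v} → v ∈ Nₖ₀ → τ v ∈ Nₖ₀
    Nₖ₀-τ {v} v∈ x = M.begin
      act x (π₀ *ₗ 𝒱⁻¹ (𝒱⁻¹ v))  M.≈⟨ act-*ₗ x π₀ (𝒱⁻¹ (𝒱⁻¹ v)) ⟩
      π₀ *ₗ act x (𝒱⁻¹ (𝒱⁻¹ v))  M.≈⟨ *ₗ-congˡ (≈ᴹ-trans (act-𝒱⁻¹ x (𝒱⁻¹ v)) (𝒱⁻¹-cong (act-𝒱⁻¹ x v))) ⟩
      τ (act x v)                M.≈⟨ τ-cong (v∈ x) ⟩
      τ (a *ₗ v)                 M.≈⟨ τ-* a v ⟩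
      σ² a *ₗ τ v                M.≈⟨ *ₗ-congʳ (σ²-g (⟦ φ₀ ⟧ x)) ⟩
      a *ₗ τ v                   M.∎
      where
      a : Fₖ.Carrier
      a = g (⟦ φ₀ ⟧ x)

    ⟪⟫-cong : ∀ {u v w x} → u ≈ᴹ v → w ≈ᴹ x → ⟪ u , w ⟫ ≈ ⟪ v , x ⟫
    ⟪⟫-cong eq eq′ = *-congˡ (⟨⟩-cong eq (ℱ-cong eq′))

    ⟪⟫-+ˡ : ∀ u v w → ⟪ u +ᴹ v , w ⟫ ≈ ⟪ u , w ⟫ + ⟪ v , w ⟫
    ⟪⟫-+ˡ u v w = trans (*-congˡ (⟨⟩-+ˡ u v (ℱ w))) (Fₖ.distribˡ d _ _)

    ⟪⟫-+ʳ : ∀ u v w → ⟪ u , v +ᴹ w ⟫ ≈ ⟪ u , v ⟫ + ⟪ u , w ⟫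
    ⟪⟫-+ʳ u v w = trans (*-congˡ (trans (⟨⟩-cong ≈ᴹ-refl (ℱ-+ v w)) (⟨⟩-+ʳ u (ℱ v) (ℱ w)))) (Fₖ.distribˡ d _ _)

    private
      *-swap : ∀ x y z → x * (y * z) ≈ y * (x * z)
      *-swap x y z = trans (sym (Fₖ.*-assoc x y z)) (trans (*-congʳ (Fₖ.*-comm x y)) (Fₖ.*-assoc y x z))

    ⟪⟫-*ˡ : ∀ x v w → ⟪ x *ₗ v , w ⟫ ≈ x * ⟪ v , w ⟫
    ⟪⟫-*ˡ x v w = trans (*-congˡ (⟨⟩-*ˡ x v (ℱ w))) (*-swap d x ⟨ v , ℱ w ⟩)

    ⟪⟫-*ʳ : ∀ x v w → ⟪ v , x *ₗ w ⟫ ≈ σ x * ⟪ v , w ⟫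
    ⟪⟫-*ʳ x v w = trans (*-congˡ (trans (⟨⟩-cong ≈ᴹ-refl (ℱ-σ x w)) (⟨⟩-*ʳ (σ x) v (ℱ w)))) (*-swap d (σ x) ⟨ v , ℱ w ⟩)

    ⟪⟫-0ˡ : ∀ w → ⟪ 0ᴹ , w ⟫ ≈ 0#
    ⟪⟫-0ˡ w = trans (⟪⟫-cong (≈ᴹ-sym (*ₗ-zeroˡ 0ᴹ)) ≈ᴹ-refl) (trans (⟪⟫-*ˡ 0# 0ᴹ w) (Fₖ.zeroˡ _))

    ⟪⟫-0ʳ : ∀ v → ⟪ v , 0ᴹ ⟫ ≈ 0#
    ⟪⟫-0ʳ v = trans (⟪⟫-cong ≈ᴹ-refl (≈ᴹ-sym (*ₗ-zeroˡ 0ᴹ))) (trans (⟪⟫-*ʳ 0# v 0ᴹ)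
                (trans (*-congʳ σ.0#-homo) (Fₖ.zeroˡ _)))

    ⟨⟩-antisym : ∀ v w → - ⟨ v , w ⟩ ≈ ⟨ w , v ⟩
    ⟨⟩-antisym v w = FieldProperties.x+y≈0⇒-x≈y Kₖ.𝐅 (trans (sym expanded) (⟨⟩-alternating (v +ᴹ w)))
      where
      expanded : ⟨ v +ᴹ w , v +ᴹ w ⟩ ≈ ⟨ v , w ⟩ + ⟨ w , v ⟩
      expanded = trans (⟨⟩-+ˡ v w (v +ᴹ w)) (Fₖ.+-cong
        (trans (⟨⟩-+ʳ v v w) (trans (Fₖ.+-congʳ (⟨⟩-alternating v)) (Fₖ.+-identityˡ _)))
        (trans (⟨⟩-+ʳ w v w) (trans (Fₖ.+-congˡ (⟨⟩-alternating w)) (Fₖ.+-identityʳ _))))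

    𝒱⁻¹ℱ : ∀ w → 𝒱⁻¹ (ℱ w) ≈ᴹ τ w
    𝒱⁻¹ℱ w = M.begin
      𝒱⁻¹ (ℱ w)                  M.≈⟨ 𝒱⁻¹-cong (≈ᴹ-sym (𝒱⁻¹𝒱 (ℱ w))) ⟩
      𝒱⁻¹ (𝒱⁻¹ (𝒱 (ℱ w)))        M.≈⟨ 𝒱⁻¹-cong (𝒱⁻¹-cong (𝒱ℱ w)) ⟩
      𝒱⁻¹ (𝒱⁻¹ (π₀ *ₗ w))        M.≈⟨ 𝒱⁻¹-cong (𝒱⁻¹-σ π₀ w) ⟩
      𝒱⁻¹ (σ π₀ *ₗ 𝒱⁻¹ w)        M.≈⟨ 𝒱⁻¹-σ (σ π₀) (𝒱⁻¹ w) ⟩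
      σ² π₀ *ₗ 𝒱⁻¹ (𝒱⁻¹ w)       M.≈⟨ *ₗ-congʳ (trans (σ.⟦⟧-cong σ-π₀) σ-π₀) ⟩
      τ w                        M.∎

    -- The sign in σ d = - d cancels that of the antisymmetric pairing, which is the reason for the
    -- factor δ; τ enters as 𝒱⁻¹ℱ. On C, where τ is the identity, this is hermitian symmetry.
    σ-⟪⟫ : ∀ v w → σ ⟪ v , w ⟫ ≈ ⟪ τ w , v ⟫
    σ-⟪⟫ v w = trans (σ.*-homo d _) (trans (*-cong σ-d σ⟨⟩)
      (trans (sym (-‿distribˡ-* d _)) (trans (-‿distribʳ-* d _)
        (*-congˡ (⟨⟩-antisym (ℱ v) (τ w))))))
      where
      open FieldProperties Kₖ.𝐅
      σ⟨⟩ : σ (⟨ v , ℱ w ⟩) ≈ ⟨ ℱ v , τ w ⟩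
      σ⟨⟩ = trans (σ.⟦⟧-cong (⟨⟩-cong ≈ᴹ-refl (≈ᴹ-sym (𝒱𝒱⁻¹ (ℱ w)))))
        (trans (sym (⟨⟩-ℱ𝒱 v (𝒱⁻¹ (ℱ w)))) (⟨⟩-cong ≈ᴹ-refl (𝒱⁻¹ℱ w)))

    ⟪⟫-ττ : ∀ v w → ⟪ τ v , τ w ⟫ ≈ σ² ⟪ v , w ⟫
    ⟪⟫-ττ v w = sym (trans (σ.⟦⟧-cong (σ-⟪⟫ v w)) (σ-⟪⟫ (τ w) v))

-- Nondegeneracy of the form on Nₖ₀.

module KroneckerDelta {ℓ} (R : CommutativeRing ℓ ℓ) where
  open CommutativeRing R hiding (refl; zero)
  open SemiringSum (CommutativeRing.semiring R)

  δ : ∀ {n} → Fin n → Fin n → Carrier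
  δ zero    zero    = 1#
  δ zero    (suc j) = 0#
  δ (suc i) zero    = 0#
  δ (suc i) (suc j) = δ i j

  sum-δ : ∀ {n} (x : Fin n → Carrier) k → sum (λ j → x j * δ k j) ≈ x k
  sum-δ {suc n} x zero = trans (+-cong (*-identityʳ (x zero))
    (trans (sum-cong-≋ {n} (λ j → zeroʳ (x (suc j)))) (sum-replicate-zero n))) (+-identityʳ (x zero))
  sum-δ {suc n} x (suc k) = trans (+-cong (zeroʳ (x zero)) (sum-δ (x ∘ suc) k)) (+-identityˡ (x (suc k)))

-- At level 2 of the inverse limit, 2 = 0 would mean that p² ≥ 4 divides 2.
2≉0ₚ : ∀ {p} → Prime p → let open CommutativeRing (PAdic.ℤₚ p) in ¬ (1# + 1# ≈ 0#)
2≉0ₚ {p} (prime _) 2≈0 = ℕₚ.<⇒≱ (ℕₚ.m<m+n 2 {2} (s≤s z≤n)) (ℕₚ.≤-trans 4≤p² p²≤2)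
  where
  2≤p : 2 ≤ p
  2≤p = nonTrivial⇒n>1 p
  4≤p² : 4 ≤ p ^ℕ 2
  4≤p² = ℕₚ.^-monoˡ-≤ 2 2≤p
  p²≤2 : p ^ℕ 2 ≤ 2
  p²≤2 = ℕ∣.∣⇒≤ (ℤ∣.∣⇒∣ᵤ (2≈0 2))

module Duality {p ℓ} (em : ExcludedMiddle ℓ) (p-prime : Prime p) {D : UnramifiedQuadraticExtension p ℓ}
  {𝕎 : RelativeWittVectors D} {n h : ℕ} (1≤n : 1 ≤ n)
  {K₂ : WittFractionField D 𝕎 (UnramifiedQuadraticExtension.𝔽q² D)
          (UnramifiedQuadraticExtension.𝔽q→𝔽q² D)}
  {𝕏 : FramingObject D K₂ n h} {X : AlgebraicallyClosedExtension D}
  (𝒩 : BaseChange D K₂ 𝕏 X) where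

  open UnramifiedQuadraticExtension D
  open BaseChange 𝒩
  open Scalars em 𝒩
  open Operators em 1≤n 𝒩
  open Fₖ using (_≈_; _+_; _*_; -_; 0#; 1#; sym; trans; *-congˡ; *-congʳ; *-cong; +-cong; +-congˡ;
    +-congʳ)
  open Nₖ
  open Module Nₖ.module′ using (≈ᴹ-refl; ≈ᴹ-sym; ≈ᴹ-trans; ≈ᴹ-setoid; +ᴹ-cong; +ᴹ-congˡ; +ᴹ-congʳ;
    +ᴹ-comm; *ₗ-cong; *ₗ-congˡ; *ₗ-congʳ; *ₗ-distribˡ; *ₗ-distribʳ; *ₗ-assoc)
  open VectorSpaces em Kₖ.𝐅 Nₖ.module′
  open FieldProperties Kₖ.𝐅
  private
    module φ = FieldHomProperties {K = E} {K₂.𝐅} φ₀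
    module F→E = FieldHomProperties {K = F} {E} F→E
    module star = FieldHomProperties {K = E} {E} star
    module ℚₚ→F = FieldHomProperties {K = ℚₚ} {F} ℚₚ→F
    module F→𝐅 = FieldHomProperties {K = F} {Kₖ.𝐅} Kₖ.F→𝐅
    module ℤₚ→ℚₚ = HomProperties {R = PAdic.ℤₚ p} {S = ℚₚ.ring′} ℤₚ→ℚₚ
    module M = SetoidReasoning ≈ᴹ-setoid

  abstract
    2≉0 : ¬ (1# + 1# ≈ 0#)
    2≉0 eq = F→𝐅.≉0-homo (ℚₚ→F.≉0-homo 2≉0ℚ) (trans (F→𝐅.⟦⟧-cong (F.trans (ℚₚ→F.+-homo ℚₚ.1# ℚₚ.1#)
        (F.+-cong ℚₚ→F.1#-homo ℚₚ→F.1#-homo)))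
      (trans (F→𝐅.+-homo F.1# F.1#) (trans (+-cong F→𝐅.1#-homo F→𝐅.1#-homo) eq)))
      where
      2≉0ℚ : ¬ (ℚₚ.1# ℚₚ.+ ℚₚ.1# ℚₚ.≈ ℚₚ.0#)
      2≉0ℚ eq = 2≉0ₚ p-prime (IsFractionField.injective isℚₚ (ℚₚ.trans (ℤₚ→ℚₚ.+-homo _ _)
        (ℚₚ.trans (ℚₚ.+-cong ℤₚ→ℚₚ.1#-homo ℤₚ→ℚₚ.1#-homo) (ℚₚ.trans eq (ℚₚ.sym ℤₚ→ℚₚ.0#-homo)))))

    x+x≈0⇒x≈0 : ∀ {x} → x + x ≈ 0# → x ≈ 0#
    x+x≈0⇒x≈0 {x} eq = x*y≈0⇒y≈0 2≉0 (trans (Fₖ.distribʳ x 1# 1#)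
      (trans (+-cong (Fₖ.*-identityˡ x) (Fₖ.*-identityˡ x)) eq))

    x±y≈0⇒x≈0 : ∀ {x y} → x + y ≈ 0# → x + - y ≈ 0# → x ≈ 0#
    x±y≈0⇒x≈0 {x} {y} eq eq′ = x+x≈0⇒x≈0 (trans (+-congʳ (x-y≈0⇒x≈y eq′)) (trans (Fₖ.+-comm y x) eq))

    x±y≈0⇒y≈0 : ∀ {x y} → x + y ≈ 0# → x + - y ≈ 0# → y ≈ 0#
    x±y≈0⇒y≈0 {x} {y} eq eq′ = trans (sym (Fₖ.+-identityˡ y)) (trans (+-congʳ (sym (x±y≈0⇒x≈0 eq eq′))) eq)

  private
    gφ : E.Carrier → Fₖ.Carrier
    gφ x = g (⟦ φ₀ ⟧ x)

    gφ-cong : ∀ {x y} → x E.≈ y → gφ x ≈ gφ y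
    gφ-cong eq = g.⟦⟧-cong (φ.⟦⟧-cong eq)

    gφ-+ : ∀ x y → gφ (x E.+ y) ≈ gφ x + gφ y
    gφ-+ x y = trans (g.⟦⟧-cong (φ.+-homo x y)) (g.+-homo _ _)

    gφ-* : ∀ x y → gφ (x E.* y) ≈ gφ x * gφ y
    gφ-* x y = trans (g.⟦⟧-cong (φ.*-homo x y)) (g.*-homo _ _)

    gφ-injective : ∀ {x y} → gφ x ≈ gφ y → x E.≈ y
    gφ-injective eq = φ.injective em (g.injective em eq)

    e : E.Carrier
    e = proj₁ (proj₂ φ₀-isomorphism (⟦ K₂.ι ⟧ δ))

    gφ-e : gφ e ≈ d
    gφ-e = g.⟦⟧-cong (proj₂ (proj₂ φ₀-isomorphism (⟦ K₂.ι ⟧ δ)) E.refl)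

  -- Since σ d = - d ≠ d, the element e = φ₀⁻¹(δ) generates E over F, with e² ∈ F and e* = - e.
  module Nondegeneracy (v₀ : Carrierᴹ) (v₀∈Nₖ₀ : v₀ ∈ Nₖ₀) (v₀≉0 : ¬ (v₀ ≈ᴹ 0ᴹ)) where
    private
      a : F.Carrier → Fₖ.Carrier
      a x = ⟦ Kₖ.F→𝐅 ⟧ x

    abstract
      -- Both sides are scalars by which x acts on `v₀`, and a nonzero vector can be cancelled. This
      -- is where the module parameter `v₀` enters.
      gφ-F : ∀ x → gφ (⟦ F→E ⟧ x) ≈ a x
      gφ-F x = *ₗ-cancelʳ v₀≉0 (≈ᴹ-trans (≈ᴹ-sym (v₀∈Nₖ₀ (⟦ F→E ⟧ x))) (act-F x v₀))

      -- Apply σ, which fixes the scalars from F and negates d.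
      conjugates : ∀ x y → a x + a y * d ≈ 0# → a x + - (a y * d) ≈ 0#
      conjugates x y eq = trans (sym (trans (σ.+-homo (a x) (a y * d)) (+-cong (σ-F x)
        (trans (σ.*-homo (a y) d) (trans (*-cong (σ-F y) σ-d) (sym (-‿distribʳ-* (a y) d)))))))
        (trans (σ.⟦⟧-cong eq) σ.0#-homo)

      a≈0⇒≈0 : ∀ {x} → a x ≈ 0# → x F.≈ F.0#
      a≈0⇒≈0 eq = F→𝐅.injective em (trans eq (sym F→𝐅.0#-homo))

      y≈0 : ∀ x y → a x + a y * d ≈ 0# → y F.≈ F.0#
      y≈0 x y eq = a≈0⇒≈0 (x*y≈0⇒y≈0 d≉0 (trans (Fₖ.*-comm d (a y)) (x±y≈0⇒y≈0 eq (conjugates x y eq))))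

      x≈0 : ∀ x y → a x + a y * d ≈ 0# → x F.≈ F.0#
      x≈0 x y eq = a≈0⇒≈0 (x±y≈0⇒x≈0 eq (conjugates x y eq))

      gφ-a+be : ∀ x y → gφ (⟦ F→E ⟧ x E.+ ⟦ F→E ⟧ y E.* e) ≈ a x + a y * d
      gφ-a+be x y = trans (gφ-+ _ _) (+-cong (gφ-F x) (trans (gφ-* _ _) (*-cong (gφ-F y) gφ-e)))

    private
      f : F.Carrier → E.Carrier
      f = ⟦ F→E ⟧

      module Coordinates (b₀ b₁ : E.Carrier) where
        comb : F.Carrier → F.Carrier → E.Carrier
        comb x y = f x E.* b₀ E.+ f y E.* b₁

        comb-cong : ∀ {x x′ y y′} → x F.≈ x′ → y F.≈ y′ → comb x y E.≈ comb x′ y′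
        comb-cong x≈ y≈ = E.+-cong (E.*-congʳ (F→E.⟦⟧-cong x≈)) (E.*-congʳ (F→E.⟦⟧-cong y≈))

        comb-0 : comb F.0# F.0# E.≈ E.0#
        comb-0 = E.trans (E.+-cong (E.trans (E.*-congʳ F→E.0#-homo) (E.zeroˡ b₀))
          (E.trans (E.*-congʳ F→E.0#-homo) (E.zeroˡ b₁))) (E.+-identityʳ E.0#)

        comb-* : ∀ x a b → f x E.* comb a b E.≈ comb (x F.* a) (x F.* b)
        comb-* x a b = E.trans (E.distribˡ (f x) _ _) (E.+-cong (scale a b₀) (scale b b₁))
          where
          scale : ∀ a c → f x E.* (f a E.* c) E.≈ f (x F.* a) E.* c
          scale a c = E.trans (E.sym (E.*-assoc (f x) (f a) c)) (E.*-congʳ (E.sym (F→E.*-homo x a)))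

        comb-+ : ∀ a b c d → comb a b E.+ comb c d E.≈ comb (a F.+ c) (b F.+ d)
        comb-+ a b c d = E.trans (interchange _ _ _ _) (E.+-cong (collect a c b₀) (collect b d b₁))
          where
          open CommutativeSemigroupProperties E.+-commutativeSemigroup using (interchange)
          collect : ∀ a c v → f a E.* v E.+ f c E.* v E.≈ f (a F.+ c) E.* v
          collect a c v = E.trans (E.sym (E.distribʳ v (f a) (f c))) (E.*-congʳ (E.sym (F→E.+-homo a c)))

        change-of-basis : (N : Fin 2 → Fin 2 → F.Carrier) (v : Fin 2 → E.Carrier) →
          (∀ i → v i E.≈ comb (N i zero) (N i (suc zero))) → ∀ x y →
          f x E.* v zero E.+ f y E.* v (suc zero) E.≈
            comb (x F.* N zero zero F.+ (y F.* N (suc zero) zero F.+ F.0#))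
                 (x F.* N zero (suc zero) F.+ (y F.* N (suc zero) (suc zero) F.+ F.0#))
        change-of-basis N v v≈ x y = E.trans (E.+-cong (E.trans (E.*-congˡ (v≈ zero)) (comb-* x _ _))
          (E.trans (E.*-congˡ (v≈ (suc zero))) (comb-* y _ _))) (E.trans (comb-+ _ _ _ _)
          (comb-cong (F.+-congˡ (F.sym (F.+-identityʳ _))) (F.+-congˡ (F.sym (F.+-identityʳ _)))))

    abstract
      -- A relation between 1 and e over F is trivial, as it holds together with its conjugate and 2
      -- ≠ 0. Two independent vectors span a space of dimension 2; `N` is their matrix in the given
      -- basis.
      generated-by-e : ∀ y → ∃ λ s → ∃ λ t → y E.≈ (⟦ F→E ⟧ s E.+ ⟦ F→E ⟧ t E.* e)
      generated-by-e y = result (LinearEquations.injective⇒surjective em F N N-injective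
                           (proj₁ (spanning y)))
        where
        b : Fin 2 → E.Carrier
        b = proj₁ E/F-quadratic
        open Coordinates (b zero) (b (suc zero))
        spanning : ∀ y → ∃ λ (x : Fin 2 → F.Carrier) → y E.≈ comb (x zero) (x (suc zero))
        spanning y with LinearAlgebra.IsBasis.spanning (proj₂ E/F-quadratic) y tt
        ... | x , y≈ = x , E.trans y≈ (E.+-congˡ (E.+-identityʳ _))
        1,e : Fin 2 → E.Carrier
        1,e zero = E.1#
        1,e (suc _) = e
        N : Fin 2 → Fin 2 → F.Carrier
        N i = proj₁ (spanning (1,e i))
        x+ye : ∀ x y → (f x E.+ f y E.* e) E.≈
          comb (x F.* N zero zero F.+ (y F.* N (suc zero) zero F.+ F.0#))
               (x F.* N zero (suc zero) F.+ (y F.* N (suc zero) (suc zero) F.+ F.0#))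
        x+ye x y = E.trans (E.+-congʳ (E.sym (E.*-identityʳ (f x))))
          (change-of-basis N 1,e (λ i → proj₂ (spanning (1,e i))) x y)
        N-injective : ∀ (x : Fin 2 → F.Carrier) → (∀ j → x zero F.* N zero j F.+ (x (suc zero) F.* N (suc zero) j F.+ F.0#) F.≈ F.0#) →
          ∀ i → x i F.≈ F.0#
        N-injective x xN≈0 = λ { zero → x≈0 (x zero) (x (suc zero)) rel ; (suc zero) → y≈0 (x zero) (x (suc zero)) rel }
          where
          rel : a (x zero) + a (x (suc zero)) * d ≈ 0#
          rel = trans (sym (gφ-a+be (x zero) (x (suc zero)))) (trans (gφ-cong (E.trans (x+ye (x zero) (x (suc zero)))
            (E.trans (comb-cong (xN≈0 zero) (xN≈0 (suc zero))) comb-0)))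
            (trans (g.⟦⟧-cong φ.0#-homo) g.0#-homo))
        result : (∃ λ (x : Fin 2 → F.Carrier) → ∀ j → x zero F.* N zero j F.+ (x (suc zero) F.* N (suc zero) j F.+ F.0#)
            F.≈ proj₁ (spanning y) j) →
          ∃ λ s → ∃ λ t → y E.≈ (f s E.+ f t E.* e)
        result (x , xN≈y) = x zero , x (suc zero) , E.trans (proj₂ (spanning y))
          (E.sym (E.trans (x+ye (x zero) (x (suc zero))) (comb-cong (xN≈y zero) (xN≈y (suc zero)))))

      -- Write e² = s + te. Since σ fixes d² and negates d, applying it gives td = - td, hence t =
      -- 0.
      e²∈F : ∃ λ s → (e E.* e) E.≈ ⟦ F→E ⟧ s
      e²∈F with generated-by-e (e E.* e)
      ... | s , t , e²≈ = s , E.trans e²≈ (E.trans (E.+-congˡ (E.trans (E.*-congʳ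
              (E.trans (F→E.⟦⟧-cong t≈0) F→E.0#-homo)) (E.zeroˡ e))) (E.+-identityʳ _))
        where
        d² : d * d ≈ a s + a t * d
        d² = trans (sym (trans (gφ-* e e) (*-cong gφ-e gφ-e))) (trans (gφ-cong e²≈) (gφ-a+be s t))
        d²′ : d * d ≈ a s + - (a t * d)
        d²′ = trans (sym (trans (*-cong σ-d σ-d) (trans (sym (-‿distribˡ-* d (- d)))
            (trans (Fₖ.-‿cong (sym (-‿distribʳ-* d d))) (-‿involutive (d * d))))))
          (trans (sym (σ.*-homo d d)) (trans (σ.⟦⟧-cong d²) (trans (σ.+-homo (a s) (a t * d))
            (+-cong (σ-F s) (trans (σ.*-homo (a t) d)
              (trans (*-cong (σ-F t) σ-d) (sym (-‿distribʳ-* (a t) d))))))))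
        atd : a t * d ≈ - (a t * d)
        atd = trans (sym (cancel (a t * d))) (trans (+-congˡ (trans (sym d²) d²′)) (cancel (- (a t * d))))
          where
          cancel : ∀ z → - a s + (a s + z) ≈ z
          cancel z = trans (sym (Fₖ.+-assoc (- a s) (a s) z))
            (trans (+-congʳ (Fₖ.-‿inverseˡ (a s))) (Fₖ.+-identityˡ z))
        t≈0 : t F.≈ F.0#
        t≈0 = a≈0⇒≈0 (x*y≈0⇒y≈0 d≉0 (trans (Fₖ.*-comm d (a t)) (x+x≈0⇒x≈0
          (trans (+-congˡ atd) (Fₖ.-‿inverseʳ (a t * d))))))

      star-e≉e : ¬ (⟦ star ⟧ e E.≈ e)
      star-e≉e eq = proj₂ star-nontrivial (trivial (proj₁ star-nontrivial))
        where
        trivial : ∀ y → ⟦ star ⟧ y E.≈ y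
        trivial y with generated-by-e y
        ... | s , t , y≈ = E.trans (star.⟦⟧-cong y≈) (E.trans (star.+-homo _ _) (E.trans
              (E.+-cong (star-F s) (E.trans (star.*-homo _ _) (E.*-cong (star-F t) eq))) (E.sym y≈)))

      -- As e² lies in F, the image of e* is a square root of d², that is d or - d. The value d is
      -- excluded: e generates E, so e* = e would make the conjugation trivial.
      gφ-star-e : gφ (⟦ star ⟧ e) ≈ - d
      gφ-star-e = trans (sym (-‿involutive s)) (Fₖ.-‿cong (x+y≈0⇒-x≈y s+d≈0))
        where
        s : Fₖ.Carrier
        s = gφ (⟦ star ⟧ e)
        s²≈d² : s * s ≈ d * d
        s²≈d² = trans (sym (gφ-* _ _)) (trans (gφ-cong (E.trans (E.sym (star.*-homo e e))
          (E.trans (star.⟦⟧-cong (proj₂ e²∈F)) (E.trans (star-F _) (E.sym (proj₂ e²∈F))))))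
          (trans (gφ-* e e) (*-cong gφ-e gφ-e)))
        s-d≉0 : ¬ (s + - d ≈ 0#)
        s-d≉0 eq = star-e≉e (gφ-injective (trans (x-y≈0⇒x≈y eq) (sym gφ-e)))
        difference-of-squares : (s + - d) * (s + d) ≈ 0#
        difference-of-squares = trans (Fₖ.distribʳ (s + d) s (- d)) (trans
          (+-cong (Fₖ.distribˡ s s d) (trans (sym (-‿distribˡ-* d (s + d))) (Fₖ.-‿cong
            (trans (Fₖ.distribˡ d s d) (trans (+-cong (Fₖ.*-comm d s) (sym s²≈d²)) (Fₖ.+-comm (s * d) (s * s)))))))
          (Fₖ.-‿inverseʳ (s * s + s * d)))
        s+d≈0 : s + d ≈ 0#
        s+d≈0 = x*y≈0⇒y≈0 s-d≉0 difference-of-squares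

      -- On Nₖ₀ the element e acts by d and its adjoint e* by - d, so d⟨v,w⟩ equals its own
      -- negative.
      Nₖ₀-isotropic : ∀ {v w} → v ∈ Nₖ₀ → w ∈ Nₖ₀ → ⟨ v , w ⟩ ≈ 0#
      Nₖ₀-isotropic {v} {w} v∈ w∈ = x*y≈0⇒y≈0 d≉0 (x+x≈0⇒x≈0 (trans (+-congˡ d≈-d) (Fₖ.-‿inverseʳ _)))
        where
        d≈-d : d * ⟨ v , w ⟩ ≈ - (d * ⟨ v , w ⟩)
        d≈-d = trans (sym (trans (⟨⟩-cong (≈ᴹ-trans (v∈ e) (*ₗ-congʳ gφ-e)) ≈ᴹ-refl) (⟨⟩-*ˡ d v w)))
          (trans (⟨⟩-act e v w) (trans (⟨⟩-cong ≈ᴹ-refl (≈ᴹ-trans (w∈ (⟦ star ⟧ e)) (*ₗ-congʳ gφ-star-e)))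
          (trans (⟨⟩-*ʳ (- d) v w) (sym (-‿distribˡ-* d _)))))

      act-e-act-e : ∀ w → act e (act e w) ≈ᴹ (d * d) *ₗ w
      act-e-act-e w = ≈ᴹ-trans (≈ᴹ-sym (act-* e e w)) (≈ᴹ-trans (act-cong (proj₂ e²∈F) ≈ᴹ-refl)
        (≈ᴹ-trans (act-F s w) (*ₗ-congʳ (trans (sym (gφ-F s)) (trans (gφ-cong (E.sym (proj₂ e²∈F)))
          (trans (gφ-* e e) (*-cong gφ-e gφ-e)))))))
        where
        s : F.Carrier
        s = proj₁ e²∈F

      -- Up to a factor, c + e is the projection onto the c-eigenspace of e. It is used for c = d
      -- and c = - d.
      eigenvector : ∀ c → c * c ≈ d * d → ∀ w → act e (c *ₗ w +ᴹ act e w) ≈ᴹ c *ₗ (c *ₗ w +ᴹ act e w)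
      eigenvector c c² w = M.begin
        act e (c *ₗ w +ᴹ act e w)          M.≈⟨ act-+ᴹ e (c *ₗ w) (act e w) ⟩
        act e (c *ₗ w) +ᴹ act e (act e w)  M.≈⟨ +ᴹ-cong (act-*ₗ e c w) (act-e-act-e w) ⟩
        c *ₗ act e w +ᴹ (d * d) *ₗ w       M.≈⟨ +ᴹ-comm _ _ ⟩
        (d * d) *ₗ w +ᴹ c *ₗ act e w       M.≈⟨ +ᴹ-congʳ (≈ᴹ-trans (*ₗ-congʳ (sym c²)) (*ₗ-assoc c c w)) ⟩
        c *ₗ (c *ₗ w) +ᴹ c *ₗ act e w      M.≈⟨ *ₗ-distribˡ c (c *ₗ w) (act e w) ⟨
        c *ₗ (c *ₗ w +ᴹ act e w)           M.∎

      eigenvector∈Nₖ₀ : ∀ {u} → act e u ≈ᴹ d *ₗ u → u ∈ Nₖ₀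
      eigenvector∈Nₖ₀ {u} eu≈du y with generated-by-e y
      ... | s , t , y≈ = M.begin
        act y u                                      M.≈⟨ act-cong y≈ ≈ᴹ-refl ⟩
        act (⟦ F→E ⟧ s E.+ ⟦ F→E ⟧ t E.* e) u        M.≈⟨ act-+ _ _ u ⟩
        act (⟦ F→E ⟧ s) u +ᴹ act (⟦ F→E ⟧ t E.* e) u M.≈⟨ +ᴹ-cong (act-F s u) (≈ᴹ-trans (act-* _ e u)
                                                          (≈ᴹ-trans (act-F t (act e u)) (*ₗ-congˡ eu≈du))) ⟩
        a s *ₗ u +ᴹ a t *ₗ (d *ₗ u)                  M.≈⟨ +ᴹ-congˡ (≈ᴹ-sym (*ₗ-assoc (a t) d u)) ⟩
        a s *ₗ u +ᴹ (a t * d) *ₗ u                   M.≈⟨ *ₗ-distribʳ u (a s) (a t * d) ⟨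
        (a s + a t * d) *ₗ u                         M.≈⟨ *ₗ-congʳ (trans (sym (gφ-a+be s t)) (gφ-cong (E.sym y≈))) ⟩
        gφ y *ₗ u                                    M.∎

      -- Semilinearity of 𝒱 together with σ d = - d turns the eigenvalue - d into d. The factor ϖ
      -- makes the vector a preimage of u under ℱ, ready for the second argument of the form.
      conjugate-eigenvector : ∀ {u} → act e u ≈ᴹ (- d) *ₗ u → (ϖ *ₗ 𝒱 u) ∈ Nₖ₀
      conjugate-eigenvector {u} eu≈ = eigenvector∈Nₖ₀ (M.begin
        act e (ϖ *ₗ 𝒱 u)     M.≈⟨ ≈ᴹ-trans (act-*ₗ e ϖ (𝒱 u)) (*ₗ-congˡ (act-𝒱 e u)) ⟩
        ϖ *ₗ 𝒱 (act e u)     M.≈⟨ *ₗ-congˡ (𝒱-cong (≈ᴹ-trans eu≈ (*ₗ-congʳ (sym σ-d)))) ⟩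
        ϖ *ₗ 𝒱 (σ d *ₗ u)    M.≈⟨ *ₗ-congˡ (𝒱-σ d u) ⟩
        ϖ *ₗ (d *ₗ 𝒱 u)      M.≈⟨ *ₗ-swap ϖ d (𝒱 u) ⟩
        d *ₗ (ϖ *ₗ 𝒱 u)      M.∎)

      ℱ-ϖ𝒱 : ∀ u → ℱ (ϖ *ₗ 𝒱 u) ≈ᴹ u
      ℱ-ϖ𝒱 u = ≈ᴹ-trans (ℱ-σ ϖ (𝒱 u)) (≈ᴹ-trans (*ₗ-cong σ-ϖ (ℱ𝒱 u)) (*ₗ-inverse ϖπ₀ u))

      -- Split w into eigenvectors of e. The d-part is orthogonal to v by isotropy; the (- d)-part
      -- is ℱ of a vector of Nₖ₀, hence orthogonal to v by hypothesis. So v is orthogonal to all of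
      -- Nₖ.
      orthogonal⇒0 : ∀ {v} → v ∈ Nₖ₀ → (∀ w → w ∈ Nₖ₀ → ⟪ v , w ⟫ ≈ 0#) → v ≈ᴹ 0ᴹ
      orthogonal⇒0 {v} v∈ v⊥ = ⟨⟩-nondegenerate v λ w →
        x*y≈0⇒y≈0 d≉0 (x±y≈0⇒y≈0 (plus w) (minus w))
        where
        expand : ∀ c w → ⟨ v , c *ₗ w +ᴹ act e w ⟩ ≈ ⟨ v , act e w ⟩ + c * ⟨ v , w ⟩
        expand c w = trans (⟨⟩-+ʳ v (c *ₗ w) (act e w)) (trans (+-congʳ (⟨⟩-*ʳ c v w)) (Fₖ.+-comm _ _))
        plus : ∀ w → ⟨ v , act e w ⟩ + d * ⟨ v , w ⟩ ≈ 0#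
        plus w = trans (sym (expand d w)) (Nₖ₀-isotropic v∈ (eigenvector∈Nₖ₀ (eigenvector d Fₖ.refl w)))
        -d*-d : - d * - d ≈ d * d
        -d*-d = trans (sym (-‿distribˡ-* d (- d))) (trans (Fₖ.-‿cong (sym (-‿distribʳ-* d d))) (-‿involutive (d * d)))
        minus : ∀ w → ⟨ v , act e w ⟩ + - (d * ⟨ v , w ⟩) ≈ 0#
        minus w = trans (+-congˡ (-‿distribˡ-* d _)) (trans (sym (expand (- d) w))
          (x*y≈0⇒y≈0 d≉0 (trans (*-congˡ (⟨⟩-cong ≈ᴹ-refl (≈ᴹ-sym (ℱ-ϖ𝒱 _))))
            (v⊥ _ (conjugate-eigenvector (eigenvector (- d) -d*-d w))))))

  abstract
    -- If v is nonzero, it is itself the vector `v₀` that the preceding argument requires.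
    ⟪⟫-nondegenerate : ∀ {v} → v ∈ Nₖ₀ → (∀ w → w ∈ Nₖ₀ → ⟪ v , w ⟫ ≈ 0#) → v ≈ᴹ 0ᴹ
    ⟪⟫-nondegenerate {v} v∈ v⊥ = decidable-stable em λ v≉0 →
      v≉0 (Nondegeneracy.orthogonal⇒0 v v∈ v≉0 v∈ v⊥)

-- Lattices in Nₖ₀ and their duals.

module LatticeProperties {p ℓ} (em : ExcludedMiddle ℓ) (p-prime : Prime p) {D : UnramifiedQuadraticExtension p ℓ}
  {𝕎 : RelativeWittVectors D} {n h : ℕ} (1≤n : 1 ≤ n)
  {K₂ : WittFractionField D 𝕎 (UnramifiedQuadraticExtension.𝔽q² D)
          (UnramifiedQuadraticExtension.𝔽q→𝔽q² D)}
  {𝕏 : FramingObject D K₂ n h} {X : AlgebraicallyClosedExtension D}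
  (𝒩 : BaseChange D K₂ 𝕏 X) where

  open UnramifiedQuadraticExtension D
  open BaseChange 𝒩
  open Scalars em 𝒩
  open Operators em 1≤n 𝒩
  open Duality em p-prime 1≤n 𝒩
  open Fₖ using (_≈_; _+_; _*_; 0#; 1#; sym; trans; *-congˡ; *-congʳ)
  open Nₖ
  open Module Nₖ.module′ using (≈ᴹ-refl; ≈ᴹ-sym; ≈ᴹ-trans; +ᴹ-cong; *ₗ-congˡ; *ₗ-congʳ; *ₗ-zeroˡ;
    *ₗ-zeroʳ; *ₗ-distribˡ; *ₗ-identityˡ; +ᴹ-identityˡ; +ᴹ-identityʳ)
  open SemiringSum (CommutativeRing.semiring Fₖ.ring′) using (sum; sum-cong-≋; sum-replicate-zero)
  open KroneckerDelta Fₖ.ring′ using () renaming (δ to kronecker; sum-δ to sum-kronecker)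
  open LinearCombinations Nₖ.module′ using (lincomb-cong; lincomb-zero; lincomb-+; *ₗ-lincomb;
    sum∈; semilinear-lincomb)
  private
    module ιₖ = HomProperties {R = Kₖ.W} {S = Fₖ.ring′} Kₖ.ι
    Wₖ = Kₖ.W.Carrier

  ιᶠ : ∀ {m} → (Fin m → Wₖ) → Fin m → Fₖ.Carrier
  ιᶠ w i = ι (w i)

  abstract
    ⟪lincomb⟫ : ∀ {m} (x : Fin m → Fₖ.Carrier) (b : Fin m → Carrierᴹ) w →
      ⟪ lincomb x b , w ⟫ ≈ sum (λ i → x i * ⟪ b i , w ⟫)
    ⟪lincomb⟫ x b w = semilinear-lincomb TensorUnit.⟨module⟩ id (λ v → ⟪ v , w ⟫) (⟪⟫-0ˡ w)
      (λ u v → ⟪⟫-+ˡ u v w) (λ x v → ⟪⟫-*ˡ x v w) x b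

    ⟪_,lincomb⟫ : ∀ v {m} (x : Fin m → Fₖ.Carrier) (b : Fin m → Carrierᴹ) →
      ⟪ v , lincomb x b ⟫ ≈ sum (λ i → σ (x i) * ⟪ v , b i ⟫)
    ⟪ v ,lincomb⟫ x b = semilinear-lincomb TensorUnit.⟨module⟩ σ (λ w → ⟪ v , w ⟫) (⟪⟫-0ʳ v)
      (⟪⟫-+ʳ v) (λ x w → ⟪⟫-*ʳ x v w) x b

    lincomb∈ : (P : Pred Carrierᴹ ℓ) → IsSubmodule P → ∀ {m} (w : Fin m → Wₖ) (b : Fin m → Carrierᴹ) →
      (∀ i → b i ∈ P) → lincomb (ιᶠ w) b ∈ P
    lincomb∈ P isSub w b b∈ = sum∈ P (IsSubmodule.zero∈ isSub) (λ u v → IsSubmodule.+-closed isSub)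
      (λ i → ι (w i) *ₗ b i) (λ i → IsSubmodule.·-closed isSub (w i) (b∈ i))

    spanOf-isSubmodule : ∀ {m} (b : Fin m → Carrierᴹ) → IsSubmodule (spanOf b)
    spanOf-isSubmodule {m} b = record
      { resp = λ { u≈v (w , eq) → w , ≈ᴹ-trans (≈ᴹ-sym u≈v) eq }
      ; zero∈ = (λ _ → Kₖ.W.0#) , ≈ᴹ-sym (lincomb-zero (λ _ → ι Kₖ.W.0#) b (λ _ → ιₖ.0#-homo))
      ; +-closed = λ { (w , eq) (w′ , eq′) → (λ i → w i Kₖ.W.+ w′ i) , ≈ᴹ-trans (+ᴹ-cong eq eq′)
          (≈ᴹ-trans (≈ᴹ-sym (lincomb-+ (ιᶠ w) (ιᶠ w′) b))
            (lincomb-cong {x = λ i → ι (w i) + ι (w′ i)} {λ i → ι (w i Kₖ.W.+ w′ i)} {b} {b}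
              (λ i → sym (ιₖ.+-homo (w i) (w′ i))) (λ _ → ≈ᴹ-refl))) }
      ; ·-closed = λ { x (w , eq) → (λ i → x Kₖ.W.* w i) , ≈ᴹ-trans (*ₗ-congˡ eq)
          (≈ᴹ-trans (*ₗ-lincomb (ι x) (ιᶠ w) b)
            (lincomb-cong {x = λ i → ι x * ι (w i)} {λ i → ι (x Kₖ.W.* w i)} {b} {b}
              (λ i → sym (ιₖ.*-homo x (w i))) (λ _ → ≈ᴹ-refl))) } }

    ∈spanOf : ∀ {m} (b : Fin m → Carrierᴹ) i → b i ∈ spanOf b
    ∈spanOf b i = (λ j → k₀ i j) , ≈ᴹ-trans (≈ᴹ-sym (lemma b i)) (lincomb-cong {x = kronecker i} {λ j → ι (k₀ i j)} {b} {b}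
        (k≈ i) (λ _ → ≈ᴹ-refl))
      where
      k₀ : ∀ {m} → Fin m → Fin m → Wₖ
      k₀ = KroneckerDelta.δ Kₖ.W
      k≈ : ∀ {m} (i j : Fin m) → kronecker i j ≈ ι (k₀ i j)
      k≈ zero zero = sym ιₖ.1#-homo
      k≈ zero (suc j) = sym ιₖ.0#-homo
      k≈ (suc i) zero = sym ιₖ.0#-homo
      k≈ (suc i) (suc j) = k≈ i j
      lemma : ∀ {m} (b : Fin m → Carrierᴹ) i → lincomb (kronecker i) b ≈ᴹ b i
      lemma b zero = ≈ᴹ-trans (+ᴹ-cong (*ₗ-identityˡ (b zero)) (lincomb-zero (λ _ → 0#) (b ∘ suc) (λ _ → Fₖ.refl)))
        (+ᴹ-identityʳ (b zero))
      lemma b (suc i) = ≈ᴹ-trans (+ᴹ-cong (*ₗ-zeroˡ (b zero)) (lemma (b ∘ suc) i)) (+ᴹ-identityˡ (b (suc i)))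

    lattice-isSubmodule : ∀ {A} → IsLatticeCₖ A → IsSubmodule A
    lattice-isSubmodule (b , _ , A⊆span , span⊆A) = record
      { resp = λ eq u∈ → span⊆A (resp eq (A⊆span u∈))
      ; zero∈ = span⊆A zero∈
      ; +-closed = λ u∈ v∈ → span⊆A (+-closed (A⊆span u∈) (A⊆span v∈))
      ; ·-closed = λ w v∈ → span⊆A (·-closed w (A⊆span v∈)) }
      where open IsSubmodule (spanOf-isSubmodule b)

    lattice⊆Nₖ₀ : ∀ {A} → IsLatticeCₖ A → A ⊆ Nₖ₀
    lattice⊆Nₖ₀ (b , isBasis , A⊆span , _) v∈ with A⊆span v∈
    ... | w , v≈ = Nₖ₀-resp (≈ᴹ-sym v≈) (sum∈ Nₖ₀ Nₖ₀-0 (λ u v → Nₖ₀-+) (λ i → ι (w i) *ₗ b i)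
                     (λ i → Nₖ₀-* (ι (w i)) (IsBasis.member isBasis i)))

    Integral-resp : ∀ {x y} → x ≈ y → Kₖ.Integral x → Kₖ.Integral y
    Integral-resp x≈y (w , eq) = w , trans (sym x≈y) eq

    Integral-σ : ∀ {x} → Kₖ.Integral x → Kₖ.Integral (σ x)
    Integral-σ x∈ = Multiple⇒Integral (Multiple-σ 1# σ.1#-homo (Integral⇒Multiple x∈))

    Integral-σ⁻ : ∀ {x} → Kₖ.Integral (σ x) → Kₖ.Integral x
    Integral-σ⁻ x∈ = Multiple⇒Integral (Multiple-σ⁻ 1# σ.1#-homo (Integral⇒Multiple x∈))

    Integral-+ : ∀ {x y} → Kₖ.Integral x → Kₖ.Integral y → Kₖ.Integral (x + y)
    Integral-+ x∈ y∈ = Multiple⇒Integral (Multiple-+ 1# (Integral⇒Multiple x∈) (Integral⇒Multiple y∈))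

    Integral-* : ∀ w {x} → Kₖ.Integral x → Kₖ.Integral (ι w * x)
    Integral-* w x∈ = Multiple⇒Integral (Multiple-* 1# w (Integral⇒Multiple x∈))

    private
      gram-injective : (b : Fin n → Carrierᴹ) → IsBasis Nₖ₀ b →
        ∀ (x : Fin n → Fₖ.Carrier) → (∀ j → sum (λ i → x i * ⟪ b i , b j ⟫) ≈ 0#) → ∀ i → x i ≈ 0#
      gram-injective b isBasis x xG≈0 = independent x (⟪⟫-nondegenerate v∈ v⊥)
        where
        open IsBasis isBasis
        v∈ : lincomb x b ∈ Nₖ₀
        v∈ = sum∈ Nₖ₀ Nₖ₀-0 (λ u v → Nₖ₀-+) (λ i → x i *ₗ b i) (λ i → Nₖ₀-* (x i) (member i))
        v⊥ : ∀ w → w ∈ Nₖ₀ → ⟪ lincomb x b , w ⟫ ≈ 0#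
        v⊥ w w∈ with spanning w w∈
        ... | y , w≈ = trans (⟪⟫-cong ≈ᴹ-refl w≈) (trans (⟪ lincomb x b ,lincomb⟫ y b)
          (trans (sum-cong-≋ (λ j → trans (*-congˡ (trans (⟪lincomb⟫ x b (b j)) (xG≈0 j))) (Fₖ.zeroʳ (σ (y j)))))
                 (sum-replicate-zero n)))

      -- Nondegeneracy makes the Gram matrix injective, hence surjective; the rows of its inverse
      -- are the coordinates of the left dual basis.
      dualBasis : (b : Fin n → Carrierᴹ) → IsBasis Nₖ₀ b →
        ∀ k → ∃ λ v → v ∈ Nₖ₀ × (∀ j → ⟪ v , b j ⟫ ≈ kronecker k j)
      dualBasis b isBasis k = fromSolution (LinearEquations.injective⇒surjective em Kₖ.𝐅
        (λ i j → ⟪ b i , b j ⟫) (gram-injective b isBasis) (kronecker k))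
        where
        fromSolution : (∃ λ (x : Fin n → Fₖ.Carrier) → ∀ j → sum (λ i → x i * ⟪ b i , b j ⟫) ≈ kronecker k j) →
          ∃ λ v → v ∈ Nₖ₀ × (∀ j → ⟪ v , b j ⟫ ≈ kronecker k j)
        fromSolution (x , xG≈δ) = lincomb x b ,
          sum∈ Nₖ₀ Nₖ₀-0 (λ u v → Nₖ₀-+) (λ i → x i *ₗ b i) (λ i → Nₖ₀-* (x i) (IsBasis.member isBasis i)) ,
          λ j → trans (⟪lincomb⟫ x b (b j)) (xG≈δ j)

    -- The right dual of Aᵛ lies in A: pair with the basis dual to a basis of A.
    ᵛ-separates : ∀ {A} → IsLatticeCₖ A → ∀ {u} → u ∈ Nₖ₀ → (∀ v → v ∈ A ᵛ → Kₖ.Integral ⟪ v , u ⟫) → u ∈ A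
    ᵛ-separates {A} (b , isBasis , A⊆span , span⊆A) {u} u∈ pairs with IsBasis.spanning isBasis u u∈
    ... | y , u≈ = span⊆A ((λ k → proj₁ (coefficient k)) , ≈ᴹ-trans u≈
          (lincomb-cong {x = y} {λ k → ι (proj₁ (coefficient k))} {b} {b} (λ k → proj₂ (coefficient k)) (λ _ → ≈ᴹ-refl)))
      where
      b* : Fin n → Carrierᴹ
      b* k = proj₁ (dualBasis b isBasis k)
      ⟪b*,lincomb⟫ : ∀ k (x : Fin n → Fₖ.Carrier) → ⟪ b* k , lincomb x b ⟫ ≈ σ (x k)
      ⟪b*,lincomb⟫ k x = trans (⟪ b* k ,lincomb⟫ x b)
        (trans (sum-cong-≋ (λ j → *-congˡ (proj₂ (proj₂ (dualBasis b isBasis k)) j)))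
               (sum-kronecker (λ j → σ (x j)) k))
      b*∈ : ∀ k → b* k ∈ A ᵛ
      b*∈ k = proj₁ (proj₂ (dualBasis b isBasis k)) , λ w w∈ → integral w (A⊆span w∈)
        where
        integral : ∀ w → w ∈ spanOf b → Kₖ.Integral ⟪ b* k , w ⟫
        integral w (z , w≈) = Integral-resp (sym (trans (⟪⟫-cong ≈ᴹ-refl w≈) (⟪b*,lincomb⟫ k (ιᶠ z))))
          (Integral-σ (z k , Fₖ.refl))
      coefficient : ∀ k → Kₖ.Integral (y k)
      coefficient k = Integral-σ⁻ (Integral-resp (trans (⟪⟫-cong ≈ᴹ-refl u≈) (⟪b*,lincomb⟫ k y))
        (pairs (b* k) (b*∈ k)))

    ᵛ-isSubmodule : ∀ A → IsSubmodule (A ᵛ)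
    ᵛ-isSubmodule A = record
      { resp = λ { eq (u∈ , u⊥) → Nₖ₀-resp eq u∈ , λ w w∈ → Integral-resp (⟪⟫-cong eq ≈ᴹ-refl) (u⊥ w w∈) }
      ; zero∈ = Nₖ₀-0 , λ w w∈ → Integral-resp (sym (⟪⟫-0ˡ w)) (Multiple⇒Integral (Multiple-0 1#))
      ; +-closed = λ { {u} {v} (u∈ , u⊥) (v∈ , v⊥) → Nₖ₀-+ u∈ v∈ , λ w w∈ →
          Integral-resp (sym (⟪⟫-+ˡ u v w)) (Integral-+ (u⊥ w w∈) (v⊥ w w∈)) }
      ; ·-closed = λ { x {v} (v∈ , v⊥) → Nₖ₀-* (ι x) v∈ , λ w w∈ →
          Integral-resp (sym (⟪⟫-*ˡ (ι x) v w)) (Integral-* x (v⊥ w w∈)) } }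

    image-isSubmodule : ∀ {P : Pred Carrierᴹ ℓ} c → IsSubmodule P → IsSubmodule (image (c *ₗ_) P)
    image-isSubmodule c isSub = record
      { resp = λ { eq (u , u∈ , v≈) → u , u∈ , ≈ᴹ-trans (≈ᴹ-sym eq) v≈ }
      ; zero∈ = 0ᴹ , zero∈ , ≈ᴹ-sym (*ₗ-zeroʳ c)
      ; +-closed = λ { (u , u∈ , eq) (v , v∈ , eq′) → u +ᴹ v , +-closed u∈ v∈ ,
          ≈ᴹ-trans (+ᴹ-cong eq eq′) (≈ᴹ-sym (*ₗ-distribˡ c u v)) }
      ; ·-closed = λ { x (u , u∈ , eq) → ι x *ₗ u , ·-closed x u∈ ,
          ≈ᴹ-trans (*ₗ-congˡ eq) (*ₗ-swap (ι x) c u) } }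
      where open IsSubmodule isSub

    π₀-integral : ∃ λ w → π₀ ≈ ι w
    π₀-integral = _ , Kₖ.F→𝐅-compatible π

    π₀-closed : ∀ {P : Pred Carrierᴹ ℓ} → IsSubmodule P → ∀ {v} → v ∈ P → (π₀ *ₗ v) ∈ P
    π₀-closed isSub v∈ = IsSubmodule.resp isSub (*ₗ-congʳ (sym (proj₂ π₀-integral)))
      (IsSubmodule.·-closed isSub (proj₁ π₀-integral) v∈)

    ᵛ-antitone : ∀ {P Q} → P ⊆ Q → Q ᵛ ⊆ P ᵛ
    ᵛ-antitone P⊆Q (v∈ , v⊥) = v∈ , λ w w∈ → v⊥ w (P⊆Q w∈)

    -- Dualizing πAᵛ ⊆ B gives πBᵛ ⊆ (Aᵛ)ᵛ = τ(A).
    θ-πᵛ : ∀ {A B} → IsLatticeCₖ A → (π· (A ᵛ)) ⊆ B → ∀ {v} → v ∈ (π· (B ᵛ)) → θ v ∈ A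
    θ-πᵛ {A} {B} A-lattice πAᵛ⊆B {v} (u , (u∈ , u⊥) , v≈) =
      ᵛ-separates A-lattice (Nₖ₀-θ (Nₖ₀-resp (≈ᴹ-sym v≈) (Nₖ₀-* π₀ u∈))) λ a a∈ →
        Integral-σ⁻ (Integral-resp (sym (eq a)) (u⊥ (π₀ *ₗ a) (πAᵛ⊆B (a , a∈ , ≈ᴹ-refl))))
      where
      eq : ∀ a → σ ⟪ a , θ v ⟫ ≈ ⟪ u , π₀ *ₗ a ⟫
      eq a = trans (σ-⟪⟫ a (θ v)) (trans (⟪⟫-cong (≈ᴹ-trans (τθ v) v≈) ≈ᴹ-refl)
        (trans (⟪⟫-*ˡ π₀ u a) (sym (trans (⟪⟫-*ʳ π₀ u a) (*-congʳ σ-π₀)))))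

    -- The direct half of double duality. It yields πτ(A_m) ⊆ πB_mᵛ ⊆ A_m, the bound on the growth
    -- of A_m under τ.
    τ-ᵛ : ∀ {A B} → A ⊆ Nₖ₀ → B ⊆ A ᵛ → ∀ {a} → a ∈ A → τ a ∈ B ᵛ
    τ-ᵛ A⊆Nₖ₀ B⊆Aᵛ {a} a∈ = Nₖ₀-τ (A⊆Nₖ₀ a∈) , λ b b∈ →
      Integral-resp (σ-⟪⟫ b a) (Integral-σ (proj₂ (B⊆Aᵛ b∈) a a∈))

-- τ-closures, and the passage of orthogonality to them.

module τClosureProperties {p ℓ} (em : ExcludedMiddle ℓ) (p-prime : Prime p) {D : UnramifiedQuadraticExtension p ℓ}
  {𝕎 : RelativeWittVectors D} {n h : ℕ} (1≤n : 1 ≤ n)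
  {K₂ : WittFractionField D 𝕎 (UnramifiedQuadraticExtension.𝔽q² D)
          (UnramifiedQuadraticExtension.𝔽q→𝔽q² D)}
  {𝕏 : FramingObject D K₂ n h} {X : AlgebraicallyClosedExtension D}
  (𝒩 : BaseChange D K₂ 𝕏 X) where

  open AlgebraicallyClosedExtension X
  open BaseChange 𝒩
  open Scalars em 𝒩
  open Operators em 1≤n 𝒩
  open Duality em p-prime 1≤n 𝒩
  open LatticeProperties em p-prime 1≤n 𝒩
  open Fₖ using (_≈_; _*_; 0#; 1#; sym; trans; *-congˡ; *-congʳ)
  open Nₖ
  open Module Nₖ.module′ using (≈ᴹ-refl; ≈ᴹ-sym; ≈ᴹ-trans; +ᴹ-cong; +ᴹ-congˡ; *ₗ-cong; *ₗ-congˡ;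
    *ₗ-congʳ; *ₗ-distribˡ; *ₗ-identityˡ; +ᴹ-identityˡ; +ᴹ-identityʳ)
  open VectorSpaces em Kₖ.𝐅 Nₖ.module′
  open LinearCombinations Nₖ.module′ using (lincomb-cong; sum∈; semilinear-lincomb;
    independent-unique)
  private
    module ιₖ = HomProperties {R = Kₖ.W} {S = Fₖ.ring′} Kₖ.ι
    Wₖ = Kₖ.W.Carrier
    W₂ = K₂.W.Carrier

  infix 9 θ^_
  θ^_ : ℕ → Carrierᴹ → Carrierᴹ
  (θ^ zero)  v = v
  (θ^ suc j) v = θ ((θ^ j) v)

  -- Defined by iteration so that the zeroth power reduces to the identity; the edges of the chain
  -- with exponent 0 then are plain inclusions.
  π^ᴹ : ℕ → Carrierᴹ → Carrierᴹ
  π^ᴹ zero    v = v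
  π^ᴹ (suc j) v = π₀ *ₗ π^ᴹ j v

  abstract
    τ^-shift : ∀ j v → (τ^ j) (τ v) ≡ τ ((τ^ j) v)
    τ^-shift zero    v = refl
    τ^-shift (suc j) v = ≡.cong τ (τ^-shift j v)

    T⊆T-suc : ∀ {A} → IsSubmodule A → ∀ s → T s A ⊆ T (suc s) A
    T⊆T-suc isSub s {v} v∈ = v , (τ^ s) 0ᴹ , v∈ , (0ᴹ , IsSubmodule.zero∈ isSub , ≈ᴹ-refl) ,
      ≈ᴹ-sym (≈ᴹ-trans (+ᴹ-congˡ (τ^-0 s)) (+ᴹ-identityʳ v))
      where
      τ^-0 : ∀ s → (τ^ s) 0ᴹ ≈ᴹ 0ᴹ
      τ^-0 zero = ≈ᴹ-refl
      τ^-0 (suc s) = ≈ᴹ-trans (τ-cong (τ^-0 s)) τ-0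

    ⊆T : ∀ {A} → IsSubmodule A → ∀ s → A ⊆ T (suc s) A
    ⊆T isSub zero {v} v∈ = 0ᴹ , v , ≈ᴹ-refl , (v , v∈ , ≈ᴹ-refl) , ≈ᴹ-sym (+ᴹ-identityˡ v)
    ⊆T isSub (suc s) v∈ = T⊆T-suc isSub (suc s) (⊆T isSub s v∈)

    T-induction : ∀ {A} (Q : Pred Carrierᴹ ℓ) → (∀ {u v} → u ≈ᴹ v → u ∈ Q → v ∈ Q) → 0ᴹ ∈ Q →
      (∀ {u v} → u ∈ Q → v ∈ Q → (u +ᴹ v) ∈ Q) → (∀ j {a} → a ∈ A → (τ^ j) a ∈ Q) →
      ∀ s → T s A ⊆ Q
    T-induction Q resp Q0 Q+ Qτ zero v≈0 = resp (≈ᴹ-sym v≈0) Q0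
    T-induction Q resp Q0 Q+ Qτ (suc s) (u , w , u∈ , (a , a∈ , w≈) , v≈) = resp (≈ᴹ-sym v≈)
      (Q+ (T-induction Q resp Q0 Q+ Qτ s u∈) (resp (≈ᴹ-sym w≈) (Qτ s a∈)))

    π^ᴹ-cong : ∀ j {u v} → u ≈ᴹ v → π^ᴹ j u ≈ᴹ π^ᴹ j v
    π^ᴹ-cong zero    eq = eq
    π^ᴹ-cong (suc j) eq = *ₗ-congˡ (π^ᴹ-cong j eq)

    π^ᴹ-+ : ∀ j u v → π^ᴹ j (u +ᴹ v) ≈ᴹ π^ᴹ j u +ᴹ π^ᴹ j v
    π^ᴹ-+ zero    u v = ≈ᴹ-refl
    π^ᴹ-+ (suc j) u v = ≈ᴹ-trans (*ₗ-congˡ (π^ᴹ-+ j u v)) (*ₗ-distribˡ π₀ _ _)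

    τ-π^ᴹ : ∀ j v → τ (π^ᴹ j v) ≈ᴹ π^ᴹ j (τ v)
    τ-π^ᴹ zero    v = ≈ᴹ-refl
    τ-π^ᴹ (suc j) v = ≈ᴹ-trans (τ-fixed σ-π₀ (π^ᴹ j v)) (*ₗ-congˡ (τ-π^ᴹ j v))

    θ-π^ᴹ : ∀ j v → θ (π^ᴹ j v) ≈ᴹ π^ᴹ j (θ v)
    θ-π^ᴹ zero    v = ≈ᴹ-refl
    θ-π^ᴹ (suc j) v = ≈ᴹ-trans (θ-fixed σ-π₀ (π^ᴹ j v)) (*ₗ-congˡ (θ-π^ᴹ j v))

    -- Each application of τ costs one factor π, and the summands of `T s A` involve fewer than s of
    -- them.
    π^ᴹ-T⊆ : ∀ {A} → IsSubmodule A → (∀ {a} → a ∈ A → (π₀ *ₗ τ a) ∈ A) →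
      ∀ s {v} → v ∈ T s A → π^ᴹ s v ∈ A
    π^ᴹ-T⊆ {A} isSub πτA⊆A zero v≈0 = IsSubmodule.resp isSub (≈ᴹ-sym v≈0) (IsSubmodule.zero∈ isSub)
    π^ᴹ-T⊆ {A} isSub πτA⊆A (suc s) {v} (u , w , u∈ , (a , a∈ , w≈) , v≈) =
      IsSubmodule.resp isSub (≈ᴹ-sym (≈ᴹ-trans (π^ᴹ-cong (suc s) v≈) (π^ᴹ-+ (suc s) u w)))
        (IsSubmodule.+-closed isSub (π₀-closed isSub (π^ᴹ-T⊆ isSub πτA⊆A s u∈))
          (π₀-closed isSub (IsSubmodule.resp isSub (≈ᴹ-sym (π^ᴹ-cong s w≈)) (π^ᴹ-τ^ s))))
      where
      π^ᴹ-τ^ : ∀ s → π^ᴹ s ((τ^ s) a) ∈ A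
      π^ᴹ-τ^ zero = a∈
      π^ᴹ-τ^ (suc s) = IsSubmodule.resp isSub (*ₗ-congˡ (τ-π^ᴹ s _)) (πτA⊆A (π^ᴹ-τ^ s))

    Λ⊆C : ∀ {Λ} → IsLatticeC Λ → Λ ⊆ C
    Λ⊆C {Λ} (b , isBasis , Λ⊆span , _) v∈ with Λ⊆span v∈
    ... | w , v≈ = Nₖ₀-resp (≈ᴹ-sym v≈) (proj₁ sum∈C) ,
        ≈ᴹ-trans (τ-cong v≈) (≈ᴹ-trans (proj₂ sum∈C) (≈ᴹ-sym v≈))
      where
      b∈C : ∀ i → b i ∈ C
      b∈C = LinearAlgebra.IsBasis.member isBasis
      sum∈C : lincomb (λ i → g (⟦ K₂.ι ⟧ (w i))) b ∈ C
      sum∈C = sum∈ C (Nₖ₀-0 , τ-0) (λ { u v (u∈ , τu) (v∈ , τv) → Nₖ₀-+ u∈ v∈ , ≈ᴹ-trans (τ-+ u v) (+ᴹ-cong τu τv) })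
        (λ i → g (⟦ K₂.ι ⟧ (w i)) *ₗ b i)
        (λ i → Nₖ₀-* _ (proj₁ (b∈C i)) , ≈ᴹ-trans (τ-* _ (b i)) (*ₗ-cong (σ²-g _) (proj₂ (b∈C i))))

    ⊆Generated : ∀ {Λ : Pred Carrierᴹ ℓ} → Λ ⊆ Generated Λ
    ⊆Generated {Λ} {v} v∈ = 1 , (λ _ → v) , (λ _ → v∈) , (λ _ → Kₖ.W.1#) ,
      ≈ᴹ-sym (≈ᴹ-trans (+ᴹ-identityʳ _) (≈ᴹ-trans (*ₗ-congʳ ιₖ.1#-homo) (*ₗ-identityˡ v)))

    -- τ fixes the vectors of Λ, so θ changes only the coefficients, by the inverse of σ², which
    -- preserves W(k).
    Generated-θ : ∀ {Λ} → Λ ⊆ C → ∀ {v} → v ∈ Generated Λ → θ v ∈ Generated Λ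
    Generated-θ {Λ} Λ⊆C {v} (m , b , b∈ , w , v≈) = m , b , b∈ , w′ ,
      ≈ᴹ-trans (θ-cong (≈ᴹ-sym τu≈v)) (θτ u)
      where
      w′ : Fin m → Wₖ
      w′ i = proj₁ (σ²-ι-surjective (w i))
      u : Carrierᴹ
      u = lincomb (ιᶠ w′) b
      τu≈v : τ u ≈ᴹ v
      τu≈v = ≈ᴹ-trans (semilinear-lincomb Nₖ.module′ σ² τ τ-0 τ-+ τ-* (ιᶠ w′) b)
        (≈ᴹ-trans (lincomb-cong {x = λ i → σ² (ι (w′ i))} {ιᶠ w} {λ i → τ (b i)} {b}
          (λ i → proj₂ (σ²-ι-surjective (w i))) (λ i → proj₂ (Λ⊆C (b∈ i)))) (≈ᴹ-sym v≈))

  module _ {A Λ : Pred Carrierᴹ ℓ} (A-lattice : IsLatticeCₖ A) (closure : IsτClosure Λ A) where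
    private
      A-sub = lattice-isSubmodule A-lattice
      Λ-lattice = proj₁ closure
      s₀ : ℕ
      s₀ = proj₁ (proj₂ closure)
      Λ∈C : Λ ⊆ C
      Λ∈C = Λ⊆C Λ-lattice
      b : Fin n → Carrierᴹ
      b = proj₁ Λ-lattice

    -- One more than the given `s₀`: `T zero A` is 0, whereas `T (suc s) A` contains A.
    exponent : ℕ
    exponent = suc s₀

    abstract
      Generated⊆T : Generated Λ ⊆ T exponent A
      Generated⊆T = proj₁ (proj₂ (proj₂ closure) (suc s₀) (ℕₚ.n≤1+n s₀))

      T⊆Generated : T exponent A ⊆ Generated Λ
      T⊆Generated = proj₂ (proj₂ (proj₂ closure) (suc s₀) (ℕₚ.n≤1+n s₀))

      A⊆Generated : A ⊆ Generated Λ
      A⊆Generated v∈ = T⊆Generated (⊆T A-sub s₀ v∈)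

      Λ⊆T : Λ ⊆ T exponent A
      Λ⊆T v∈ = Generated⊆T (⊆Generated v∈)

      -- All translates of A lie in one lattice, whatever j is; this makes the final bound on the
      -- power of π uniform in j.
      θ^-A⊆Generated : ∀ j {v} → v ∈ A → (θ^ j) v ∈ Generated Λ
      θ^-A⊆Generated zero    v∈ = A⊆Generated v∈
      θ^-A⊆Generated (suc j) v∈ = Generated-θ Λ∈C (θ^-A⊆Generated j v∈)

      Generated⊆span : Generated Λ ⊆ spanOf b
      Generated⊆span (m , c , c∈ , w , v≈) = IsSubmodule.resp (spanOf-isSubmodule b) (≈ᴹ-sym v≈)
        (lincomb∈ (spanOf b) (spanOf-isSubmodule b) w c (λ i → Λ⊆span (c∈ i)))
        where
        Λ⊆span : Λ ⊆ spanOf b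
        Λ⊆span v∈ with proj₁ (proj₂ (proj₂ Λ-lattice)) v∈
        ... | r , eq = (λ i → ⟦ 𝔽q²→k ⟧ ∘ r i) , ≈ᴹ-trans eq
          (lincomb-cong {x = λ i → g (⟦ K₂.ι ⟧ (r i))} {λ i → ι (⟦ 𝔽q²→k ⟧ ∘ r i)} {b} {b}
            (λ i → F₂→Fₖ-functorial (r i)) (λ _ → ≈ᴹ-refl))

      -- b has n elements and spans A, hence Nₖ₀, over Fₖ.
      Λ-basis-independent : ∀ (x : Fin n → Fₖ.Carrier) → lincomb x b ≈ᴹ 0ᴹ → ∀ i → x i ≈ 0#
      Λ-basis-independent = LinearEquations.spanning⇒independent em Kₖ.𝐅 Nₖ.module′ (proj₁ A-lattice) b
        (IsBasis.independent (proj₁ (proj₂ A-lattice))) (λ i → ιᶠ (proj₁ (a∈span i))) (λ i → proj₂ (a∈span i))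
        where
        a∈span : ∀ i → proj₁ A-lattice i ∈ spanOf b
        a∈span i = Generated⊆span (A⊆Generated (proj₂ (proj₂ (proj₂ A-lattice)) (∈spanOf (proj₁ A-lattice) i)))

      -- Compare the coordinates of v and τ v in the τ-fixed basis of Λ: independence over `Kₖ.𝐅`
      -- makes them σ²-fixed, so they descend to W(𝔽q²).
      C∩Generated⊆Λ : ∀ {v} → v ∈ C → v ∈ Generated Λ → v ∈ Λ
      C∩Generated⊆Λ {v} (v∈Nₖ₀ , τv≈v) v∈ = fromSpan (Generated⊆span v∈)
        where
        fromSpan : v ∈ spanOf b → v ∈ Λ
        fromSpan (w , v≈) = proj₂ (proj₂ (proj₂ Λ-lattice)) ((λ i → proj₁ (descent i)) ,
          ≈ᴹ-trans v≈ (lincomb-cong {x = ιᶠ w} {λ i → g (⟦ K₂.ι ⟧ (proj₁ (descent i)))} {b} {b}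
            (λ i → proj₂ (descent i)) (λ _ → ≈ᴹ-refl)))
          where
          σ²w : lincomb (λ i → σ² (ι (w i))) b ≈ᴹ lincomb (ιᶠ w) b
          σ²w = ≈ᴹ-trans (lincomb-cong {x = λ i → σ² (ι (w i))} {λ i → σ² (ι (w i))} {b} {λ i → τ (b i)}
                  (λ _ → Fₖ.refl) (λ i → ≈ᴹ-sym (proj₂ (LinearAlgebra.IsBasis.member (proj₁ (proj₂ Λ-lattice)) i))))
            (≈ᴹ-trans (≈ᴹ-sym (semilinear-lincomb Nₖ.module′ σ² τ τ-0 τ-+ τ-* (ιᶠ w) b))
            (≈ᴹ-trans (τ-cong (≈ᴹ-sym v≈)) (≈ᴹ-trans τv≈v v≈)))
          descent : ∀ i → ∃ λ (r : W₂) → ι (w i) ≈ g (⟦ K₂.ι ⟧ r)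
          descent i = σ²-fixed-integral
            (independent-unique b Λ-basis-independent (λ i → σ² (ι (w i))) (ιᶠ w) σ²w i) (w i , Fₖ.refl)

      Λᵛᶜ⊆Aᵛ : Λ ᵛᶜ ⊆ A ᵛ
      Λᵛᶜ⊆Aᵛ {v} (v∈C , v⊥) = proj₁ v∈C , λ w w∈ → integral (A⊆Generated w∈)
        where
        pairing-integral : IsSubmodule (λ w → Kₖ.Integral ⟪ v , w ⟫)
        pairing-integral = record
          { resp = λ eq → Integral-resp (⟪⟫-cong ≈ᴹ-refl eq)
          ; zero∈ = Integral-resp (sym (⟪⟫-0ʳ v)) (Multiple⇒Integral (Multiple-0 1#))
          ; +-closed = λ {u} {w} u∈ w∈ → Integral-resp (sym (⟪⟫-+ʳ v u w)) (Integral-+ u∈ w∈)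
          ; ·-closed = λ x {w} w∈ → Integral-resp (sym (trans (⟪⟫-*ʳ (ι x) v w) (*-congʳ (ι-frob x))))
              (Integral-* (Kₖ.frobʷ x) w∈) }
        integral : ∀ {w} → w ∈ Generated Λ → Kₖ.Integral ⟪ v , w ⟫
        integral (m , c , c∈ , w , eq) = IsSubmodule.resp pairing-integral (≈ᴹ-sym eq)
          (lincomb∈ (λ w → Kₖ.Integral ⟪ v , w ⟫) pairing-integral w c
            (λ i → descends (v⊥ (c i) (c∈ i))))
          where
          descends : ∀ {x} → (∃ λ (r : W₂) → x ≈ g (⟦ K₂.ι ⟧ r)) → Kₖ.Integral x
          descends (r , eq) = (⟦ 𝔽q²→k ⟧ ∘ r) , trans eq (F₂→Fₖ-functorial r)

  module _ {P Q ΛP ΛQ : Pred Carrierᴹ ℓ} (P-lattice : IsLatticeCₖ P) (Q-lattice : IsLatticeCₖ Q)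
    (P-closure : IsτClosure ΛP P) (Q-closure : IsτClosure ΛQ Q) (c : Fₖ.Carrier) (σc≈c : σ c ≈ c)
    (orthogonal : ∀ j {u v} → u ∈ P → v ∈ Q → Multiple c ⟪ (θ^ j) u , v ⟫) where

    abstract
      private
        ΛQ⊆C : ΛQ ⊆ C
        ΛQ⊆C = Λ⊆C (proj₁ Q-closure)

        Multiple-σ² : ∀ {x} → Multiple c x → Multiple c (σ² x)
        Multiple-σ² x∈ = Multiple-σ c σc≈c (Multiple-σ c σc≈c x∈)

        -- σ² carries ⟪θ u, v⟫ to ⟪u, τ v⟫, and it preserves the multiples of c because σ fixes c.
        move-θ^ : ∀ j u v → Multiple c ⟪ (θ^ j) u , v ⟫ → Multiple c ⟪ u , (τ^ j) v ⟫
        move-θ^ zero    u v x∈ = x∈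
        move-θ^ (suc j) u v x∈ = ≡.subst (λ w → Multiple c ⟪ u , w ⟫) (τ^-shift j v) (move-θ^ j u (τ v)
          (Multiple-resp c (trans (sym (⟪⟫-ττ (θ ((θ^ j) u)) v)) (⟪⟫-cong (τθ ((θ^ j) u)) ≈ᴹ-refl)) (Multiple-σ² x∈)))

        P-ΛQ : ∀ {u v} → u ∈ P → v ∈ ΛQ → Multiple c ⟪ u , v ⟫
        P-ΛQ {u} u∈ v∈ = T-induction (λ v → Multiple c ⟪ u , v ⟫)
          (λ eq → Multiple-resp c (⟪⟫-cong ≈ᴹ-refl eq)) (Multiple-resp c (sym (⟪⟫-0ʳ u)) (Multiple-0 c))
          (λ {v} {w} v∈ w∈ → Multiple-resp c (sym (⟪⟫-+ʳ u v w)) (Multiple-+ c v∈ w∈))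
          (λ j v∈ → move-θ^ j u _ (orthogonal j u∈ v∈))
          (exponent Q-lattice Q-closure) (Λ⊆T Q-lattice Q-closure v∈)

        τ^P-ΛQ : ∀ j {u v} → u ∈ P → v ∈ ΛQ → Multiple c ⟪ (τ^ j) u , v ⟫
        τ^P-ΛQ zero    u∈ v∈ = P-ΛQ u∈ v∈
        τ^P-ΛQ (suc j) {u} {v} u∈ v∈ = Multiple-resp c
          (trans (sym (⟪⟫-ττ ((τ^ j) u) v)) (⟪⟫-cong ≈ᴹ-refl (proj₂ (ΛQ⊆C v∈)))) (Multiple-σ² (τ^P-ΛQ j u∈ v∈))

      -- The closures are enlarged one at a time. Translates τ^j(Q) are reached from θ^j(P) by
      -- `move-θ^`; once the right argument is in ΛQ it is τ-fixed, so translating the left one by τ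
      -- only applies σ² to the value.
      ΛP-ΛQ : ∀ {u v} → u ∈ ΛP → v ∈ ΛQ → Multiple c ⟪ u , v ⟫
      ΛP-ΛQ {u} {v} u∈ v∈ = T-induction (λ u → Multiple c ⟪ u , v ⟫)
        (λ eq → Multiple-resp c (⟪⟫-cong eq ≈ᴹ-refl)) (Multiple-resp c (sym (⟪⟫-0ˡ v)) (Multiple-0 c))
        (λ {u} {w} u∈ w∈ → Multiple-resp c (sym (⟪⟫-+ˡ u w v)) (Multiple-+ c u∈ w∈))
        (λ j u∈ → τ^P-ΛQ j u∈ v∈)
        (exponent P-lattice P-closure) (Λ⊆T P-lattice P-closure u∈)

      ΛQ-ΛP : ∀ {u v} → u ∈ ΛQ → v ∈ ΛP → Multiple c ⟪ u , v ⟫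
      ΛQ-ΛP {u} {v} u∈ v∈ = Multiple-resp c
        (trans (σ-⟪⟫ v u) (⟪⟫-cong (proj₂ (ΛQ⊆C u∈)) ≈ᴹ-refl)) (Multiple-σ c σc≈c (ΛP-ΛQ v∈ u∈))

  abstract
    -- The dual inside C demands values in W(𝔽q²), not merely in W(k). Between vectors of C the form
    -- takes σ²-fixed values, so integrality over k descends.
    Λ⊆c·Λ′ᵛᶜ : ∀ {Λ Λ′} → IsLatticeC Λ → IsLatticeC Λ′ → ∀ c → ¬ (c ≈ 0#) → σ c ≈ c →
      (∀ {u v} → u ∈ Λ → v ∈ Λ′ → Multiple c ⟪ u , v ⟫) → Λ ⊆ image (c *ₗ_) (Λ′ ᵛᶜ)
    Λ⊆c·Λ′ᵛᶜ {Λ} {Λ′} Λ-lattice Λ′-lattice c c≉0 σc≈c pairs {v} v∈ =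
      c⁻¹ *ₗ v , (u∈C , λ w w∈ → σ²-fixed-integral (fixed w∈) (integral w∈)) , ≈ᴹ-sym (*ₗ-inverse cc⁻¹ v)
      where
      c⁻¹ : Fₖ.Carrier
      c⁻¹ = proj₁ (Fₖ.inverse c c≉0)
      cc⁻¹ : c * c⁻¹ ≈ 1#
      cc⁻¹ = proj₂ (Fₖ.inverse c c≉0)
      u∈C : (c⁻¹ *ₗ v) ∈ C
      u∈C = Nₖ₀-* c⁻¹ (proj₁ (Λ⊆C Λ-lattice v∈)) ,
        ≈ᴹ-trans (τ-fixed (σ-inverse cc⁻¹ σc≈c) v) (*ₗ-congˡ (proj₂ (Λ⊆C Λ-lattice v∈)))
      integral : ∀ {w} → w ∈ Λ′ → Kₖ.Integral ⟪ c⁻¹ *ₗ v , w ⟫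
      integral {w} w∈ with pairs v∈ w∈
      ... | x , eq = x , trans (⟪⟫-*ˡ c⁻¹ v w) (trans (*-congˡ eq) (trans (sym (Fₖ.*-assoc c⁻¹ c (ι x)))
        (trans (*-congʳ (trans (Fₖ.*-comm c⁻¹ c) cc⁻¹)) (Fₖ.*-identityˡ (ι x)))))
      fixed : ∀ {w} → w ∈ Λ′ → σ² ⟪ c⁻¹ *ₗ v , w ⟫ ≈ ⟪ c⁻¹ *ₗ v , w ⟫
      fixed w∈ = trans (sym (⟪⟫-ττ _ _)) (⟪⟫-cong (proj₂ u∈C) (proj₂ (Λ⊆C Λ′-lattice w∈)))

-- The periodic chain of lattices of a point.

module Chain {p ℓ} (em : ExcludedMiddle ℓ) (p-prime : Prime p) {D : UnramifiedQuadraticExtension p ℓ}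
  {𝕎 : RelativeWittVectors D} {n m′ : ℕ} (1≤n : 1 ≤ n) (𝐡 : LevelStructure n m′)
  {K₂ : WittFractionField D 𝕎 (UnramifiedQuadraticExtension.𝔽q² D)
          (UnramifiedQuadraticExtension.𝔽q→𝔽q² D)}
  {𝕏 : FramingObject D K₂ n (LevelStructure.h 𝐡 zero)} {X : AlgebraicallyClosedExtension D}
  (𝒩 : BaseChange D K₂ 𝕏 X) (P : Point 𝐡 𝒩) (Λ : τClosures 𝐡 𝒩 P) where

  open BaseChange 𝒩
  open Scalars em 𝒩
  open Operators em 1≤n 𝒩
  open Duality em p-prime 1≤n 𝒩
  open LatticeProperties em p-prime 1≤n 𝒩
  open τClosureProperties em p-prime 1≤n 𝒩
  open Fₖ using (_≈_; 1#; sym; trans; *-congʳ; *-cong)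
  open Nₖ
  open Module Nₖ.module′ using (≈ᴹ-refl; ≈ᴹ-sym; ≈ᴹ-trans; +ᴹ-cong; +ᴹ-congˡ; *ₗ-congˡ; *ₗ-congʳ;
    *ₗ-zeroʳ; *ₗ-distribˡ; *ₗ-assoc; +ᴹ-identityˡ; +ᴹ-identityʳ; +ᴹ-assoc; ≈ᴹ-reflexive;
    +ᴹ-commutativeMonoid)
  open VectorSpaces em Kₖ.𝐅 Nₖ.module′
  open CommutativeSemigroupProperties
    (CommutativeMonoid.commutativeSemigroup +ᴹ-commutativeMonoid) using (interchange)
  private
    Wₖ = Kₖ.W.Carrier
  open Point P
  open τClosures Λ

  data State : Set where
    𝐀 𝐁 : Fin (suc m′) → State

  infix 4 _⟶[_]_
  -- For s ⟶[ e ] s′ the lattice π^e L s′ follows L s in the periodic chain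
  -- … ⊇ A₁ ⊇ … ⊇ Aₘ ⊇ πBₘ ⊇ … ⊇ πB₁ ⊇ πA₁ ⊇ ….
  data _⟶[_]_ : State → ℕ → State → Set where
    A-step   : ∀ i → 𝐀 (inject₁ i) ⟶[ 0 ] 𝐀 (suc i)
    A-top    : 𝐀 (fromℕ m′) ⟶[ 1 ] 𝐁 (fromℕ m′)
    B-step   : ∀ i → 𝐁 (suc i) ⟶[ 0 ] 𝐁 (inject₁ i)
    B-bottom : 𝐁 zero ⟶[ 0 ] 𝐀 zero

  L Y : State → Pred Carrierᴹ ℓ
  L (𝐀 i) = A i
  L (𝐁 i) = B i
  Y (𝐀 i) = π· (B i ᵛ)
  Y (𝐁 i) = π· (A i ᵛ)

  open _⋖_

  abstract
    length-1 : ∀ {R Q : Pred Carrierᴹ ℓ} → R ⊂[ 1 ] Q → R ⋖ Q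
    length-1 {R} {Q} (step {X = X} (done (R⊆X , X⊆R)) _ X⋖Q) = record
      { included = λ v∈ → included X⋖Q (R⊆X v∈)
      ; proper = λ Q⊆R → proper X⋖Q (λ v∈ → R⊆X (Q⊆R v∈))
      ; simple = λ Z Z-sub R⊆Z Z⊆Q → shift Z (simple X⋖Q Z Z-sub (λ v∈ → R⊆Z (X⊆R v∈)) Z⊆Q) }
      where
      shift : ∀ (Z : Pred Carrierᴹ ℓ) → Z ⊆ X ⊎ Q ⊆ Z → Z ⊆ R ⊎ Q ⊆ Z
      shift Z (inj₁ Z⊆X) = inj₁ λ v∈ → X⊆R (Z⊆X v∈)
      shift Z (inj₂ Q⊆Z) = inj₂ Q⊆Z

    Y⋖L : ∀ s → Y s ⋖ L s
    Y⋖L (𝐀 i) = length-1 (πBᵛ⊂A i)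
    Y⋖L (𝐁 i) = length-1 (πAᵛ⊂B i)

    L-isSubmodule : ∀ s → IsSubmodule (L s)
    L-isSubmodule (𝐀 i) = lattice-isSubmodule (A-lattice i)
    L-isSubmodule (𝐁 i) = lattice-isSubmodule (B-lattice i)

    Y-isSubmodule : ∀ s → IsSubmodule (Y s)
    Y-isSubmodule (𝐀 i) = image-isSubmodule π₀ (ᵛ-isSubmodule (B i))
    Y-isSubmodule (𝐁 i) = image-isSubmodule π₀ (ᵛ-isSubmodule (A i))

    θ-Y : ∀ s {v} → v ∈ Y s → θ v ∈ L s
    θ-Y (𝐀 i) = θ-πᵛ (A-lattice i) (included (Y⋖L (𝐁 i)))
    θ-Y (𝐁 i) = θ-πᵛ (B-lattice i) (included (Y⋖L (𝐀 i)))

    L-step : ∀ {s e s′} → s ⟶[ e ] s′ → ∀ {v} → v ∈ L s′ → π^ᴹ e v ∈ L s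
    L-step (A-step i) v∈ = A-chain i v∈
    L-step A-top {v} v∈ = πB⊆A (fromℕ m′) (v , v∈ , ≈ᴹ-refl)
    L-step (B-step i) v∈ = B-chain i v∈
    L-step B-bottom v∈ = A⊆B v∈

    πᵛ-antitone : ∀ (R Q : Pred Carrierᴹ ℓ) → R ⊆ Q → ∀ {v} → v ∈ (π· (Q ᵛ)) → v ∈ (π· (R ᵛ))
    πᵛ-antitone R Q R⊆Q (u , u∈ , eq) = u , ᵛ-antitone {R} {Q} R⊆Q u∈ , eq

    Y-step : ∀ {s e s′} → s ⟶[ e ] s′ → ∀ {v} → v ∈ Y s′ → π^ᴹ e v ∈ Y s
    Y-step (A-step i) = πᵛ-antitone (B (inject₁ i)) (B (suc i)) (B-chain i)
    -- The claim is π u ∈ Bᵛ for u ∈ Aᵛ. As σ fixes π, the factor may be moved to the other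
    -- argument, where πB ⊆ A applies.
    Y-step A-top {v} (u , (u∈ , u⊥) , v≈) = π₀ *ₗ u ,
      (Nₖ₀-* π₀ u∈ , λ b b∈ → Integral-resp
        (trans (⟪⟫-*ʳ π₀ u b) (trans (*-congʳ σ-π₀) (sym (⟪⟫-*ˡ π₀ u b))))
        (u⊥ (π₀ *ₗ b) (πB⊆A (fromℕ m′) (b , b∈ , ≈ᴹ-refl)))) , *ₗ-congˡ v≈
    Y-step (B-step i) = πᵛ-antitone (A (suc i)) (A (inject₁ i)) (A-chain i)
    Y-step B-bottom = πᵛ-antitone (A zero) (B zero) A⊆B

  Contained : State → ℕ → State → Set ℓ
  Contained s e s′ = ∀ j {v} → v ∈ L s′ → (θ^ j) (π^ᴹ e v) ∈ Y s

  abstract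
    θ^-cong : ∀ j {u v} → u ≈ᴹ v → (θ^ j) u ≈ᴹ (θ^ j) v
    θ^-cong zero    eq = eq
    θ^-cong (suc j) eq = θ-cong (θ^-cong j eq)

    θ^-+ : ∀ j u v → (θ^ j) (u +ᴹ v) ≈ᴹ (θ^ j) u +ᴹ (θ^ j) v
    θ^-+ zero    u v = ≈ᴹ-refl
    θ^-+ (suc j) u v = ≈ᴹ-trans (θ-cong (θ^-+ j u v)) (θ-+ _ _)

    θ^-0 : ∀ j → (θ^ j) 0ᴹ ≈ᴹ 0ᴹ
    θ^-0 zero    = ≈ᴹ-refl
    θ^-0 (suc j) = ≈ᴹ-trans (θ-cong (θ^-0 j)) θ-0

    θ^-π₀ : ∀ j v → (θ^ j) (π₀ *ₗ v) ≈ᴹ π₀ *ₗ (θ^ j) v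
    θ^-π₀ zero    v = ≈ᴹ-refl
    θ^-π₀ (suc j) v = ≈ᴹ-trans (θ-cong (θ^-π₀ j v)) (θ-fixed σ-π₀ _)

    θ^-π^ᴹ : ∀ j e v → (θ^ j) (π^ᴹ e v) ≈ᴹ π^ᴹ e ((θ^ j) v)
    θ^-π^ᴹ j zero    v = ≈ᴹ-refl
    θ^-π^ᴹ j (suc e) v = ≈ᴹ-trans (θ^-π₀ j (π^ᴹ e v)) (*ₗ-congˡ (θ^-π^ᴹ j e v))

    θ^-θ : ∀ j v → θ ((θ^ j) v) ≡ (θ^ j) (θ v)
    θ^-θ zero    v = refl
    θ^-θ (suc j) v = ≡.cong θ (θ^-θ j v)

    -- Here w′ is w after j applications of σ². Moving scalars inward in this way shows that images
    -- under θ^j are submodules although θ^j is only semilinear.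
    θ^-ι : ∀ j w → ∃ λ (w′ : Wₖ) → ∀ v → (θ^ j) (ι w′ *ₗ v) ≈ᴹ ι w *ₗ (θ^ j) v
    θ^-ι zero w = w , λ v → ≈ᴹ-refl
    θ^-ι (suc j) w with σ²-ι w
    ... | w₁ , σ²w≈w₁ with θ^-ι j w₁
    ...   | w′ , eq = w′ , λ v → ≈ᴹ-trans (θ-cong (≈ᴹ-trans (eq v) (*ₗ-congʳ (sym σ²w≈w₁)))) (θ-* (ι w) ((θ^ j) v))

    θ-ι : ∀ w → ∃ λ (w′ : Wₖ) → ∀ v → θ (ι w *ₗ v) ≈ᴹ ι w′ *ₗ θ v
    θ-ι w with σ²-ι-surjective w
    ... | w′ , eq = w′ , λ v → ≈ᴹ-trans (θ-cong (*ₗ-congʳ (sym eq))) (θ-* (ι w′) v)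

    π^ᴹ-0 : ∀ e → π^ᴹ e 0ᴹ ≈ᴹ 0ᴹ
    π^ᴹ-0 zero    = ≈ᴹ-refl
    π^ᴹ-0 (suc e) = ≈ᴹ-trans (*ₗ-congˡ (π^ᴹ-0 e)) (*ₗ-zeroʳ π₀)

    π^ᴹ-* : ∀ e x v → π^ᴹ e (x *ₗ v) ≈ᴹ x *ₗ π^ᴹ e v
    π^ᴹ-* zero    x v = ≈ᴹ-refl
    π^ᴹ-* (suc e) x v = ≈ᴹ-trans (*ₗ-congˡ (π^ᴹ-* e x v)) (*ₗ-swap π₀ x _)

  Op : ℕ → ℕ → Carrierᴹ → Carrierᴹ
  Op j e v = (θ^ j) (π^ᴹ e v)

  abstract
    Op-cong : ∀ j e {u v} → u ≈ᴹ v → Op j e u ≈ᴹ Op j e v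
    Op-cong j e eq = θ^-cong j (π^ᴹ-cong e eq)

    Op-+ : ∀ j e u v → Op j e (u +ᴹ v) ≈ᴹ Op j e u +ᴹ Op j e v
    Op-+ j e u v = ≈ᴹ-trans (θ^-cong j (π^ᴹ-+ e u v)) (θ^-+ j _ _)

    Op-0 : ∀ j e → Op j e 0ᴹ ≈ᴹ 0ᴹ
    Op-0 j e = ≈ᴹ-trans (θ^-cong j (π^ᴹ-0 e)) (θ^-0 j)

    Op-ι : ∀ j e w → ∃ λ (w′ : Wₖ) → ∀ v → Op j e (ι w′ *ₗ v) ≈ᴹ ι w *ₗ Op j e v
    Op-ι j e w with θ^-ι j w
    ... | w′ , eq = w′ , λ v → ≈ᴹ-trans (θ^-cong j (π^ᴹ-* e (ι w′) v)) (eq (π^ᴹ e v))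

    Op-θ : ∀ j e v → θ (Op j e v) ≈ᴹ Op j e (θ v)
    Op-θ j e v = ≈ᴹ-trans (≈ᴹ-reflexive (θ^-θ j (π^ᴹ e v))) (θ^-cong j (θ-π^ᴹ e v))

    -- The new exponent e stands on the left so that the sum reduces to `E` or `suc E` for the
    -- exponents 0 and 1 of the edges.
    Op-Op : ∀ N E j e v → Op N E (Op j e v) ≈ᴹ Op (N +ℕ j) (e +ℕ E) v
    Op-Op N E j e v = ≈ᴹ-trans (θ^-cong N (≈ᴹ-sym (θ^-π^ᴹ j E (π^ᴹ e v))))
      (≈ᴹ-trans (≈ᴹ-reflexive (θ^-∘ N j (π^ᴹ E (π^ᴹ e v)))) (θ^-cong (N +ℕ j) (π^ᴹ-∘ e E v)))
      where
      θ^-∘ : ∀ N j v → (θ^ N) ((θ^ j) v) ≡ (θ^ (N +ℕ j)) v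
      θ^-∘ zero    j v = refl
      θ^-∘ (suc N) j v = ≡.cong θ (θ^-∘ N j v)
      π^ᴹ-swap : ∀ E v → π^ᴹ E (π₀ *ₗ v) ≈ᴹ π₀ *ₗ π^ᴹ E v
      π^ᴹ-swap E v = π^ᴹ-* E π₀ v
      π^ᴹ-∘ : ∀ e E v → π^ᴹ E (π^ᴹ e v) ≈ᴹ π^ᴹ (e +ℕ E) v
      π^ᴹ-∘ zero    E v = ≈ᴹ-refl
      π^ᴹ-∘ (suc e) E v = ≈ᴹ-trans (π^ᴹ-swap E (π^ᴹ e v)) (*ₗ-congˡ (π^ᴹ-∘ e E v))

  -- Links between neighbouring lattices.

  record Link (s : State) (j e : ℕ) (s′ : State) : Set ℓ where
    field
      into  : ∀ {v} → v ∈ L s′ → Op j e v ∈ L s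
      split : ∀ {v} → v ∈ L s → ∃ λ y → ∃ λ v′ → y ∈ Y s × v′ ∈ L s′ × v ≈ᴹ y +ᴹ Op j e v′

  -- In terms of τ = θ⁻¹: L s ∩ τ(L s) ⊆ Y s, respectively L s ⊆ τ(L s).
  Unstable Stable : State → Set ℓ
  Unstable s = ∀ v → v ∈ L s → θ v ∈ L s → v ∈ Y s
  Stable s   = ∀ v → v ∈ L s → θ v ∈ L s

  abstract
    ⊄Y⇒Link : ∀ {s e s′} j → (∀ {v} → v ∈ L s′ → Op j e v ∈ L s) →
      ¬ (∀ {v} → v ∈ L s′ → Op j e v ∈ Y s) → Link s j e s′
    ⊄Y⇒Link {s} {e} {s′} j into ⊄Y = record { into = into ; split = λ v∈ → L⊆Sum v∈ }
      where
      module L′ = IsSubmodule (L-isSubmodule s′)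
      module Ys = IsSubmodule (Y-isSubmodule s)
      Sum : Pred Carrierᴹ ℓ
      Sum v = ∃ λ y → ∃ λ v′ → y ∈ Y s × v′ ∈ L s′ × v ≈ᴹ y +ᴹ Op j e v′
      Sum-isSubmodule : IsSubmodule Sum
      Sum-isSubmodule = record
        { resp = λ { eq (y , v′ , y∈ , v′∈ , v≈) → y , v′ , y∈ , v′∈ , ≈ᴹ-trans (≈ᴹ-sym eq) v≈ }
        ; zero∈ = 0ᴹ , 0ᴹ , Ys.zero∈ , L′.zero∈ , ≈ᴹ-sym (≈ᴹ-trans (+ᴹ-congˡ (Op-0 j e)) (+ᴹ-identityʳ 0ᴹ))
        ; +-closed = λ { (y , v , y∈ , v∈ , eq) (y′ , v′ , y′∈ , v′∈ , eq′) →
            y +ᴹ y′ , v +ᴹ v′ , Ys.+-closed y∈ y′∈ , L′.+-closed v∈ v′∈ ,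
            ≈ᴹ-trans (+ᴹ-cong eq eq′) (≈ᴹ-trans (interchange _ _ _ _) (+ᴹ-congˡ (≈ᴹ-sym (Op-+ j e v v′)))) }
        ; ·-closed = λ { w (y , v , y∈ , v∈ , eq) → ι w *ₗ y , ι (proj₁ (Op-ι j e w)) *ₗ v ,
            Ys.·-closed w y∈ , L′.·-closed (proj₁ (Op-ι j e w)) v∈ ,
            ≈ᴹ-trans (*ₗ-congˡ eq) (≈ᴹ-trans (*ₗ-distribˡ (ι w) y (Op j e v))
              (+ᴹ-congˡ (≈ᴹ-sym (proj₂ (Op-ι j e w) v)))) } }
      Y⊆Sum : Y s ⊆ Sum
      Y⊆Sum {y} y∈ = y , 0ᴹ , y∈ , L′.zero∈ , ≈ᴹ-sym (≈ᴹ-trans (+ᴹ-congˡ (Op-0 j e)) (+ᴹ-identityʳ y))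
      Sum⊆L : Sum ⊆ L s
      Sum⊆L (y , v′ , y∈ , v′∈ , v≈) = IsSubmodule.resp (L-isSubmodule s) (≈ᴹ-sym v≈)
        (IsSubmodule.+-closed (L-isSubmodule s) (included (Y⋖L s) y∈) (into v′∈))
      Op∈Sum : ∀ {v} → v ∈ L s′ → Op j e v ∈ Sum
      Op∈Sum {v} v∈ = 0ᴹ , v , Ys.zero∈ , v∈ , ≈ᴹ-sym (+ᴹ-identityˡ _)
      L⊆Sum : L s ⊆ Sum
      L⊆Sum = choose (simple (Y⋖L s) Sum Sum-isSubmodule Y⊆Sum Sum⊆L)
        where
        choose : Sum ⊆ Y s ⊎ L s ⊆ Sum → L s ⊆ Sum
        choose (inj₁ Sum⊆Y) = ⊥-elim (⊄Y (λ v∈ → Sum⊆Y (Op∈Sum v∈)))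
        choose (inj₂ L⊆Sum) = L⊆Sum

    -- The least j with θʲ(π^e L s′) ⊄ Y s works: θʲ(π^e L s′) ⊆ θ(Y s) ⊆ L s.
    link : ∀ {s e s′} → s ⟶[ e ] s′ → ¬ Contained s e s′ → ∃ λ j → Link s j e s′
    link {s} {e} {s′} edge ¬contained with em {∃ λ j → ¬ (∀ {v} → v ∈ L s′ → Op j e v ∈ Y s)}
    ... | no none = ⊥-elim (¬contained (λ j {v} v∈ → decidable-stable em (λ ∉Y → none (j , λ ⊆Y → ∉Y (⊆Y v∈)))))
    ... | yes (j , ⊄Y) = descend j ⊄Y
      where
      descend : ∀ j → ¬ (∀ {v} → v ∈ L s′ → Op j e v ∈ Y s) → ∃ λ j → Link s j e s′
      descend zero ⊄Y = zero , ⊄Y⇒Link zero (L-step edge) ⊄Y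
      descend (suc j) ⊄Y = go em
        where
        go : Dec (∀ {v} → v ∈ L s′ → Op j e v ∈ Y s) → ∃ λ j → Link s j e s′
        go (yes ⊆Y) = suc j , ⊄Y⇒Link (suc j) (λ v∈ → θ-Y s (⊆Y v∈)) ⊄Y
        go (no ⊄Y′) = descend j ⊄Y′

    -- A θ-stable L s′ satisfies θ^j(π^e L s′) ⊆ π^e L s′, so a containment in Y s for j = 0 would
    -- give it for every j.
    stable-link : (∀ s → Stable s) →
      ∀ {s e s′} → s ⟶[ e ] s′ → ¬ Contained s e s′ → Link s 0 e s′
    stable-link stable {s} {e} {s′} edge ¬contained = ⊄Y⇒Link 0 (L-step edge) λ ⊆Y →
      ¬contained λ j {v} v∈ → IsSubmodule.resp (Y-isSubmodule s) (≈ᴹ-sym (θ^-π^ᴹ j e v)) (⊆Y (θ^-stable j v∈))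
      where
      θ^-stable : ∀ j {v} → v ∈ L s′ → (θ^ j) v ∈ L s′
      θ^-stable zero    v∈ = v∈
      θ^-stable (suc j) v∈ = stable s′ _ (θ^-stable j v∈)

  -- Composition of links and the contradiction.

  -- Only the power of π has to be controlled, so E is an index while the number N of translations
  -- is arbitrary. `absorb` is the invariant that disposes of the error term when the next link is
  -- substituted.
  record Reach (s s′ : State) (E : ℕ) : Set ℓ where
    field
      N      : ℕ
      into   : ∀ {v} → v ∈ L s′ → Op N E v ∈ L s
      absorb : ∀ {y} → y ∈ Y s′ → Op N E y ∈ Y s
      split  : ∀ {v} → v ∈ L s → ∃ λ y → ∃ λ v′ → y ∈ Y s × v′ ∈ L s′ × v ≈ᴹ y +ᴹ Op N E v′

  abstract
    start : ∀ s → Reach s s 0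
    start s = record { N = 0 ; into = λ v∈ → v∈ ; absorb = λ y∈ → y∈
      ; split = λ {v} v∈ → 0ᴹ , v , IsSubmodule.zero∈ (Y-isSubmodule s) , v∈ , ≈ᴹ-sym (+ᴹ-identityˡ v) }

    -- Absorption for the new end s″ is left as a hypothesis, because it is the one point where the
    -- stable and the unstable case differ.
    extend : ∀ {s s′ s″ E j e} (r : Reach s s′ E) → Link s′ j e s″ →
      (∀ {y} → y ∈ Y s″ → Op (Reach.N r) E (Op j e y) ∈ Y s) → Reach s s″ (e +ℕ E)
    extend {s} {s′} {s″} {E} {j} {e} r l absorb″ = record
      { N = N +ℕ j
      ; into = λ {v} v∈ → IsSubmodule.resp (L-isSubmodule s) (Op-Op N E j e v) (into (Link.into l v∈))
      ; absorb = λ {y} y∈ → IsSubmodule.resp (Y-isSubmodule s) (Op-Op N E j e y) (absorb″ y∈)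
      ; split = λ v∈ → refine (split v∈) }
      where
      open Reach r
      refine : ∀ {v} → (∃ λ y → ∃ λ v′ → y ∈ Y s × v′ ∈ L s′ × v ≈ᴹ y +ᴹ Op N E v′) →
        ∃ λ y → ∃ λ v′ → y ∈ Y s × v′ ∈ L s″ × v ≈ᴹ y +ᴹ Op (N +ℕ j) (e +ℕ E) v′
      refine (y , v′ , y∈ , v′∈ , v≈) with Link.split l v′∈
      ... | y′ , v″ , y′∈ , v″∈ , v′≈ = y +ᴹ Op N E y′ , v″ ,
        IsSubmodule.+-closed (Y-isSubmodule s) y∈ (absorb y′∈) , v″∈ ,
        ≈ᴹ-trans v≈ (≈ᴹ-trans (+ᴹ-congˡ (≈ᴹ-trans (Op-cong N E v′≈) (≈ᴹ-trans (Op-+ N E y′ (Op j e v″))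
          (+ᴹ-congˡ (Op-Op N E j e v″))))) (≈ᴹ-sym (+ᴹ-assoc y _ _)))

    -- Going round the chain multiplies by π once, at the edge A-top.
    reach-all : ∀ s → (∀ {s′ s″ E e} → s′ ⟶[ e ] s″ → Reach s s′ E → Reach s s″ (e +ℕ E)) →
      ∀ E → ∃ λ s′ → Reach s s′ E
    reach-all s next zero = s , start s
    reach-all s next (suc E) = 𝐁 (fromℕ m′) , next A-top (toTop (reach-all s next E))
      where
      ascend : ∀ i → Reach s (𝐀 i) E → Reach s (𝐀 (fromℕ m′)) E
      ascend = >-weakInduction (λ i → Reach s (𝐀 i) E → Reach s (𝐀 (fromℕ m′)) E) (λ r → r)
        (λ i rec r → rec (next (A-step i) r))
      descend : ∀ i → Reach s (𝐁 i) E → Reach s (𝐀 zero) E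
      descend = <-weakInduction (λ i → Reach s (𝐁 i) E → Reach s (𝐀 zero) E) (next B-bottom)
        (λ i rec r → rec (next (B-step i) r))
      toTop : (∃ λ s′ → Reach s s′ E) → Reach s (𝐀 (fromℕ m′)) E
      toTop (𝐀 i , r) = ascend i r
      toTop (𝐁 i , r) = ascend zero (descend i r)

    private
      top : Fin (suc m′)
      top = fromℕ m′

      A-top⊆A : ∀ i → A top ⊆ A i
      A-top⊆A = >-weakInduction (λ i → A top ⊆ A i) (λ v∈ → v∈) (λ i rec v∈ → A-chain i (rec v∈))

      A⊆A₀ : ∀ i → A i ⊆ A zero
      A⊆A₀ = <-weakInduction (λ i → A i ⊆ A zero) (λ v∈ → v∈) (λ i rec v∈ → rec (A-chain i v∈))

      B₀⊆B : ∀ i → B zero ⊆ B i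
      B₀⊆B = <-weakInduction (λ i → B zero ⊆ B i) (λ v∈ → v∈) (λ i rec v∈ → B-chain i (rec v∈))

      B⊆B-top : ∀ i → B i ⊆ B top
      B⊆B-top = >-weakInduction (λ i → B i ⊆ B top) (λ v∈ → v∈) (λ i rec v∈ → rec (B-chain i v∈))

      L⊆B-top : ∀ s → L s ⊆ B top
      L⊆B-top (𝐀 i) v∈ = B₀⊆B top (A⊆B (A⊆A₀ i v∈))
      L⊆B-top (𝐁 i) v∈ = B⊆B-top i v∈

      πA-top⊆Y : ∀ s → (π· A top) ⊆ Y s
      πA-top⊆Y (𝐀 i) (u , u∈ , eq) = u , A⊆Bᵛ i (A-top⊆A i u∈) , eq
      πA-top⊆Y (𝐁 i) (u , u∈ , eq) = u , B⊆Aᵛ i (B₀⊆B i (A⊆B (A-top⊆A zero u∈))) , eq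

      πτA⊆A : ∀ {a} → a ∈ A top → (π₀ *ₗ τ a) ∈ A top
      πτA⊆A {a} a∈ = included (Y⋖L (𝐀 top))
        (τ a , τ-ᵛ (lattice⊆Nₖ₀ (A-lattice top)) (B⊆Aᵛ top) a∈ , ≈ᴹ-refl)

    -- One factor π carries every L s′ into A_m, since πB_m ⊆ A_m. The factors counted by `exponent`
    -- bring the closure of A_m back into A_m, and the last one carries A_m into every Y s.
    bound : ℕ
    bound = suc (suc (exponent (A-lattice top) (Λᴬ-closure top)))

    Op-bound : ∀ s s′ N {v} → v ∈ L s′ → Op N bound v ∈ Y s
    Op-bound s s′ N {v} v∈ = πA-top⊆Y s (π^ᴹ t ((θ^ N) (π₀ *ₗ v)) ,
      π^ᴹ-T⊆ (lattice-isSubmodule (A-lattice top)) πτA⊆A t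
        (Generated⊆T (A-lattice top) (Λᴬ-closure top)
          (θ^-A⊆Generated (A-lattice top) (Λᴬ-closure top) N (πB⊆A top (v , L⊆B-top s′ v∈ , ≈ᴹ-refl)))) ,
      ≈ᴹ-trans (θ^-π^ᴹ N bound v) (*ₗ-congˡ (≈ᴹ-trans (≈ᴹ-sym (π^ᴹ-* t π₀ ((θ^ N) v)))
        (π^ᴹ-cong t (≈ᴹ-sym (θ^-π₀ N v))))))
      where
      t : ℕ
      t = exponent (A-lattice top) (Λᴬ-closure top)

    ¬next : ∀ s → ¬ (∀ {s′ s″ E e} → s′ ⟶[ e ] s″ → Reach s s′ E → Reach s s″ (e +ℕ E))
    ¬next s next = proper (Y⋖L s) (λ v∈ → L⊆Y v∈)
      where
      L⊆Y : L s ⊆ Y s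
      L⊆Y v∈ with reach-all s next bound
      ... | s′ , r with Reach.split r v∈
      ...   | y , v′ , y∈ , v′∈ , v≈ = IsSubmodule.resp (Y-isSubmodule s) (≈ᴹ-sym v≈)
        (IsSubmodule.+-closed (Y-isSubmodule s) y∈ (Op-bound s s′ (Reach.N r) v′∈))

    unstable-impossible : (∀ {s e s′} → s ⟶[ e ] s′ → ¬ Contained s e s′) →
      ∀ s → ¬ Unstable s
    unstable-impossible ¬contained s L∩τL⊆Y = ¬next s next
      where
      next : ∀ {s′ s″ E e} → s′ ⟶[ e ] s″ → Reach s s′ E → Reach s s″ (e +ℕ E)
      next {s′} {s″} {E} {e} edge r with link edge (¬contained edge)
      -- Both y and θ y lie in L s″. The composite operator commutes with θ, so the image x of y
      -- satisfies x ∈ L s and θ x ∈ L s, which instability turns into x ∈ Y s.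
      ... | j , l = extend r l λ {y} y∈ → L∩τL⊆Y _ (into (Link.into l (included (Y⋖L s″) y∈)))
              (IsSubmodule.resp (L-isSubmodule s)
                (≈ᴹ-sym (≈ᴹ-trans (Op-θ N E (Op j e y)) (Op-cong N E (Op-θ j e y))))
                (into (Link.into l (θ-Y s″ y∈))))
        where open Reach r

    stable-impossible : (∀ {s e s′} → s ⟶[ e ] s′ → ¬ Contained s e s′) →
      ¬ (∀ s → Stable s)
    stable-impossible ¬contained stable = ¬next (𝐀 zero) next
      where
      next : ∀ {s′ s″ E e} → s′ ⟶[ e ] s″ → Reach (𝐀 zero) s′ E → Reach (𝐀 zero) s″ (e +ℕ E)
      next edge r = extend r (stable-link stable edge (¬contained edge)) (λ y∈ → Reach.absorb r (Y-step edge y∈))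

    -- L ∩ τ(L) is a submodule between Y and L by double duality, and the simple quotient L/Y leaves
    -- only the two ends.
    stable-or-unstable : ∀ s → Unstable s ⊎ Stable s
    stable-or-unstable s = result (simple (Y⋖L s) L∩τL isSub
      (λ y∈ → included (Y⋖L s) y∈ , θ-Y s y∈) (λ v∈ → proj₁ v∈))
      where
      module Ls = IsSubmodule (L-isSubmodule s)
      L∩τL : Pred Carrierᴹ ℓ
      L∩τL v = v ∈ L s × θ v ∈ L s
      isSub : IsSubmodule L∩τL
      isSub = record
        { resp = λ { eq (v∈ , θv∈) → Ls.resp eq v∈ , Ls.resp (θ-cong eq) θv∈ }
        ; zero∈ = Ls.zero∈ , Ls.resp (≈ᴹ-sym θ-0) Ls.zero∈
        ; +-closed = λ { {u} {v} (u∈ , θu∈) (v∈ , θv∈) → Ls.+-closed u∈ v∈ ,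
            Ls.resp (≈ᴹ-sym (θ-+ u v)) (Ls.+-closed θu∈ θv∈) }
        ; ·-closed = λ { w {v} (v∈ , θv∈) → Ls.·-closed w v∈ ,
            Ls.resp (≈ᴹ-sym (proj₂ (θ-ι w) v)) (Ls.·-closed (proj₁ (θ-ι w)) θv∈) } }
      result : L∩τL ⊆ Y s ⊎ L s ⊆ L∩τL → Unstable s ⊎ Stable s
      result (inj₁ ⊆Y) = inj₁ λ v v∈ θv∈ → ⊆Y (v∈ , θv∈)
      result (inj₂ L⊆) = inj₂ λ v v∈ → proj₂ (L⊆ v∈)

    -- A single unstable lattice is already contradictory, whatever the others are; hence in the
    -- remaining case all of them are stable simultaneously.
    ¬all-fail : ¬ (∀ {s e s′} → s ⟶[ e ] s′ → ¬ Contained s e s′)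
    ¬all-fail ¬contained = stable-impossible ¬contained stable
      where
      stable : ∀ s → Stable s
      stable s with stable-or-unstable s
      ... | inj₁ ⊆Y = ⊥-elim (unstable-impossible ¬contained s ⊆Y)
      ... | inj₂ θL⊆L = θL⊆L

    -- From containments to elements of the Bruhat-Tits type.

    C-* : ∀ c → σ c ≈ c → ∀ {u v} → u ∈ C → v ≈ᴹ c *ₗ u → v ∈ C
    C-* c σc≈c {u} (u∈ , τu) v≈ = Nₖ₀-resp (≈ᴹ-sym v≈) (Nₖ₀-* c u∈) ,
      ≈ᴹ-trans (τ-cong v≈) (≈ᴹ-trans (τ-fixed σc≈c u) (≈ᴹ-trans (*ₗ-congˡ τu) (≈ᴹ-sym v≈)))

    πᵛ-Multiple : ∀ c → c ≈ π₀ → ∀ {Q u v} → u ∈ (π· (Q ᵛ)) → v ∈ Q → Multiple c ⟪ u , v ⟫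
    πᵛ-Multiple c c≈π {Q} {u} {v} (w , (_ , w⊥) , u≈) v∈ with w⊥ v v∈
    ... | x , eq = x , trans (⟪⟫-cong u≈ ≈ᴹ-refl) (trans (⟪⟫-*ˡ π₀ w v) (*-cong (sym c≈π) eq))

    σ-^ : ∀ i → σ (π₀ Fₖ.^ i) ≈ π₀ Fₖ.^ i
    σ-^ zero = σ.1#-homo
    σ-^ (suc i) = trans (σ.*-homo π₀ (π₀ Fₖ.^ i)) (*-cong σ-π₀ (σ-^ i))

    π^1≈π : π₀ Fₖ.^ 1 ≈ π₀
    π^1≈π = Fₖ.*-identityʳ π₀

    -- The containment says θ^j(A₁) ⊆ πA₁ᵛ and gives Λ ⊆ πΛᵛ. The other inclusion π²Λᵛ ⊆ Λ holds at
    -- every point, from πA₁ᵛ ⊆ B₁ and πB₁ ⊆ A₁. The factor is written `π₀ Fₖ.^ 1` because `𝓛 1ℤ`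
    -- unfolds to it.
    Contained⇒0∈I : Contained (𝐁 zero) 0 (𝐀 zero) → 𝓛 1ℤ (Λᴬ zero)
    Contained⇒0∈I contained = proj₁ (Λᴬ-closure zero) , π²Λᵛ⊆Λ ,
      Λ⊆c·Λ′ᵛᶜ (proj₁ (Λᴬ-closure zero)) (proj₁ (Λᴬ-closure zero)) (π₀ Fₖ.^ 1)
        (λ eq → π₀≉0 (trans (sym π^1≈π) eq)) (σ-^ 1)
        (ΛP-ΛQ (A-lattice zero) (A-lattice zero) (Λᴬ-closure zero) (Λᴬ-closure zero) (π₀ Fₖ.^ 1) (σ-^ 1)
          (λ j u∈ v∈ → πᵛ-Multiple (π₀ Fₖ.^ 1) π^1≈π (contained j u∈) v∈))
      where
      π²Λᵛ⊆Λ : image ((π₀ Fₖ.^ 2) *ₗ_) (Λᴬ zero ᵛᶜ) ⊆ Λᴬ zero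
      π²Λᵛ⊆Λ {v} (u , u∈ , v≈) = C∩Generated⊆Λ (A-lattice zero) (Λᴬ-closure zero)
        (C-* (π₀ Fₖ.^ 2) (σ-^ 2) (proj₁ u∈) v≈)
        (A⊆Generated (A-lattice zero) (Λᴬ-closure zero) (πB⊆A zero (π₀ *ₗ u ,
          included (Y⋖L (𝐁 zero)) (u , Λᵛᶜ⊆Aᵛ (A-lattice zero) (Λᴬ-closure zero) u∈ , ≈ᴹ-refl) ,
          ≈ᴹ-trans v≈ (≈ᴹ-trans (*ₗ-assoc π₀ _ u) (*ₗ-congˡ (*ₗ-congʳ π^1≈π))))))

    -- Cancelling π in θ^j(πB_m) ⊆ πB_mᵛ leaves θ^j(B_m) ⊆ B_mᵛ, hence Λ ⊆ Λᵛ. The inclusion πΛᵛ ⊆ Λ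
    -- holds at every point, from πB_mᵛ ⊆ A_m ⊆ B_m.
    Contained⇒m∈I : Contained (𝐀 (fromℕ m′)) 1 (𝐁 (fromℕ m′)) → 𝓛 0ℤ (Λᴮ (fromℕ m′))
    Contained⇒m∈I contained = proj₁ Λ-closure , πΛᵛ⊆Λ ,
      Λ⊆c·Λ′ᵛᶜ (proj₁ Λ-closure) (proj₁ Λ-closure) (π₀ Fₖ.^ 0) Fₖ.1≉0 (σ-^ 0)
        (ΛP-ΛQ B-lat B-lat Λ-closure Λ-closure (π₀ Fₖ.^ 0) (σ-^ 0) orthogonal)
      where
      Λ-closure : IsτClosure (Λᴮ (fromℕ m′)) (B (fromℕ m′))
      Λ-closure = Λᴮ-closure (fromℕ m′)
      B-lat : IsLatticeCₖ (B (fromℕ m′))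
      B-lat = B-lattice (fromℕ m′)
      orthogonal : ∀ j {u v} → u ∈ B (fromℕ m′) → v ∈ B (fromℕ m′) → Multiple 1# ⟪ (θ^ j) u , v ⟫
      orthogonal j {u} {v} u∈ v∈ with contained j u∈
      ... | w , (_ , w⊥) , πθu≈πw = Integral⇒Multiple (Integral-resp
        (⟪⟫-cong (*ₗ-cancelˡ π₀≉0 (≈ᴹ-trans (≈ᴹ-sym πθu≈πw) (θ^-π₀ j u))) ≈ᴹ-refl) (w⊥ v v∈))
      πΛᵛ⊆Λ : image ((π₀ Fₖ.^ 1) *ₗ_) (Λᴮ (fromℕ m′) ᵛᶜ) ⊆ Λᴮ (fromℕ m′)
      πΛᵛ⊆Λ {v} (u , u∈ , v≈) = C∩Generated⊆Λ B-lat Λ-closure (C-* (π₀ Fₖ.^ 1) (σ-^ 1) (proj₁ u∈) v≈)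
        (A⊆Generated B-lat Λ-closure (B₀⊆B (fromℕ m′) (A⊆B (A⊆A₀ (fromℕ m′) (included (Y⋖L (𝐀 (fromℕ m′)))
          (u , Λᵛᶜ⊆Aᵛ B-lat Λ-closure u∈ , ≈ᴹ-trans v≈ (*ₗ-congʳ π^1≈π)))))))

    -- Two edges of the chain, one among the A's and one among the B's, lead to the same element of
    -- I. On this one the translates of A_{i+1} are paired with B_i, in the opposite order to the
    -- claim, so hermitian symmetry on C is needed.
    Contained⇒i∈I : ∀ i → Contained (𝐀 (inject₁ i)) 0 (𝐀 (suc i)) →
      Λᴮ (inject₁ i) ⊆ (π· (Λᴬ (suc i) ᵛᶜ))
    Contained⇒i∈I i contained = Λ⊆c·Λ′ᵛᶜ (proj₁ (Λᴮ-closure (inject₁ i))) (proj₁ (Λᴬ-closure (suc i))) π₀ π₀≉0 σ-π₀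
      (ΛQ-ΛP (A-lattice (suc i)) (B-lattice (inject₁ i)) (Λᴬ-closure (suc i)) (Λᴮ-closure (inject₁ i)) π₀ σ-π₀
        (λ j u∈ v∈ → πᵛ-Multiple π₀ Fₖ.refl (contained j u∈) v∈))

    Contained⇒i∈I′ : ∀ i → Contained (𝐁 (suc i)) 0 (𝐁 (inject₁ i)) →
      Λᴮ (inject₁ i) ⊆ (π· (Λᴬ (suc i) ᵛᶜ))
    Contained⇒i∈I′ i contained = Λ⊆c·Λ′ᵛᶜ (proj₁ (Λᴮ-closure (inject₁ i))) (proj₁ (Λᴬ-closure (suc i))) π₀ π₀≉0 σ-π₀
      (ΛP-ΛQ (B-lattice (inject₁ i)) (A-lattice (suc i)) (Λᴮ-closure (inject₁ i)) (Λᴬ-closure (suc i)) π₀ σ-π₀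
        (λ j u∈ v∈ → πᵛ-Multiple π₀ Fₖ.refl (contained j u∈) v∈))

    m∈I : 𝓛 0ℤ (Λᴮ (fromℕ m′)) → BruhatTitsType 𝐡 𝒩 Λ (suc (fromℕ m′))
    m∈I x rewrite view-fromℕ m′ = x

    i∈I : ∀ i → Λᴮ (inject₁ i) ⊆ (π· (Λᴬ (suc i) ᵛᶜ)) → BruhatTitsType 𝐡 𝒩 Λ (suc (inject₁ i))
    i∈I i x rewrite view-inject₁ i = x

    Contained⇒satisfiable : ∀ {s e s′} → s ⟶[ e ] s′ → Contained s e s′ → Satisfiable (BruhatTitsType 𝐡 𝒩 Λ)
    Contained⇒satisfiable (A-step i) c = suc (inject₁ i) , i∈I i (Contained⇒i∈I i c)
    Contained⇒satisfiable A-top c = suc (fromℕ m′) , m∈I (Contained⇒m∈I c)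
    Contained⇒satisfiable (B-step i) c = suc (inject₁ i) , i∈I i (Contained⇒i∈I′ i c)
    Contained⇒satisfiable B-bottom c = zero , Contained⇒0∈I c

    satisfiable : Satisfiable (BruhatTitsType 𝐡 𝒩 Λ)
    satisfiable = decidable-stable em λ empty → ¬all-fail λ edge c → empty (Contained⇒satisfiable edge c)

lemma2p30 :
    ∀ {ℓ} → ExcludedMiddle ℓ →
    {p n m′ : ℕ} → Prime p → p ≢ 2 → 1 ≤ n →
    (D : UnramifiedQuadraticExtension p ℓ) →
    (𝕎 : RelativeWittVectors D) →
    (𝐡 : LevelStructure n m′) →
    (K₂ : WittFractionField D 𝕎 (UnramifiedQuadraticExtension.𝔽q² D) (UnramifiedQuadraticExtension.𝔽q→𝔽q² D)) →
    (𝕏 : FramingObject D K₂ n (LevelStructure.h 𝐡 (Fin.zero))) →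
    (X : AlgebraicallyClosedExtension D) →
    (𝒩 : BaseChange D K₂ 𝕏 X) →
    (P : Point 𝐡 𝒩) →
    (Λ : τClosures 𝐡 𝒩 P) →
    Satisfiable (BruhatTitsType 𝐡 𝒩 Λ)
lemma2p30 em p-prime _ 1≤n D 𝕎 𝐡 K₂ 𝕏 X 𝒩 P Λ = Chain.satisfiable em p-prime 1≤n 𝐡 𝒩 P Λ
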